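{- For every positive integer $\ell$, every graph $G$ and every $S\subseteq V(G)$: if there is a tangle $\mathcal T$ of $(G,S)$ of order $3f_{\boxplus}(6144\ell^4)+1$, then $G$ contains an $S$-outer-rooted model of $\boxplus_\ell$.
   Context: $\boxplus_\ell$ is the $\ell\times\ell$ grid (vertex set $[\ell]^2$, $(i,j)\sim(i',j')$ iff $|i-i'|+|j-j'|=1$), drawn in the standard way, so its outer-face vertices are those with some coordinate in $\{1,\ell\}$. A model of $H$ in $G$ is a family $(B_x\mid x\in V(H))$ of pairwise disjoint subsets of $V(G)$ such that each $G[B_x]$ is non-empty and connected and for every edge $xy\in E(H)$ there is an edge of $G$ between $B_x$ and $B_y$; a model of $\boxplus_\ell$ is $S$-outer-rooted if $B_x\cap S\ne\emptyset$ for every outer-face vertex $x$. $f_{\boxplus}$ is the minimum function such that for every positive integer $\ell$, every graph with no model of $\boxplus_\ell$ has treewidth at most $f_{\boxplus}(\ell)$. A separation of $G$ is a pair $(A,B)$ of subgraphs of $G$ with $A\cup B=G$ and $E(A\cap B)=\emptyset$; its order is $|V(A)\cap V(B)|$. For a positive integer $k$, a tangle of order $k$ in $G$ is a family $\mathcal T$ of separations of $G$ of order less than $k$ such that: (T1) for every separation $(A,B)$ of order at most $k-1$, $(A,B)\in\mathcal T$ or $(B,A)\in\mathcal T$; (T2) for all $(A_1,B_1),(A_2,B_2),(A_3,B_3)\in\mathcal T$, $A_1\cup A_2\cup A_3\neq G$; (T3) for every $(A,B)\in\mathcal T$, $V(A)\ne V(G)$. It is a tangle of $(G,S)$ if moreover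 (T4) for every $(A,B)\in\mathcal T$, $S\not\subseteq V(A)$. -}

module Defs where

open import Data.Nat using (ℕ; zero; suc; _+_; _*_; _∸_; _^_; _≤_; _<_; ∣_-_∣; _≡ᵇ_)
open import Data.Nat.Properties using (∣-∣-comm; ∣n-n∣≡0)
import Data.Nat as ℕ
open import Data.Bool using (Bool; true; false)
open import Data.Fin using (Fin; toℕ; remQuot; inject₁; fromℕ) renaming (zero to fzero; suc to fsuc)
open import Data.Fin.Subset using (Subset; _∈_; _∉_; _∩_; ∣_∣)
open import Data.Product using (Σ; ∃; ∃-syntax; _×_; _,_; proj₁; proj₂)
open import Data.Sum using (_⊎_)
open import Data.Unit using (⊤)
open import Relation.Nullary using (¬_)
open import Relation.Binary.PropositionalEquality using (_≡_; _≢_; refl; cong; cong₂; trans)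
import Data.Sum
open import Data.Vec using (tabulate; lookup)
open import Function.Definitions using (Injective)

record Graph (n : ℕ) : Set where
  field
    adj    : Fin n → Fin n → Bool
    sym    : ∀ u v → adj u v ≡ adj v u
    irrefl : ∀ u → adj u u ≡ false
open Graph public

module _ {n : ℕ} (G : Graph n) where

  data Walk (P : Fin n → Set) : Fin n → Fin n → Set where
    here : ∀ {u} → P u → Walk P u u
    step : ∀ {u w v} → P u → adj G u w ≡ true → Walk P w v → Walk P u v

  -- G[X] is connected (X nonempty is required separately where needed)
  InducedConnected : Subset n → Set
  InducedConnected X = ∀ u v → u ∈ X → v ∈ X → Walk (λ w → w ∈ X) u v

  Connected : Set
  Connected = ∀ u v → Walk (λ _ → ⊤) u v

  record Cycle : Set where
    field
      len   : ℕ
      c     : Fin (suc (suc (suc len))) → Fin n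
      inj   : Injective _≡_ _≡_ c
      cons  : ∀ (i : Fin (suc (suc len))) → adj G (c (inject₁ i)) (c (fsuc i)) ≡ true
      close : adj G (c (fromℕ (suc (suc len)))) (c fzero) ≡ true

  IsTree : Set
  IsTree = (1 ≤ n) × Connected × ¬ Cycle

record TreeDecomposition {n : ℕ} (G : Graph n) (k : ℕ) : Set where
  field
    m        : ℕ
    T        : Graph m
    isTree   : IsTree T
    bag      : Fin m → Subset n
    coverV   : ∀ v → ∃[ t ] (v ∈ bag t)
    coverE   : ∀ u v → adj G u v ≡ true → ∃[ t ] (u ∈ bag t × v ∈ bag t)
    subtree  : ∀ v → InducedConnected T (tabulate (λ t → lookup (bag t) v))
    width    : ∀ t → ∣ bag t ∣ ≤ suc k

TwAtMost : ∀ {n} → Graph n → ℕ → Set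
TwAtMost G k = TreeDecomposition G k

record Model {h n : ℕ} (H : Graph h) (G : Graph n) : Set where
  field
    B        : Fin h → Subset n
    nonempty : ∀ x → ∃[ v ] (v ∈ B x)
    disjoint : ∀ x y → x ≢ y → ∀ v → v ∈ B x → v ∉ B y
    conn     : ∀ x → InducedConnected G (B x)
    edges    : ∀ x y → adj H x y ≡ true →
               ∃[ u ] ∃[ v ] (u ∈ B x × v ∈ B y × adj G u v ≡ true)
open Model public

-- The ℓ × ℓ grid, vertex set Fin (ℓ * ℓ) ≅ Fin ℓ × Fin ℓ via remQuot
-- (coordinates are 0-indexed: [ℓ] is represented by {0, …, ℓ-1})

coord : ∀ ℓ → Fin (ℓ * ℓ) → ℕ × ℕ
coord ℓ x = toℕ (proj₁ (remQuot {ℓ} ℓ x)) , toℕ (proj₂ (remQuot {ℓ} ℓ x))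

dist : ℕ × ℕ → ℕ × ℕ → ℕ
dist (i , j) (i' , j') = ∣ i - i' ∣ + ∣ j - j' ∣

private
  dist-sym : ∀ p q → dist p q ≡ dist q p
  dist-sym (i , j) (i' , j') = cong₂ _+_ (∣-∣-comm i i') (∣-∣-comm j j')

  dist-refl : ∀ p → dist p p ≡ 0
  dist-refl (i , j) = cong₂ _+_ (∣n-n∣≡0 i) (∣n-n∣≡0 j)

grid : ∀ ℓ → Graph (ℓ * ℓ)
grid ℓ = record
  { adj    = λ x y → dist (coord ℓ x) (coord ℓ y) ≡ᵇ 1
  ; sym    = λ x y → cong (_≡ᵇ 1) (dist-sym (coord ℓ x) (coord ℓ y))
  ; irrefl = λ x → cong (_≡ᵇ 1) (dist-refl (coord ℓ x))
  }

OuterVertex : ∀ ℓ → Fin (ℓ * ℓ) → Set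
OuterVertex ℓ x =
  proj₁ (coord ℓ x) ≡ 0 ⊎ proj₁ (coord ℓ x) ≡ ℓ ∸ 1 ⊎
  proj₂ (coord ℓ x) ≡ 0 ⊎ proj₂ (coord ℓ x) ≡ ℓ ∸ 1

OuterRooted : ∀ ℓ {n} {G : Graph n} → Subset n → Model (grid ℓ) G → Set
OuterRooted ℓ S M = ∀ x → OuterVertex ℓ x → ∃[ v ] (v ∈ B M x × v ∈ S)

GridBound : ℕ → ℕ → Set
GridBound ℓ k = ∀ n (G : Graph n) → ¬ Model (grid ℓ) G → TwAtMost G k

IsFGrid : ℕ → ℕ → Set
IsFGrid ℓ k = GridBound ℓ k × (∀ k' → GridBound ℓ k' → k ≤ k')

record Subgraph {n : ℕ} (G : Graph n) : Set where
  field
    V     : Subset n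
    E     : Fin n → Fin n → Bool
    E⊆    : ∀ u v → E u v ≡ true → adj G u v ≡ true
    Esym  : ∀ u v → E u v ≡ E v u
    Eends : ∀ u v → E u v ≡ true → u ∈ V
open Subgraph public

record Separation {n : ℕ} (G : Graph n) : Set where
  constructor sep
  field
    A B    : Subgraph G
    coverV : ∀ v → v ∈ V A ⊎ v ∈ V B
    coverE : ∀ u v → adj G u v ≡ true → E A u v ≡ true ⊎ E B u v ≡ true
    disjE  : ∀ u v → E A u v ≡ true → E B u v ≡ false
open Separation public

order : ∀ {n} {G : Graph n} → Separation G → ℕ
order s = ∣ V (A s) ∩ V (B s) ∣

private
  bool-disj : ∀ (a b : Bool) → (a ≡ true → b ≡ false) → b ≡ true → a ≡ false
  bool-disj false _ _ _ = refl
  bool-disj true true f e with f refl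
  ... | ()
  bool-disj true false f ()

swap : ∀ {n} {G : Graph n} → Separation G → Separation G
swap {G = G} (sep A₀ B₀ cV cE dE) = sep B₀ A₀
  (λ v → Data.Sum.swap (cV v))
  (λ u v e → Data.Sum.swap (cE u v e))
  (λ u v e → flip-disj u v e)
  where
    flip-disj : ∀ u v → E B₀ u v ≡ true → E A₀ u v ≡ false
    flip-disj u v e = bool-disj (E A₀ u v) (E B₀ u v) (dE u v) e

Union3IsG : ∀ {n} {G : Graph n} → Subgraph G → Subgraph G → Subgraph G → Set
Union3IsG {G = G} A₁ A₂ A₃ =
  (∀ v → v ∈ V A₁ ⊎ v ∈ V A₂ ⊎ v ∈ V A₃) ×
  (∀ u v → adj G u v ≡ true → E A₁ u v ≡ true ⊎ E A₂ u v ≡ true ⊎ E A₃ u v ≡ true)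

record Tangle {n : ℕ} (G : Graph n) (S : Subset n) (k : ℕ) : Set₁ where
  field
    mem : Separation G → Set
    ord : ∀ s → mem s → order s < k
    T1  : ∀ s → order s ≤ k ∸ 1 → mem s ⊎ mem (swap s)
    T2  : ∀ s₁ s₂ s₃ → mem s₁ → mem s₂ → mem s₃ →
          ¬ Union3IsG (A s₁) (A s₂) (A s₃)
    T3  : ∀ s → mem s → ¬ (∀ v → v ∈ V (A s))
    T4  : ∀ s → mem s → ¬ (∀ v → v ∈ S → v ∈ V (A s))

-- A tangle of (G , S) of order 3f + 1 yields, by submodularity, a set X ⊆ S of 3f + 1 vertices such
-- that every separation (C , D) has |C ∩ X| ≤ |C ∩ D| or |D ∩ X| ≤ |C ∩ D|. Adding three apex
-- vertices to G and to X makes X large enough to force treewidth more than f, hence a grid, and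
-- deleting the apices costs only a constant fraction of the rows. If a small cut separates X from
-- this grid, then some edge of the grid can be deleted while X keeps its property, so by induction
-- on the number of edges there is a grid that no cut of order less than k = 10ℓ separates from X.
-- Now delete edges outside the grid as long as X (made minimal) keeps this property. Behind the
-- largest cut of order k only edges of the grid survive, so on a band of rows behind that cut k
-- disjoint paths from X arrive through its two border rows, at least 5ℓ of them through the same
-- one and in distinct columns. Grouping columns gives a 3ℓ × 5ℓ grid with its top row rooted in S,
-- and three times folding columns around the left side roots the other sides of an ℓ × ℓ grid.

module Submission where

-- The set X replaces the tangle because its property mentions vertex sets only: it can be tested
-- again after each edge deletion, by pushing a separation of the smaller graph off the grid to get
-- one of the larger graph, and the tangle is never transported. Three apices suffice because bags
-- have at most f + 1 vertices and the treewidth argument may cut X into three pieces of that size,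
-- so X needs 3f + 4 vertices. Each apex removal halves the rows, which is the factor 8 in 6144 = 8
-- * 768. The two rounds of deletions differ. In the first the grid is expendable, since treewidth
-- yields a new one after every deletion, and X must stay linked. In the second the grid is fixed
-- and only the freeness of the roots matters. Whether all separations of a graph have large order
-- is not decided, so the construction runs under double negation. It is removed at the end because
-- a finite graph has finitely many candidate models.

open import Defs
open import Data.Nat using (ℕ; zero; suc; _+_; _*_; _∸_; _^_; _≤_; _<_; z≤n; s≤s; _⊔_; _<?_; _≤?_; _≡ᵇ_; ∣_-_∣; pred)
open import Data.Nat.Properties hiding (_≟_; suc-injective)
open import Data.Nat.Induction using (<-wellFounded)
open import Induction.WellFounded using (Acc; acc)
import Data.Nat as ℕ
import Data.Nat.Properties as ℕ
open import Data.Nat.Tactic.RingSolver using (solve-∀)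
open import Data.Nat.DivMod using (_/_; +-distrib-/-∣ʳ; m<n⇒m/n≡0; m*n/n≡m)
open import Data.Nat.Divisibility using (n∣m*n)
import Data.Bool as Bool
import Data.Bool.Properties as Bool
open import Data.Bool using (Bool; true; false; _∧_; _∨_; not)
open import Data.Fin using (Fin; toℕ; remQuot; inject₁; fromℕ; fromℕ<; combine; _≟_) renaming (zero to fzero; suc to fsuc)
open import Data.Fin.Properties using (any?; all?; ¬∀⟶∃¬; suc-injective; toℕ<n; toℕ-injective; toℕ-fromℕ<; remQuot-combine; combine-remQuot)
open import Data.Fin.Subset using (Subset)
import Data.Fin.Subset as Subset
import Data.Fin.Subset.Properties as Subset
import Data.Vec as Vec
import Data.Vec.Properties as Vec
open import Data.Product using (Σ; ∃; Σ-syntax; _×_; _,_; proj₁; proj₂)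
open import Data.Product.Properties as Product using (,-injectiveˡ; ,-injectiveʳ)
open import Data.Sum using (_⊎_; inj₁; inj₂; [_,_]′)
open import Data.Empty using (⊥; ⊥-elim)
open import Data.Unit using (⊤; tt)
open import Data.Maybe using (Maybe; just; nothing; _>>=_)
open import Data.Maybe.Properties as Maybe using (just-injective)
open import Relation.Nullary using (¬_; Dec; yes; no; does)
open import Relation.Nullary.Decidable using (¬¬-excluded-middle; decidable-stable; dec-true; map′; ¬?; _×-dec_; _⊎-dec_; _→-dec_)
open import Relation.Binary.PropositionalEquality using (_≡_; _≢_; refl; trans; cong; cong₂; subst; subst₂) renaming (sym to ≡-sym)
open import Function using (_∘_; id; case_of_)
open import Function.Definitions using (Injective)
open import Algebra.Properties.CommutativeSemigroup +-commutativeSemigroup using (interchange)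

-- Vertex sets and their sizes

VSet : ℕ → Set
VSet n = Fin n → Bool

infix 4 _∈_ _∉_ _⊆_
infixr 6 _∪_
infixr 7 _∩_

_∈_ _∉_ : ∀ {n} → Fin n → VSet n → Set
v ∈ S = S v ≡ true
v ∉ S = S v ≡ false

_⊆_ : ∀ {n} → VSet n → VSet n → Set
S ⊆ T = ∀ v → v ∈ S → v ∈ T

_∪_ _∩_ : ∀ {n} → VSet n → VSet n → VSet n
(S ∪ T) v = S v ∨ T v
(S ∩ T) v = S v ∧ T v

∁ : ∀ {n} → VSet n → VSet n
∁ S v = not (S v)

full : ∀ {n} → VSet n
full _ = true

empty : ∀ {n} → VSet n
empty _ = false

_==_ : ∀ {n} → Fin n → Fin n → Bool
u == v = does (u ≟ v)

_∖_ _⊕_ : ∀ {n} → VSet n → Fin n → VSet n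
(S ∖ w) v = S v ∧ not (v == w)
(S ⊕ w) v = S v ∨ (v == w)

clash : ∀ {a} {A : Set a} {b : Bool} → b ≡ true → b ≡ false → A
clash refl ()

split : (b : Bool) → b ≡ true ⊎ b ≡ false
split true  = inj₁ refl
split false = inj₂ refl

∨-elim : ∀ {a b} → a ∨ b ≡ true → a ≡ true ⊎ b ≡ true
∨-elim {true}  _ = inj₁ refl
∨-elim {false} p = inj₂ p

∨ˡ : ∀ {a b} → a ≡ true → a ∨ b ≡ true
∨ˡ refl = refl

∨ʳ : ∀ {a b} → b ≡ true → a ∨ b ≡ true
∨ʳ {true}  refl = refl
∨ʳ {false} refl = refl

∨-false : ∀ {a b} → a ∨ b ≡ false → a ≡ false × b ≡ false
∨-false {false} p = refl , p

∨-false⁺ : ∀ {a b} → a ≡ false → b ≡ false → a ∨ b ≡ false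
∨-false⁺ refl refl = refl

∧⁺ : ∀ {a b} → a ≡ true → b ≡ true → a ∧ b ≡ true
∧⁺ refl refl = refl

∧⁻ : ∀ {a b} → a ∧ b ≡ true → a ≡ true × b ≡ true
∧⁻ {true} {true} _ = refl , refl

∧-false : ∀ {a b} → a ∧ b ≡ false → a ≡ false ⊎ b ≡ false
∧-false {false} _ = inj₁ refl
∧-false {true}  p = inj₂ p

∧-falseˡ : ∀ {a b} → a ≡ false → a ∧ b ≡ false
∧-falseˡ refl = refl

∧-falseʳ : ∀ {a b} → b ≡ false → a ∧ b ≡ false
∧-falseʳ {true}  refl = refl
∧-falseʳ {false} refl = refl

not⁺ : ∀ {a} → a ≡ false → not a ≡ true
not⁺ refl = refl

not⁻ : ∀ {a} → not a ≡ true → a ≡ false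
not⁻ {false} _ = refl

not-false : ∀ {a} → not a ≡ false → a ≡ true
not-false {true} _ = refl

≢⇒false : ∀ {b} → ¬ (b ≡ true) → b ≡ false
≢⇒false {true}  ¬p = ⊥-elim (¬p refl)
≢⇒false {false} _  = refl

==-refl : ∀ {n} (v : Fin n) → (v == v) ≡ true
==-refl v with v ≟ v
... | yes _ = refl
... | no ¬p = ⊥-elim (¬p refl)

==⇒≡ : ∀ {n} {u v : Fin n} → (u == v) ≡ true → u ≡ v
==⇒≡ {u = u} {v} p with u ≟ v
... | yes q = q

≢⇒== : ∀ {n} {u v : Fin n} → u ≢ v → (u == v) ≡ false
≢⇒== {u = u} {v} p with u ≟ v
... | yes q = ⊥-elim (p q)
... | no _  = refl

∖⁻ : ∀ {n} (S : VSet n) {w v} → v ∈ S ∖ w → v ∈ S × v ≢ w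
∖⁻ S {w} {v} p with ∧⁻ {S v} p
... | q , r = q , λ { refl → clash (==-refl w) (not⁻ r) }

∖⁺ : ∀ {n} (S : VSet n) {w v} → v ∈ S → v ≢ w → v ∈ S ∖ w
∖⁺ S p q = ∧⁺ p (not⁺ (≢⇒== q))

∉∖ : ∀ {n} (S : VSet n) w → w ∉ S ∖ w
∉∖ S w = ∧-falseʳ {S w} (cong not (==-refl w))

⊕⁻ : ∀ {n} (S : VSet n) {w v} → v ∈ S ⊕ w → v ∈ S ⊎ v ≡ w
⊕⁻ S {w} {v} p with ∨-elim {S v} p
... | inj₁ q = inj₁ q
... | inj₂ q = inj₂ (==⇒≡ q)

⊕-new : ∀ {n} (S : VSet n) w → w ∈ S ⊕ w
⊕-new S w = ∨ʳ {S w} (==-refl w)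

⊕-old : ∀ {n} (S : VSet n) {w v} → v ∈ S → v ∈ S ⊕ w
⊕-old S p = ∨ˡ p

bit : Bool → ℕ
bit true  = 1
bit false = 0

bit-mono : ∀ {a b} → (a ≡ true → b ≡ true) → bit a ≤ bit b
bit-mono {false}        h = z≤n
bit-mono {true} {true}  h = ≤-refl
bit-mono {true} {false} h = clash (h refl) refl

abstract
  size : ∀ {n} → VSet n → ℕ
  size {zero}  S = 0
  size {suc n} S = bit (S fzero) + size (S ∘ fsuc)

  -- Counting reduces to a check at each vertex; sums of two sizes on both sides make submodularity
  -- of the order a pointwise fact.
  size-mono₂ : ∀ {n} {P Q R T : VSet n} →
    (∀ v → bit (P v) + bit (Q v) ≤ bit (R v) + bit (T v)) →
    size P + size Q ≤ size R + size T
  size-mono₂ {zero}  h = z≤n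
  size-mono₂ {suc n} {P} {Q} {R} {T} h =
    subst₂ _≤_ (interchange (bit (P fzero)) _ _ _) (interchange (bit (R fzero)) _ _ _)
      (+-mono-≤ (h fzero) (size-mono₂ (h ∘ fsuc)))

  size-empty : ∀ {n} → size (empty {n}) ≡ 0
  size-empty {zero}  = refl
  size-empty {suc n} = size-empty {n}

  size-mono : ∀ {n} {S T : VSet n} → S ⊆ T → size S ≤ size T
  size-mono {zero}  h = z≤n
  size-mono {suc n} {S} {T} h =
    +-mono-≤ (bit-mono (h fzero)) (size-mono {S = S ∘ fsuc} {T ∘ fsuc} (h ∘ fsuc))

  size-remove : ∀ {n} {S : VSet n} {w} → w ∈ S → suc (size (S ∖ w)) ≡ size S
  size-remove {suc n} {S} {fzero} p rewrite p =
    cong suc (≤-antisym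
      (size-mono {S = λ v → S (fsuc v) ∧ true} {S ∘ fsuc} (λ v q → proj₁ (∧⁻ q)))
      (size-mono {S = S ∘ fsuc} {λ v → S (fsuc v) ∧ true} λ v q → ∧⁺ q refl))
  size-remove {suc n} {S} {fsuc w} p =
    trans (≡-sym (+-suc (bit (S fzero ∧ true)) _))
      (cong₂ _+_ (cong bit (Bool.∧-identityʳ (S fzero))) (size-remove {S = S ∘ fsuc} p))

  size-full : ∀ {n} → size (full {n}) ≡ n
  size-full {zero}  = refl
  size-full {suc n} = cong suc (size-full {n})

  size-tabulate : ∀ {n} (S : VSet n) → Subset.∣ Vec.tabulate S ∣ ≡ size S
  size-tabulate {zero}  S = refl
  size-tabulate {suc n} S with S fzero
  ... | true  = cong suc (size-tabulate (S ∘ fsuc))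
  ... | false = size-tabulate (S ∘ fsuc)

  size-suc : ∀ {n} (S : VSet (suc n)) → size S ≡ bit (S fzero) + size (S ∘ fsuc)
  size-suc S = refl

size-cover : ∀ {n} {S A B : VSet n} → (∀ v → v ∈ S → v ∈ A ⊎ v ∈ B) → size S ≤ size A + size B
size-cover {n} {S} {A} {B} h =
  subst (_≤ size A + size B) (trans (cong (size S +_) (size-empty {n})) (+-identityʳ _))
    (size-mono₂ {P = S} {Q = empty} λ v → aux (S v) (A v) (B v) (h v))
  where
    aux : ∀ s a b → (s ≡ true → a ≡ true ⊎ b ≡ true) → bit s + 0 ≤ bit a + bit b
    aux false a b h = z≤n
    aux true a b h with h refl
    ... | inj₁ refl = s≤s z≤n
    ... | inj₂ refl = m≤n+m 1 (bit a)

size-⊕ : ∀ {n} {S T : VSet n} w → (∀ v → v ∈ T → v ≢ w → v ∈ S) → size T ≤ suc (size S)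
size-⊕ {S = S} {T} w h with split (T w)
... | inj₁ p = subst (_≤ suc (size S)) (size-remove {S = T} p)
                 (s≤s (size-mono λ v q → h v (proj₁ (∖⁻ T q)) (proj₂ (∖⁻ T q))))
... | inj₂ p = ≤-trans (size-mono λ v q → h v q λ { refl → clash q p }) (n≤1+n _)

size-⊂ : ∀ {n} {S T : VSet n} w → S ⊆ T → w ∉ S → w ∈ T → size S < size T
size-⊂ {S = S} {T} w h p q = subst (size S <_) (size-remove {S = T} q)
  (s≤s (size-mono λ v r → ∖⁺ T (h v r) λ { refl → clash r p }))

size≤n : ∀ {n} (S : VSet n) → size S ≤ n
size≤n {n} S = subst (size S ≤_) (size-full {n}) (size-mono λ _ _ → refl)

-- The complement measures how far an increasing sequence of sets can still grow.
size-∁-< : ∀ {n} {S T : VSet n} w → S ⊆ T → w ∉ S → w ∈ T → size (∁ T) < size (∁ S)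
size-∁-< {S = S} {T} w h p q =
  size-⊂ w (λ v r → not⁺ (≢⇒false λ s → clash (h v s) (not⁻ r))) (cong not q) (not⁺ p)

inj⇒≤size : ∀ {n} k {Q : VSet n} (x : Fin k → Fin n) → Injective _≡_ _≡_ x →
  (∀ i → x i ∈ Q) → k ≤ size Q
inj⇒≤size zero    x inj h = z≤n
inj⇒≤size (suc k) {Q} x inj h = subst (suc k ≤_) (size-remove {S = Q} (h fzero))
  (s≤s (inj⇒≤size k {Q ∖ x fzero} (x ∘ fsuc) (λ e → suc-injective (inj e))
    λ i → ∖⁺ Q (h (fsuc i)) λ e → case inj e of λ ()))

inj-hits : ∀ {n} k {Q : VSet n} (x : Fin k → Fin n) → Injective _≡_ _≡_ x →
  (∀ i → x i ∈ Q) → size Q ≤ k → ∀ z → z ∈ Q → ∃ λ i → x i ≡ z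
inj-hits k {Q} x inj h le z p with any? (λ i → x i ≟ z)
... | yes q = q
... | no ¬q = ⊥-elim (<-irrefl refl
  (≤-trans (subst (_≤ k) (≡-sym (size-remove {S = Q} p)) le)
    (inj⇒≤size k {Q ∖ z} x inj λ i → ∖⁺ Q (h i) λ e → ¬q (i , e))))

-- Otherwise each value below `a` is taken at some vertex of `Q`, which injects `Fin a` into `Q`.
-- This finds the rows, columns and bands that a separator misses.
avoids-value : ∀ {n} a {Q : VSet n} (g : Fin n → ℕ) → size Q < a →
  ∃ λ i → i < a × (∀ v → v ∈ Q → g v ≢ i)
avoids-value {n} a {Q} g lt with all? (λ (i : Fin a) → any? λ v → (Q v Bool.≟ true) ×-dec (g v ℕ.≟ toℕ i))
... | yes h = ⊥-elim (<-irrefl refl (≤-trans lt (inj⇒≤size a (λ i → proj₁ (h i))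
        (λ {i} {j} e → toℕ-injective (trans (≡-sym (proj₂ (proj₂ (h i)))) (trans (cong g e) (proj₂ (proj₂ (h j))))))
        λ i → proj₁ (proj₂ (h i)))))
... | no ¬h with ¬∀⟶∃¬ a _ (λ i → any? λ v → (Q v Bool.≟ true) ×-dec (g v ℕ.≟ toℕ i)) ¬h
...   | i , ¬p = toℕ i , toℕ<n i , λ v q e → ¬p (v , q , e)

⟦_⟧ : ∀ {n} → Subset n → VSet n
⟦ s ⟧ = Vec.lookup s

size-⟦⟧ : ∀ {n} (s : Subset n) → Subset.∣ s ∣ ≡ size ⟦ s ⟧
size-⟦⟧ s = trans (cong Subset.∣_∣ (≡-sym (Vec.tabulate∘lookup s))) (size-tabulate ⟦ s ⟧)

∈⇒⟦⟧ : ∀ {n} {s : Subset n} {v} → v Subset.∈ s → v ∈ ⟦ s ⟧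
∈⇒⟦⟧ = Vec.[]=⇒lookup

⟦⟧⇒∈ : ∀ {n} {s : Subset n} {v} → v ∈ ⟦ s ⟧ → v Subset.∈ s
⟦⟧⇒∈ {s = s} {v} = Vec.lookup⇒[]= v s

-- Graphs, walks and separations

abstract
  total : ∀ {m} → (Fin m → ℕ) → ℕ
  total {zero}  f = 0
  total {suc m} f = f fzero + total (f ∘ fsuc)

  total-mono : ∀ {m} {f g : Fin m → ℕ} → (∀ i → f i ≤ g i) → total f ≤ total g
  total-mono {zero}  h = z≤n
  total-mono {suc m} h = +-mono-≤ (h fzero) (total-mono (h ∘ fsuc))

  total-< : ∀ {m} {f g : Fin m → ℕ} → (∀ i → f i ≤ g i) → ∀ i → f i < g i → total f < total g
  total-< h fzero    lt = +-mono-<-≤ lt (total-mono (h ∘ fsuc))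
  total-< h (fsuc i) lt = +-mono-≤-< (h fzero) (total-< (h ∘ fsuc) i lt)

edgeCount : ∀ {n} → Graph n → ℕ
edgeCount G = total (λ u → size (adj G u))

edgeCount-< : ∀ {n} (H G : Graph n) → (∀ u v → adj H u v ≡ true → adj G u v ≡ true) →
  ∀ x y → adj G x y ≡ true → adj H x y ≡ false → edgeCount H < edgeCount G
edgeCount-< H G h x y p q =
  total-< (λ u → size-mono (h u)) x (size-⊂ y (h x) q p)

restrict : ∀ {n} (G : Graph n) (keep : Fin n → Fin n → Bool) →
  (∀ u v → keep u v ≡ keep v u) → Graph n
restrict G keep s = record
  { adj    = λ u v → adj G u v ∧ keep u v
  ; sym    = λ u v → cong₂ _∧_ (Graph.sym G u v) (s u v)
  ; irrefl = λ u → ∧-falseˡ (irrefl G u)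
  }

-- The vertex set stays `Fin n`: vertices outside `C` only lose their edges, so both halves of a cut
-- are graphs on the same vertices.
within : ∀ {n} → Graph n → VSet n → Graph n
within G C = restrict G (λ u v → C u ∧ C v) (λ u v → Bool.∧-comm (C u) (C v))

isEdge : ∀ {n} → Fin n → Fin n → Fin n → Fin n → Bool
isEdge x y u v = ((u == x) ∧ (v == y)) ∨ ((u == y) ∧ (v == x))

isEdge-sym : ∀ {n} (x y u v : Fin n) → isEdge x y u v ≡ isEdge x y v u
isEdge-sym x y u v =
  trans (Bool.∨-comm ((u == x) ∧ (v == y)) _)
        (cong₂ _∨_ (Bool.∧-comm (u == y) (v == x)) (Bool.∧-comm (u == x) (v == y)))

isEdge⁻ : ∀ {n} {x y u v : Fin n} → isEdge x y u v ≡ true → (u ≡ x × v ≡ y) ⊎ (u ≡ y × v ≡ x)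
isEdge⁻ {x = x} {y} {u} {v} p with ∨-elim {(u == x) ∧ (v == y)} p
... | inj₁ q = inj₁ (==⇒≡ (proj₁ (∧⁻ q)) , ==⇒≡ (proj₂ (∧⁻ {u == x} q)))
... | inj₂ q = inj₂ (==⇒≡ (proj₁ (∧⁻ q)) , ==⇒≡ (proj₂ (∧⁻ {u == y} q)))

delete : ∀ {n} → Graph n → Fin n → Fin n → Graph n
delete G x y = restrict G (λ u v → not (isEdge x y u v)) (λ u v → cong not (isEdge-sym x y u v))

delete-⊆ : ∀ {n} (G : Graph n) {x y} u v → adj (delete G x y) u v ≡ true → adj G u v ≡ true
delete-⊆ G u v p = proj₁ (∧⁻ p)

delete-or : ∀ {n} (G : Graph n) {x y} u v → adj G u v ≡ true →
  adj (delete G x y) u v ≡ true ⊎ (u ≡ x × v ≡ y) ⊎ (u ≡ y × v ≡ x)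
delete-or G {x} {y} u v p with split (isEdge x y u v)
... | inj₁ q = inj₂ (isEdge⁻ q)
... | inj₂ q = inj₁ (∧⁺ p (not⁺ q))

edgeCount-delete : ∀ {n} (G : Graph n) x y → adj G x y ≡ true → edgeCount (delete G x y) < edgeCount G
edgeCount-delete G x y p = edgeCount-< (delete G x y) G (delete-⊆ G) x y p
  (∧-falseʳ {adj G x y} (cong not (∨ˡ (∧⁺ (==-refl x) (==-refl y)))))

symm : ∀ {n} (G : Graph n) {u v} → adj G u v ≡ true → adj G v u ≡ true
symm G {u} {v} p = trans (Graph.sym G v u) p

module _ {n : ℕ} where

  walk-map : ∀ {G H : Graph n} {P Q : Fin n → Set} → (∀ v → P v → Q v) →
    (∀ u v → P u → P v → adj G u v ≡ true → adj H u v ≡ true) →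
    ∀ {u v} → Walk G P u v → Walk H Q u v
  walk-head : ∀ {G : Graph n} {P : Fin n → Set} {u v} → Walk G P u v → P u
  walk-head (here p)     = p
  walk-head (step p _ _) = p
  walk-map f g (here p)     = here (f _ p)
  walk-map f g (step p e w) = step (f _ p) (g _ _ p (walk-head w) e) (walk-map f g w)

  walk-++ : ∀ {G : Graph n} {P : Fin n → Set} {u v w} → Walk G P u v → Walk G P v w → Walk G P u w
  walk-++ (here _)     w′ = w′
  walk-++ (step p e w) w′ = step p e (walk-++ w w′)

  walk-last : ∀ {G : Graph n} {P : Fin n → Set} {u v} → Walk G P u v → P v
  walk-last (here p)     = p
  walk-last (step _ _ w) = walk-last w

  walk-rev : ∀ {G : Graph n} {P : Fin n → Set} {u v} → Walk G P u v → Walk G P v u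
  walk-rev (here p) = here p
  walk-rev {G} (step p e w) = walk-++ (walk-rev w) (step (walk-head w) (symm G e) (here p))

  ConnectedSet : Graph n → (Fin n → Set) → Set
  ConnectedSet G P = ∀ u v → P u → P v → Walk G P u v

  reachable : ∀ (G : Graph n) (X : VSet n) u → u ∈ X → Σ[ Y ∈ VSet n ]
    (u ∈ Y × (∀ v → v ∈ Y → Walk G (_∈ X) u v) ×
     (∀ v w → v ∈ Y → w ∈ X → adj G v w ≡ true → w ∈ Y))
  reachable G X u u∈X = grow ((_== u)) (<-wellFounded _) (==-refl u)
      (λ v p → subst (Walk G (_∈ X) u) (≡-sym (==⇒≡ p)) (here u∈X))
    where
    grow : (Y : VSet n) → Acc _<_ (size (∁ Y)) → u ∈ Y → (∀ v → v ∈ Y → Walk G (_∈ X) u v) →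
      Σ[ Y ∈ VSet n ] (u ∈ Y × (∀ v → v ∈ Y → Walk G (_∈ X) u v) ×
        (∀ v w → v ∈ Y → w ∈ X → adj G v w ≡ true → w ∈ Y))
    grow Y (acc rec) u∈Y walks
      with any? (λ v → any? λ w → (Y v Bool.≟ true) ×-dec (X w Bool.≟ true) ×-dec
                                  (adj G v w Bool.≟ true) ×-dec (Y w Bool.≟ false))
    ... | no ¬p = Y , u∈Y , walks , closed
      where
      closed : ∀ v w → v ∈ Y → w ∈ X → adj G v w ≡ true → w ∈ Y
      closed v w p q e with split (Y w)
      ... | inj₁ r = r
      ... | inj₂ r = ⊥-elim (¬p (v , w , p , q , e , r))
    ... | yes (v , w , p , q , e , r) =
      grow (Y ⊕ w) (rec (size-∁-< w (λ z → ⊕-old Y) r (⊕-new Y w))) (⊕-old Y u∈Y) walks′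
      where
      walks′ : ∀ z → z ∈ Y ⊕ w → Walk G (_∈ X) u z
      walks′ z s with ⊕⁻ Y s
      ... | inj₁ t    = walks z t
      ... | inj₂ refl = walk-++ (walks v p) (step (walk-last (walks v p)) e (here q))

  walk-stays : ∀ {G : Graph n} {P : Fin n → Set} {Y : VSet n} →
    (∀ v w → v ∈ Y → P w → adj G v w ≡ true → w ∈ Y) →
    ∀ {u v} → Walk G P u v → u ∈ Y → v ∈ Y
  walk-stays h (here _) q = q
  walk-stays h (step p e w) q = walk-stays h w (h _ _ q (walk-head w) e)

  -- The parts C minus D and D minus C appear as the complements of `D` and of `C`, so neither field
  -- needs a disjunction.
  record IsSep (G : Graph n) (C D : VSet n) : Set where
    field
      cov : ∀ v → v ∉ D → v ∈ C
      nox : ∀ u v → adj G u v ≡ true → u ∉ D → v ∉ C → ⊥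
  open IsSep public

  cov′ : ∀ {G : Graph n} {C D} → IsSep G C D → ∀ v → v ∉ C → v ∈ D
  cov′ {D = D} s v p with split (D v)
  ... | inj₁ q = q
  ... | inj₂ q = clash (cov s v q) p

  sep-swap : ∀ {G : Graph n} {C D} → IsSep G C D → IsSep G D C
  sep-swap s .cov = cov′ s
  sep-swap {G} s .nox u v e p q = nox s v u (symm G e) q p

  -- Only xy itself can cross, and its direction is forced: an end outside `D` lies in `C`.
  delete-crossing-unique : ∀ {G : Graph n} {x y C D} → IsSep (delete G x y) C D →
    ∀ {u v u′ v′} → adj G u v ≡ true → u ∉ D → v ∉ C → adj G u′ v′ ≡ true → u′ ∉ D → v′ ∉ C →
    u′ ≡ u × v′ ≡ v
  delete-crossing-unique {G} {x} {y} s {u} {v} {u′} {v′} e p q e′ p′ q′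
    with delete-or G {x} {y} u v e | delete-or G {x} {y} u′ v′ e′
  ... | inj₁ f | _      = ⊥-elim (nox s u v f p q)
  ... | _      | inj₁ f = ⊥-elim (nox s u′ v′ f p′ q′)
  ... | inj₂ (inj₁ (refl , refl)) | inj₂ (inj₁ (refl , refl)) = refl , refl
  ... | inj₂ (inj₁ (refl , refl)) | inj₂ (inj₂ (refl , refl)) = clash (cov s u p) q′
  ... | inj₂ (inj₂ (refl , refl)) | inj₂ (inj₁ (refl , refl)) = clash (cov s u p) q′
  ... | inj₂ (inj₂ (refl , refl)) | inj₂ (inj₂ (refl , refl)) = refl , refl

  sep-join : ∀ {G : Graph n} {C D C′ D′} → IsSep G C D → IsSep G C′ D′ → IsSep G (C ∪ C′) (D ∩ D′)
  sep-join {D = D} s t .cov v p with ∧-false {D v} p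
  ... | inj₁ q = ∨ˡ (cov s v q)
  ... | inj₂ q = ∨ʳ (cov t v q)
  sep-join {D = D} s t .nox u v e p q with ∧-false {D u} p | ∨-false q
  ... | inj₁ r | q₁ , q₂ = nox s u v e r q₁
  ... | inj₂ r | q₁ , q₂ = nox t u v e r q₂

  sep-meet : ∀ {G : Graph n} {C D C′ D′} → IsSep G C D → IsSep G C′ D′ → IsSep G (C ∩ C′) (D ∪ D′)
  sep-meet s t = sep-swap (sep-join (sep-swap s) (sep-swap t))

  order-swap : ∀ (C D : VSet n) → size (C ∩ D) ≤ size (D ∩ C)
  order-swap C D = size-mono λ v p → ∧⁺ (proj₂ (∧⁻ {C v} p)) (proj₁ (∧⁻ {C v} p))

  submodular : ∀ {G : Graph n} {C D C′ D′} → IsSep G C D → IsSep G C′ D′ →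
    size ((C ∪ C′) ∩ (D ∩ D′)) + size ((C ∩ C′) ∩ (D ∪ D′)) ≤ size (C ∩ D) + size (C′ ∩ D′)
  submodular {C = C} {D} {C′} {D′} s t =
    size-mono₂ λ v → aux (C v) (D v) (C′ v) (D′ v) (cov s v) (cov t v)
    where
    aux : ∀ c d c′ d′ → (d ≡ false → c ≡ true) → (d′ ≡ false → c′ ≡ true) →
      bit ((c ∨ c′) ∧ (d ∧ d′)) + bit ((c ∧ c′) ∧ (d ∨ d′)) ≤ bit (c ∧ d) + bit (c′ ∧ d′)
    aux false false _ _ f _ = clash (f refl) refl
    aux _ _ false false _ g = clash (g refl) refl
    aux false true  false true  _ _ = ≤-refl
    aux false true  true  false _ _ = ≤-refl
    aux false true  true  true  _ _ = ≤-refl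
    aux true  false false true  _ _ = ≤-refl
    aux true  false true  false _ _ = ≤-refl
    aux true  false true  true  _ _ = ≤-refl
    aux true  true  false true  _ _ = ≤-refl
    aux true  true  true  false _ _ = ≤-refl
    aux true  true  true  true  _ _ = ≤-refl

  walk-side : ∀ {G : Graph n} {C D P} → IsSep G C D → (∀ v → P v → v ∉ C ∩ D) →
    ∀ {u v} → Walk G P u v → u ∉ C → v ∉ C
  walk-side s h (here _) q = q
  walk-side {G} {C} {D} s h (step {w = w} p e W) q = walk-side s h W w∉C
    where
    w∉C : w ∉ C
    w∉C with split (C w)
    ... | inj₂ r = r
    ... | inj₁ r with ∧-false {C w} (h w (walk-head W))
    ...   | inj₁ r′ = r′
    ...   | inj₂ r′ = ⊥-elim (nox s w _ (symm G e) r′ q)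

-- Menger's theorem

size-pick : ∀ {n} {Q : VSet n} → 1 ≤ size Q → ∃ λ v → v ∈ Q
size-pick {n} {Q} le with any? (λ v → Q v Bool.≟ true)
... | yes p = p
... | no ¬p = ⊥-elim (<-irrefl (≡-sym (size-empty {n}))
                (≤-trans le (size-mono {S = Q} {empty} λ v q → ⊥-elim (¬p (v , q)))))

size-choose : ∀ {n} k (Q : VSet n) → k ≤ size Q →
  Σ[ x ∈ (Fin k → Fin n) ] (Injective _≡_ _≡_ x × (∀ i → x i ∈ Q))
size-choose zero    Q le = (λ ()) , (λ {}) , λ ()
size-choose (suc k) Q le with size-pick {Q = Q} (≤-trans (s≤s z≤n) le)
... | w , w∈Q with size-choose k (Q ∖ w) (≤-pred (subst (suc k ≤_) (≡-sym (size-remove {S = Q} w∈Q)) le))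
...   | x , inj , h = y , inj′ , h′
  where
  y : Fin (suc k) → Fin _
  y fzero    = w
  y (fsuc i) = x i
  h′ : ∀ i → y i ∈ Q
  h′ fzero    = w∈Q
  h′ (fsuc i) = proj₁ (∖⁻ Q (h i))
  inj′ : Injective _≡_ _≡_ y
  inj′ {fzero}  {fzero}  e = refl
  inj′ {fzero}  {fsuc j} e = ⊥-elim (proj₂ (∖⁻ Q (h j)) (≡-sym e))
  inj′ {fsuc i} {fzero}  e = ⊥-elim (proj₂ (∖⁻ Q (h i)) e)
  inj′ {fsuc i} {fsuc j} e = cong fsuc (inj e)

-- Disjoint connected sets stand in for disjoint paths: gluing is then a union, and connectedness is
-- all that branch sets will need.
record Linkage {n} (G : Graph n) (k : ℕ) (A B : VSet n) : Set where
  field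
    part      : Fin k → VSet n
    separate  : ∀ i j v → v ∈ part i → v ∈ part j → i ≡ j
    connected : ∀ i → ConnectedSet G (_∈ part i)
    src tgt   : Fin k → Fin n
    src-part  : ∀ i → src i ∈ part i
    tgt-part  : ∀ i → tgt i ∈ part i
    src-∈     : ∀ i → src i ∈ A
    tgt-∈     : ∀ i → tgt i ∈ B

  tgt-inj : Injective _≡_ _≡_ tgt
  tgt-inj {i} {j} e = separate i j (tgt j) (subst (_∈ part i) e (tgt-part i)) (tgt-part j)

AllSeps≥ : ∀ {n} → Graph n → ℕ → VSet n → VSet n → Set
AllSeps≥ G k A B = ∀ C D → IsSep G C D → A ⊆ C → B ⊆ D → k ≤ size (C ∩ D)

AllSeps≥-swap : ∀ {n} {G : Graph n} {k A B} → AllSeps≥ G k A B → AllSeps≥ G k B A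
AllSeps≥-swap h C D s p q = ≤-trans (h D C (sep-swap s) q p) (order-swap D C)

-- x is the end in C ∖ D of the only edge between C ∖ D and D ∖ C.
AllSeps≥-half : ∀ {n} (G : Graph n) {k A B C D x} → AllSeps≥ G k A B →
  (∀ v → v ∉ D → v ∈ C) → (∀ u v → adj G u v ≡ true → u ∉ D → v ∉ C → u ≡ x) →
  A ⊆ C → B ⊆ D → AllSeps≥ (within G C) k A ((C ∩ D) ⊕ x)
AllSeps≥-half G {k} {A} {B} {C} {D} {x} h covC cross A⊆C B⊆D C′ D′ s A⊆C′ X⊆D′ =
  ≤-trans (h (C′ ∩ C) (D′ ∪ ∁ C) s′ (λ v p → ∧⁺ (A⊆C′ v p) (A⊆C v p)) B⊆) (size-mono small)
  where
  s′ : IsSep G (C′ ∩ C) (D′ ∪ ∁ C)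
  s′ .cov v p with ∨-false {D′ v} p
  ... | q , r = ∧⁺ (cov s v q) (not-false r)
  s′ .nox u v e p q with ∨-false {D′ u} p
  ... | u∉D′ , r with not-false r | split (C v)
  ...   | u∈C | inj₁ v∈C with ∧-false {C′ v} q
  ...     | inj₁ v∉C′ = nox s u v (∧⁺ e (∧⁺ u∈C v∈C)) u∉D′ v∉C′
  ...     | inj₂ v∉C  = clash v∈C v∉C
  s′ .nox u v e p q | u∉D′ , r | u∈C | inj₂ v∉C with split (D u)
  ...     | inj₁ u∈D = clash (X⊆D′ u (⊕-old (C ∩ D) (∧⁺ u∈C u∈D))) u∉D′
  ...     | inj₂ u∉D = clash (X⊆D′ u (subst (_∈ ((C ∩ D) ⊕ x)) (≡-sym (cross u v e u∉D v∉C)) (⊕-new (C ∩ D) x))) u∉D′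
  B⊆ : B ⊆ (D′ ∪ ∁ C)
  B⊆ v p with split (C v)
  ... | inj₁ q = ∨ˡ (X⊆D′ v (⊕-old (C ∩ D) (∧⁺ q (B⊆D v p))))
  ... | inj₂ q = ∨ʳ {D′ v} (not⁺ q)
  small : (C′ ∩ C) ∩ (D′ ∪ ∁ C) ⊆ C′ ∩ D′
  small v p with ∧⁻ {C′ v ∧ C v} p
  ... | q , r with ∧⁻ {C′ v} q | ∨-elim {D′ v} r
  ...   | a , b | inj₁ c = ∧⁺ a c
  ...   | a , b | inj₂ c = clash b (not⁻ c)

within-⊆ : ∀ {n} {G : Graph n} {C A B k} (P : Linkage (within G C) k A B) → A ⊆ C →
  ∀ i → Linkage.part P i ⊆ C
within-⊆ {G = G} {C} P A⊆C i v p = go (connected i (src i) v (src-part i) p) (A⊆C _ (src-∈ i))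
  where
  open Linkage P
  go : ∀ {u v} → Walk (within G C) (_∈ part i) u v → u ∈ C → v ∈ C
  go (here _) q = q
  go (step {u} {w} _ e W) q = go W (proj₂ (∧⁻ {C u} (proj₂ (∧⁻ {adj G u w} e))))

-- Each of the sets (C ∩ D) + x and (D ∩ C) + y has at most k vertices, so the k distinct targets in
-- it exhaust it. Pairing x with y and every other vertex with itself therefore matches the parts of
-- the two linkages one to one.
glue : ∀ {n} (G : Graph n) {k A B C D x y} → adj G x y ≡ true → x ∉ D → y ∉ C →
  A ⊆ C → B ⊆ D → suc (size (C ∩ D)) ≤ k →
  Linkage (within G C) k A ((C ∩ D) ⊕ x) → Linkage (within G D) k B ((D ∩ C) ⊕ y) → Linkage G k A B
glue {n} G {k} {A} {B} {C} {D} {x} {y} x~y x∉D y∉C A⊆C B⊆D le P Q = record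
  { part = R ; separate = R-sep ; connected = R-conn
  ; src = P.src ; tgt = Q.src ∘ σ
  ; src-part = λ i → ∨ˡ (P.src-part i) ; tgt-part = λ i → ∨ʳ {P.part i _} (Q.src-part (σ i))
  ; src-∈ = P.src-∈ ; tgt-∈ = λ i → Q.src-∈ (σ i) }
  where
  module P = Linkage P
  module Q = Linkage Q
  X Y : VSet n
  X = (C ∩ D) ⊕ x
  Y = (D ∩ C) ⊕ y
  X≤k : size X ≤ k
  X≤k = ≤-trans (size-⊕ x λ v p v≢x → [ id , (λ e → ⊥-elim (v≢x e)) ]′ (⊕⁻ (C ∩ D) p)) le
  Y≤k : size Y ≤ k
  Y≤k = ≤-trans (size-⊕ y λ v p v≢y → [ id , (λ e → ⊥-elim (v≢y e)) ]′ (⊕⁻ (D ∩ C) p))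
                (≤-trans (s≤s (order-swap D C)) le)
  C∩D⊆Y : ∀ {z} → z ∈ C → z ∈ D → z ∈ Y
  C∩D⊆Y p q = ⊕-old (D ∩ C) (∧⁺ q p)
  cross : ∀ i → Σ[ j ∈ Fin k ] ((P.tgt i ≡ x × Q.tgt j ≡ y) ⊎
                                (P.tgt i ∈ D × P.tgt i ≡ Q.tgt j))
  cross i with ⊕⁻ (C ∩ D) (P.tgt-∈ i)
  ... | inj₂ e with inj-hits k {Y} Q.tgt Q.tgt-inj Q.tgt-∈ Y≤k y (⊕-new (D ∩ C) y)
  ...   | j , f = j , inj₁ (e , f)
  cross i | inj₁ p with ∧⁻ {C (P.tgt i)} p
  ... | c , d with inj-hits k {Y} Q.tgt Q.tgt-inj Q.tgt-∈ Y≤k (P.tgt i) (C∩D⊆Y c d)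
  ...   | j , f = j , inj₂ (d , ≡-sym f)
  σ : Fin k → Fin k
  σ i = proj₁ (cross i)
  R : Fin k → VSet n
  R i = P.part i ∪ Q.part (σ i)

  y∉ : ∀ i → P.tgt i ≢ y
  y∉ i e = clash (subst (_∈ C) e (within-⊆ P A⊆C i _ (P.tgt-part i))) y∉C

  σ-inj : ∀ i j → Q.tgt (σ i) ≡ Q.tgt (σ j) → i ≡ j
  σ-inj i j e with cross i | cross j
  ... | _ , inj₁ (a , b) | _ , inj₁ (c , d) = P.tgt-inj (trans a (≡-sym c))
  ... | _ , inj₁ (a , b) | _ , inj₂ (c , d) = ⊥-elim (y∉ j (trans d (trans (≡-sym e) b)))
  ... | _ , inj₂ (a , b) | _ , inj₁ (c , d) = ⊥-elim (y∉ i (trans b (trans e d)))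
  ... | _ , inj₂ (a , b) | _ , inj₂ (c , d) = P.tgt-inj (trans b (trans e (≡-sym d)))

  -- A common vertex lies in C ∩ D, hence is the target of a part on either side; disjointness
  -- within each linkage identifies these parts as number i and number `σ j`.
  meet : ∀ i j z → z ∈ P.part i → z ∈ Q.part (σ j) → i ≡ j
  meet i j z p q with within-⊆ P A⊆C i z p | within-⊆ Q B⊆D (σ j) z q
  ... | z∈C | z∈D with inj-hits k {X} P.tgt P.tgt-inj P.tgt-∈ X≤k z (⊕-old (C ∩ D) (∧⁺ z∈C z∈D))
                     | inj-hits k {Y} Q.tgt Q.tgt-inj Q.tgt-∈ Y≤k z (C∩D⊆Y z∈C z∈D)
  ...   | i′ , e | j′ , f with P.separate i′ i z (subst (_∈ P.part i′) e (P.tgt-part i′)) p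
                             | Q.separate j′ (σ j) z (subst (_∈ Q.part j′) f (Q.tgt-part j′)) q
  ...     | refl | refl with cross j
  ...       | _ , inj₁ (a , b) = ⊥-elim (clash z∈C (subst (_∉ C) (trans (≡-sym b) f) y∉C))
  ...       | _ , inj₂ (a , b) = P.tgt-inj (trans e (trans (≡-sym f) (≡-sym b)))

  R-sep : ∀ i j v → v ∈ R i → v ∈ R j → i ≡ j
  R-sep i j v p q with ∨-elim {P.part i v} p | ∨-elim {P.part j v} q
  ... | inj₁ a | inj₁ b = P.separate i j v a b
  ... | inj₁ a | inj₂ b = meet i j v a b
  ... | inj₂ a | inj₁ b = ≡-sym (meet j i v b a)
  ... | inj₂ a | inj₂ b = σ-inj i j (cong Q.tgt (Q.separate (σ i) (σ j) v a b))

  fromP : ∀ i {u v} → Walk (within G C) (_∈ P.part i) u v → Walk G (_∈ R i) u v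
  fromP i = walk-map (λ v p → ∨ˡ p) (λ u v _ _ e → proj₁ (∧⁻ e))
  fromQ : ∀ i {u v} → Walk (within G D) (_∈ Q.part (σ i)) u v → Walk G (_∈ R i) u v
  fromQ i = walk-map (λ v p → ∨ʳ {P.part i v} p) (λ u v _ _ e → proj₁ (∧⁻ e))

  bridge : ∀ i → Walk G (_∈ R i) (P.tgt i) (Q.tgt (σ i))
  bridge i = aux (P.tgt-part i) (Q.tgt-part (σ i)) (proj₂ (cross i))
    where
    aux : ∀ {z w} → z ∈ P.part i → w ∈ Q.part (σ i) → (z ≡ x × w ≡ y) ⊎ (z ∈ D × z ≡ w) →
      Walk G (_∈ R i) z w
    aux p q (inj₁ (refl , refl)) = step (∨ˡ p) x~y (here (∨ʳ {P.part i y} q))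
    aux p q (inj₂ (_ , refl))    = here (∨ˡ p)

  toHub : ∀ i v → v ∈ R i → Walk G (_∈ R i) v (P.tgt i)
  toHub i v p with ∨-elim {P.part i v} p
  ... | inj₁ a = fromP i (P.connected i v (P.tgt i) a (P.tgt-part i))
  ... | inj₂ a = walk-++ (fromQ i (Q.connected (σ i) v _ a (Q.tgt-part (σ i)))) (walk-rev (bridge i))

  R-conn : ∀ i → ConnectedSet G (_∈ R i)
  R-conn i u v p q = walk-++ (toHub i u p) (walk-rev (toHub i v q))

Linkage-map : ∀ {n} {H G : Graph n} {k A B} → (∀ u v → adj H u v ≡ true → adj G u v ≡ true) →
  Linkage H k A B → Linkage G k A B
Linkage-map h P = record
  { part = part ; separate = separate
  ; connected = λ i u v p q → walk-map (λ _ → id) (λ u v _ _ → h u v) (connected i u v p q)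
  ; src = src ; tgt = tgt ; src-part = src-part ; tgt-part = tgt-part ; src-∈ = src-∈ ; tgt-∈ = tgt-∈ }
  where open Linkage P

-- Induction on the number of edges. If deleting xy creates no separation of order below k, delete
-- it. Otherwise xy is the only edge crossing such a separation; both ends in turn complete its
-- separator to a set still separated from its terminals by k vertices, and the linkages of the two
-- halves are glued along xy.
menger : ∀ {n} (G : Graph n) {k A B} → AllSeps≥ G k A B → ¬ ¬ Linkage G k A B
menger {n} G h = go G (<-wellFounded (edgeCount G)) h
  where
  go : ∀ (G : Graph n) → Acc _<_ (edgeCount G) → ∀ {k A B} → AllSeps≥ G k A B → ¬ ¬ Linkage G k A B
  go G (acc rec) {k} {A} {B} h fail with any? (λ x → any? λ y → adj G x y Bool.≟ true)
  ... | no none = fail record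
      { part = λ i → _== x i ; separate = λ i j v p q → inj (trans (≡-sym (==⇒≡ {u = v} p)) (==⇒≡ {u = v} q))
      ; connected = λ i u v p q → subst (Walk G _ u) (trans (==⇒≡ {u = u} p) (≡-sym (==⇒≡ {u = v} q))) (here p)
      ; src = x ; tgt = x ; src-part = ==-refl ∘ x ; tgt-part = ==-refl ∘ x
      ; src-∈ = λ i → proj₁ (∧⁻ (x∈ i)) ; tgt-∈ = λ i → proj₂ (∧⁻ {A (x i)} (x∈ i)) }
    where
    -- Without edges every covering pair is a separation, and this one has intersection `A ∩ B`.
    s : IsSep G A (B ∪ ∁ A)
    s .cov v p = not-false (proj₂ (∨-false {B v} p))
    s .nox u v e _ _ = none (u , v , e)
    shrink : A ∩ (B ∪ ∁ A) ⊆ A ∩ B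
    shrink v p with ∧⁻ {A v} p
    ... | a , b with ∨-elim {B v} b
    ...   | inj₁ c = ∧⁺ a c
    ...   | inj₂ c = clash a (not⁻ c)
    chosen = size-choose k (A ∩ B)
      (≤-trans (h A (B ∪ ∁ A) s (λ _ → id) (λ v → ∨ˡ)) (size-mono shrink))
    x = proj₁ chosen
    inj = proj₁ (proj₂ chosen)
    x∈ = proj₂ (proj₂ chosen)
  ... | yes (x₀ , y₀ , x~y) = ¬¬-excluded-middle λ where
      (yes h′) → go (delete G x₀ y₀) (rec (edgeCount-delete G x₀ y₀ x~y)) h′
                    (fail ∘ Linkage-map (delete-⊆ G))
      (no ¬h′) → ¬h′ λ C D s A⊆C B⊆D → ≮⇒≥ λ lt → cut C D s A⊆C B⊆D lt
    where
    recurse : ∀ (C : VSet n) {A B x y} → adj G x y ≡ true → y ∉ C → AllSeps≥ (within G C) k A B →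
      ¬ ¬ Linkage (within G C) k A B
    recurse C {x = x} {y} e y∉C = go (within G C) (rec (edgeCount-< (within G C) G
      (λ u v p → proj₁ (∧⁻ p)) x y e (∧-falseʳ {adj G x y} (∧-falseʳ {C x} y∉C))))
    cross-cut : ∀ C D → IsSep (delete G x₀ y₀) C D → A ⊆ C → B ⊆ D → size (C ∩ D) < k →
      ∀ x y → adj G x y ≡ true → x ∉ D → y ∉ C →
      (∀ u v → adj G u v ≡ true → u ∉ D → v ∉ C → u ≡ x × v ≡ y) → ⊥
    cross-cut C D s A⊆C B⊆D lt x y e x∉D y∉C only =
      recurse C e y∉C (AllSeps≥-half G h (cov s) (λ u v e p q → proj₁ (only u v e p q)) A⊆C B⊆D) λ P →
      recurse D (symm G e) x∉D (AllSeps≥-half G (AllSeps≥-swap {G = G} h) (cov′ s)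
        (λ u v e p q → proj₂ (only v u (symm G e) q p)) B⊆D A⊆C) λ Q →
      fail (glue G e x∉D y∉C A⊆C B⊆D lt P Q)
    cut : ∀ C D → IsSep (delete G x₀ y₀) C D → A ⊆ C → B ⊆ D → size (C ∩ D) < k → ⊥
    cut C D s A⊆C B⊆D lt = <-irrefl refl (≤-trans lt (h C D s′ A⊆C B⊆D))
      where
      s′ : IsSep G C D
      s′ .cov = cov s
      s′ .nox u v e p q with delete-or G {x₀} {y₀} u v e
      ... | inj₁ e′ = nox s u v e′ p q
      ... | inj₂ _  = cross-cut C D s A⊆C B⊆D lt u v e p q
                        λ u′ v′ e′ p′ q′ → delete-crossing-unique s e p q e′ p′ q′

-- From tangles to linked sets

Linked : ∀ {n} → Graph n → VSet n → Set
Linked G X = ∀ C D → IsSep G C D → size (C ∩ X) ≤ size (C ∩ D) ⊎ size (D ∩ X) ≤ size (C ∩ D)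

modular-∩ : ∀ {n} (C C′ X : VSet n) →
  size (C ∩ X) + size (C′ ∩ X) ≤ size ((C ∪ C′) ∩ X) + size ((C ∩ C′) ∩ X)
modular-∩ C C′ X = size-mono₂ λ v → aux (C v) (C′ v) (X v)
  where
  aux : ∀ c c′ x → bit (c ∧ x) + bit (c′ ∧ x) ≤ bit ((c ∨ c′) ∧ x) + bit ((c ∧ c′) ∧ x)
  aux true  true  x = ≤-refl
  aux true  false x = ≤-refl
  aux false true  x = m≤m+n (bit x) 0
  aux false false x = ≤-refl

module TangleLinked {n} (G : Graph n) (S : Subset n) (k : ℕ) (𝒯 : Tangle G S k) where

  open Tangle 𝒯

  tab⁺ : ∀ (C : VSet n) v → v ∈ C → v Subset.∈ Vec.tabulate C
  tab⁺ C v p = ⟦⟧⇒∈ (trans (Vec.lookup∘tabulate C v) p)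
  tab⁻ : ∀ (C : VSet n) v → v Subset.∈ Vec.tabulate C → v ∈ C
  tab⁻ C v p = trans (≡-sym (Vec.lookup∘tabulate C v)) (∈⇒⟦⟧ p)

  -- Edges inside `C` go to the first side. Any other edge has both ends in `D`, since it would
  -- cross otherwise.
  toSeparation : ∀ C D → IsSep G C D → Separation G
  toSeparation C D s = sep
    (record { V = Vec.tabulate C ; E = λ u v → adj G u v ∧ (C u ∧ C v)
            ; E⊆ = λ u v p → proj₁ (∧⁻ p)
            ; Esym = λ u v → cong₂ _∧_ (Graph.sym G u v) (Bool.∧-comm (C u) (C v))
            ; Eends = λ u v p → tab⁺ C u (proj₁ (∧⁻ (proj₂ (∧⁻ {adj G u v} p)))) })
    (record { V = Vec.tabulate D ; E = λ u v → adj G u v ∧ not (C u ∧ C v)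
            ; E⊆ = λ u v p → proj₁ (∧⁻ p)
            ; Esym = λ u v → cong₂ _∧_ (Graph.sym G u v) (cong not (Bool.∧-comm (C u) (C v)))
            ; Eends = λ u v p → tab⁺ D u (end u v (proj₁ (∧⁻ p)) (not⁻ (proj₂ (∧⁻ {adj G u v} p)))) })
    (λ v → case split (C v) of λ { (inj₁ p) → inj₁ (tab⁺ C v p) ; (inj₂ p) → inj₂ (tab⁺ D v (cov′ s v p)) })
    (λ u v e → case split (C u ∧ C v) of λ
      { (inj₁ p) → inj₁ (∧⁺ e p) ; (inj₂ p) → inj₂ (∧⁺ e (not⁺ p)) })
    (λ u v p → ∧-falseʳ {adj G u v} (cong not (proj₂ (∧⁻ {adj G u v} p))))
    where
    end : ∀ u v → adj G u v ≡ true → C u ∧ C v ≡ false → u ∈ D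
    end u v e p with split (D u)
    ... | inj₁ q = q
    ... | inj₂ q with ∧-false {C u} p
    ...   | inj₁ r = clash (cov s u q) r
    ...   | inj₂ r = ⊥-elim (nox s u v e q r)

  -- T1 leaves open which side carries the edges inside A ∩ B, so only vertex sets are recorded.
  record Small (C D : VSet n) : Set where
    field
      separation : Separation G
      member     : mem separation
      C⊆A        : ∀ v → v ∈ C → v Subset.∈ V (A separation)
      D⊆B        : ∀ v → v ∈ D → v Subset.∈ V (B separation)
      B⊆D        : ∀ v → v Subset.∈ V (B separation) → v ∈ D
  open Small

  orient : ∀ C D (s : IsSep G C D) → size (C ∩ D) < k →
    mem (toSeparation C D s) ⊎ mem (swap (toSeparation C D s))
  orient C D s lt = T1 (toSeparation C D s) (<⇒≤pred (≤-trans (s≤s (≤-trans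
    (≤-reflexive (size-⟦⟧ (Vec.tabulate C Subset.∩ Vec.tabulate D)))
    (size-mono λ v p → let q = Subset.x∈p∩q⁻ (Vec.tabulate C) (Vec.tabulate D) (⟦⟧⇒∈ p) in
      ∧⁺ (tab⁻ C v (proj₁ q)) (tab⁻ D v (proj₂ q))))) lt))

  small-dichotomy : ∀ C D → IsSep G C D → size (C ∩ D) < k → Small C D ⊎ Small D C
  small-dichotomy C D s lt with orient C D s lt
  ... | inj₁ m = inj₁ record { separation = _ ; member = m ; C⊆A = tab⁺ C ; D⊆B = tab⁺ D ; B⊆D = tab⁻ D }
  ... | inj₂ m = inj₂ record { separation = _ ; member = m ; C⊆A = tab⁺ D ; D⊆B = tab⁺ C ; B⊆D = tab⁻ C }

  -- A vertex outside `D` is outside `D₁` or `D₂`, so it and all edges at it belong to one of the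
  -- two small sides. If D were small as well, the three small sides would cover G, against T2.
  small-absorb : ∀ {C₁ D₁ C₂ D₂ C D} → Small C₁ D₁ → Small C₂ D₂ → IsSep G C D → size (C ∩ D) < k →
    D₁ ∩ D₂ ⊆ D → Small C D
  small-absorb {C₁} {D₁} {C₂} {D₂} {C} {D} σ₁ σ₂ s lt D⊆
    with orient D C (sep-swap s) (≤-trans (s≤s (order-swap D C)) lt)
  ... | inj₂ m = record { separation = _ ; member = m ; C⊆A = tab⁺ C ; D⊆B = tab⁺ D ; B⊆D = tab⁻ D }
  ... | inj₁ m = ⊥-elim (T2 _ _ _ (member σ₁) (member σ₂) m (vertices , edges′))
    where
    out : ∀ v → v ∉ D → ¬ (v Subset.∈ V (B (separation σ₁))) ⊎ ¬ (v Subset.∈ V (B (separation σ₂)))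
    out v p with split (D₁ v) | split (D₂ v)
    ... | inj₁ a | inj₁ b = clash (D⊆ v (∧⁺ a b)) p
    ... | inj₂ a | _      = inj₁ λ q → clash (B⊆D σ₁ v q) a
    ... | inj₁ _ | inj₂ b = inj₂ λ q → clash (B⊆D σ₂ v q) b
    vertices : ∀ v → v Subset.∈ V (A (separation σ₁)) ⊎ v Subset.∈ V (A (separation σ₂)) ⊎
                     v Subset.∈ Vec.tabulate D
    vertices v with split (D v)
    ... | inj₁ p = inj₂ (inj₂ (tab⁺ D v p))
    ... | inj₂ p with out v p
    ...   | inj₁ q = inj₁ ([ id , (λ r → ⊥-elim (q r)) ]′ (Separation.coverV (separation σ₁) v))
    ...   | inj₂ q = inj₂ (inj₁ ([ id , (λ r → ⊥-elim (q r)) ]′ (Separation.coverV (separation σ₂) v)))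
    onA : ∀ (t : Separation G) u v → adj G u v ≡ true → ¬ (u Subset.∈ V (B t)) ⊎ ¬ (v Subset.∈ V (B t)) →
      E (A t) u v ≡ true
    onA t u v e h with Separation.coverE t u v e
    ... | inj₁ a = a
    ... | inj₂ b with h
    ...   | inj₁ q = ⊥-elim (q (Eends (B t) u v b))
    ...   | inj₂ q = ⊥-elim (q (Eends (B t) v u (trans (Esym (B t) v u) b)))
    edges′ : ∀ u v → adj G u v ≡ true → E (A (separation σ₁)) u v ≡ true ⊎
      E (A (separation σ₂)) u v ≡ true ⊎ adj G u v ∧ (D u ∧ D v) ≡ true
    edges′ u v e with split (D u) | split (D v)
    ... | inj₁ p | inj₁ q = inj₂ (inj₂ (∧⁺ e (∧⁺ p q)))
    ... | inj₂ p | _ with out u p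
    ...   | inj₁ r = inj₁ (onA (separation σ₁) u v e (inj₁ r))
    ...   | inj₂ r = inj₂ (inj₁ (onA (separation σ₂) u v e (inj₁ r)))
    edges′ u v e | inj₁ _ | inj₂ p with out v p
    ...   | inj₁ r = inj₁ (onA (separation σ₁) u v e (inj₂ r))
    ...   | inj₂ r = inj₂ (inj₁ (onA (separation σ₂) u v e (inj₂ r)))

  small-misses : ∀ {C D} → Small C D → ¬ (⟦ S ⟧ ⊆ C)
  small-misses σ S⊆C = T4 _ (member σ) λ v p → C⊆A σ v (S⊆C v (∈⇒⟦⟧ p))

  -- The independent sets of the matroid that the tangle defines on the vertices.
  Independent : VSet n → Set
  Independent X = ∀ C D → IsSep G C D → Small C D → size (C ∩ X) ≤ size (C ∩ D)

  -- Otherwise every s ∈ S lies in a tight small side, and tight small sides are closed under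
  -- union by submodularity, so S would lie in a single small side.
  extend : ∀ X → Independent X → size X < k →
    ¬ ¬ (∃ λ s → s ∈ ⟦ S ⟧ × s ∉ X × Independent (X ⊕ s))
  extend X ind X<k fail = collect n ≤-refl λ (C , D , _ , σ , _ , _ , all) →
      small-misses σ λ v p → all v p (toℕ<n v)
    where
    Tight : VSet n → VSet n → Set
    Tight C D = size (C ∩ D) ≤ size (C ∩ X)

    Collected : ℕ → Set
    Collected i = Σ[ C ∈ VSet n ] Σ[ D ∈ VSet n ] (IsSep G C D × Small C D × Tight C D × X ⊆ C ×
      (∀ v → v ∈ ⟦ S ⟧ → toℕ v < i → v ∈ C))

    join : ∀ {C D C′ D′} → IsSep G C D → IsSep G C′ D′ → Small C D → Small C′ D′ →
      Tight C D → Tight C′ D′ → Small (C ∪ C′) (D ∩ D′) × Tight (C ∪ C′) (D ∩ D′)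
    join {C} {D} {C′} {D′} s s′ σ σ′ t t′ =
      small-absorb σ σ′ (sep-join s s′) (≤-trans (s≤s (≤-trans tight
        (size-mono {S = (C ∪ C′) ∩ X} {X} λ v p → proj₂ (∧⁻ {C v ∨ C′ v} p)))) X<k) (λ _ → id) , tight
      where
      meet : size ((C ∩ C′) ∩ X) ≤ size ((C ∩ C′) ∩ (D ∪ D′))
      -- The intersection is a small side if its order is below k; otherwise its order already
      -- exceeds the size of `X`.
      meet with size ((C ∩ C′) ∩ (D ∪ D′)) <? k
      ... | yes lt = ind _ _ (sep-meet s s′)
        (small-absorb σ σ (sep-meet s s′) lt λ v p → ∨ˡ (proj₁ (∧⁻ {D v} p)))
      ... | no ge = ≤-trans (size-mono {T = X} λ v p → proj₂ (∧⁻ {C v ∧ C′ v} p))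
                      (≤-trans (<⇒≤ X<k) (≮⇒≥ ge))
      tight : Tight (C ∪ C′) (D ∩ D′)
      tight = +-cancelʳ-≤ (size ((C ∩ C′) ∩ X)) _ _ (≤-trans (+-monoʳ-≤ _ meet)
        (≤-trans (submodular s s′) (≤-trans (+-mono-≤ t t′) (modular-∩ C C′ X))))

    collect : ∀ i → i ≤ n → ¬ ¬ Collected i
    -- The start is the tight separation (X, full). The reverse orientation is impossible because
    -- its small side would contain S.
    collect zero _ done with small-dichotomy X full
        (record { cov = λ v () ; nox = λ u v _ () })
        (≤-trans (s≤s (size-mono λ v p → proj₁ (∧⁻ p))) X<k)
    ... | inj₂ σ = small-misses σ λ _ _ → refl
    ... | inj₁ σ = done (X , full , record { cov = λ v () ; nox = λ u v _ () } , σ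
      , size-mono (λ v p → ∧⁺ (proj₁ (∧⁻ {X v} p)) (proj₁ (∧⁻ {X v} p))) , (λ _ → id) , λ v _ ())
    collect (suc i) i<n done = collect i (<⇒≤ i<n) add
      where
      w = fromℕ< i<n
      last : ∀ v → toℕ v < suc i → v ≢ w → toℕ v < i
      last v lt v≢w with m≤n⇒m<n∨m≡n (≤-pred lt)
      ... | inj₁ p = p
      ... | inj₂ p = ⊥-elim (v≢w (toℕ-injective (trans p (≡-sym (toℕ-fromℕ< i<n)))))
      add : ¬ Collected i
      add (C , D , s , σ , t , X⊆C , all) with split (C w) | split (⟦ S ⟧ w)
      ... | inj₁ w∈C | _ = done (C , D , s , σ , t , X⊆C , λ v p lt →
              case v ≟ w of λ { (yes refl) → w∈C ; (no v≢w) → all v p (last v lt v≢w) })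
      ... | inj₂ _ | inj₂ w∉S = done (C , D , s , σ , t , X⊆C , λ v p lt →
              case v ≟ w of λ { (yes refl) → clash p w∉S ; (no v≢w) → all v p (last v lt v≢w) })
      ... | inj₂ w∉C | inj₁ w∈S = fail (w , w∈S , ≢⇒false (λ p → clash (X⊆C w p) w∉C) , λ C′ D′ s′ σ′ →
              ≮⇒≥ λ lt → done (enlarge C′ D′ s′ σ′ lt))
        where
        -- A witness that X + w is dependent must contain w, and it is tight because X itself is
        -- independent; uniting it with `C` collects w.
        enlarge : ∀ C′ D′ → IsSep G C′ D′ → Small C′ D′ → size (C′ ∩ D′) < size (C′ ∩ (X ⊕ w)) → Collected (suc i)
        enlarge C′ D′ s′ σ′ lt = C ∪ C′ , D ∩ D′ , sep-join s s′ , proj₁ joined , proj₂ joined ,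
            (λ v p → ∨ˡ (X⊆C v p)) , λ v p lt → case v ≟ w of λ
              { (yes refl) → ∨ʳ {C v} w∈C′ ; (no v≢w) → ∨ˡ (all v p (last v lt v≢w)) }
          where
          w∈C′ : w ∈ C′
          w∈C′ with split (C′ w)
          ... | inj₁ p = p
          ... | inj₂ p = ⊥-elim (<-irrefl refl (≤-trans lt (≤-trans
            (size-mono λ v q → ∧⁺ (proj₁ (∧⁻ {C′ v} q)) ([ id , (λ { refl → clash (proj₁ (∧⁻ {C′ v} q)) p }) ]′
              (⊕⁻ X (proj₂ (∧⁻ {C′ v} q))))) (ind C′ D′ s′ σ′))))
          tight′ : Tight C′ D′
          tight′ = ≤-pred (≤-trans lt (size-⊕ w λ v q v≢w → ∧⁺ (proj₁ (∧⁻ {C′ v} q))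
            ([ id , (λ e → ⊥-elim (v≢w e)) ]′ (⊕⁻ X (proj₂ (∧⁻ {C′ v} q))))))
          joined = join s s′ σ σ′ t tight′

  -- X is grown to exactly k vertices. Below order k, independence bounds the small side; from order
  -- k on, the size of X is bound enough.
  linked : ¬ ¬ (Σ[ X ∈ VSet n ] (X ⊆ ⟦ S ⟧ × k ≤ size X × Linked G X))
  linked done = grow k ≤-refl λ (X , X⊆S , size≡ , ind) →
      done (X , X⊆S , ≤-reflexive (≡-sym size≡) , λ C D s → side C D s X size≡ ind)
    where
    side : ∀ C D → IsSep G C D → ∀ X → size X ≡ k → Independent X →
      size (C ∩ X) ≤ size (C ∩ D) ⊎ size (D ∩ X) ≤ size (C ∩ D)
    side C D s X size≡ ind with size (C ∩ D) <? k
    ... | no ge = inj₁ (≤-trans (size-mono {T = X} λ v p → proj₂ (∧⁻ {C v} p))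
                    (≤-trans (≤-reflexive size≡) (≮⇒≥ ge)))
    ... | yes lt with small-dichotomy C D s lt
    ...   | inj₁ σ = inj₁ (ind C D s σ)
    ...   | inj₂ σ = inj₂ (≤-trans (ind D C (sep-swap s) σ) (order-swap D C))
    grow : ∀ i → i ≤ k → ¬ ¬ (Σ[ X ∈ VSet n ] (X ⊆ ⟦ S ⟧ × size X ≡ i × Independent X))
    grow zero _ done = done (empty , (λ v ()) , size-empty , λ C D _ _ →
      ≤-trans (size-mono {T = empty} λ v p → proj₂ (∧⁻ {C v} p)) (≤-trans (≤-reflexive size-empty) z≤n))
    grow (suc i) i<k done = grow i (<⇒≤ i<k) λ (X , X⊆S , size≡ , ind) →
      extend X ind (subst (_< k) (≡-sym size≡) i<k) λ (s , s∈S , s∉X , ind′) →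
      done (X ⊕ s , (λ v p → [ X⊆S v , (λ { refl → s∈S }) ]′ (⊕⁻ X p))
           , ≤-antisym (≤-trans (size-⊕ s λ v p v≢s → [ id , (λ e → ⊥-elim (v≢s e)) ]′ (⊕⁻ X p)) (s≤s (≤-reflexive size≡)))
               (subst (λ j → suc j ≤ size (X ⊕ s)) size≡ (size-⊂ s (λ v → ⊕-old X) s∉X (⊕-new X s)))
           , ind′)

-- Linked sets and treewidth

-- The length is an index so that `at` can list the vertices as the injective map that `Cycle`
-- requires.
data Path {m} (T : Graph m) (P : Fin m → Set) : ℕ → Fin m → Fin m → Set where
  stop : ∀ {u} → P u → Path T P 0 u u
  cons : ∀ {u w v k} → P u → adj T u w ≡ true → Path T P k w v → Path T P (suc k) u v

module _ {m} {T : Graph m} {P : Fin m → Set} where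

  at : ∀ {k u v} → Path T P k u v → Fin (suc k) → Fin m
  at {u = u} p            fzero    = u
  at         (cons _ _ p) (fsuc i) = at p i

  Simple : ∀ {k u v} → Path T P k u v → Set
  Simple p = Injective _≡_ _≡_ (at p)

  at-last : ∀ {k u v} (p : Path T P k u v) → at p (fromℕ k) ≡ v
  at-last (stop _)     = refl
  at-last (cons _ _ p) = at-last p

  at-P : ∀ {k u v} (p : Path T P k u v) i → P (at p i)
  at-P (stop q)     fzero    = q
  at-P (cons q _ _) fzero    = q
  at-P (cons _ _ p) (fsuc i) = at-P p i

  at-adj : ∀ {k u v} (p : Path T P k u v) (i : Fin k) → adj T (at p (inject₁ i)) (at p (fsuc i)) ≡ true
  at-adj (cons _ e (stop _))     fzero    = e
  at-adj (cons _ e (cons _ _ _)) fzero    = e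
  at-adj (cons _ _ p)            (fsuc i) = at-adj p i

  suffix : ∀ {k u v} (p : Path T P k u v) → Simple p → (i : Fin (suc k)) →
    Σ[ j ∈ ℕ ] Σ[ q ∈ Path T P j (at p i) v ] Simple q
  suffix p            s fzero    = _ , p , s
  suffix (cons _ _ p) s (fsuc i) = suffix p (λ e → suc-injective (s e)) i

  simplify : ∀ {u v} → Walk T P u v → Σ[ k ∈ ℕ ] Σ[ p ∈ Path T P k u v ] Simple p
  simplify (here q) = 0 , stop q , λ { {fzero} {fzero} _ → refl }
  simplify {u} {v} (step q e w) with simplify w
  ... | k , p , s with any? (λ i → at p i ≟ u)
  ...   | yes (i , at≡u) = subst (λ z → Σ[ k ∈ ℕ ] Σ[ p ∈ Path T P k z v ] Simple p) at≡u (suffix p s i)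
  ...   | no fresh = suc k , cons q e p , s′
    where
    s′ : Simple (cons q e p)
    s′ {fzero}  {fzero}  _ = refl
    s′ {fzero}  {fsuc j} f = ⊥-elim (fresh (j , ≡-sym f))
    s′ {fsuc i} {fzero}  f = ⊥-elim (fresh (i , f))
    s′ {fsuc i} {fsuc j} f = cong fsuc (s f)

cycle : ∀ {m} {T : Graph m} {Y : VSet m} {t a b} → t ∉ Y → adj T t a ≡ true → adj T b t ≡ true →
  a ≢ b → Walk T (_∈ Y) a b → Cycle T
cycle {m} {T} {Y} {t} {a} {b} t∉Y t~a b~t a≢b w with simplify w
... | zero  , stop _ , _ = ⊥-elim (a≢b refl)
... | suc k , p , s = record
  { len = k ; c = c ; inj = c-inj ; cons = c-adj
  ; close = subst (λ z → adj T z t ≡ true) (≡-sym (at-last p)) b~t }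
  where
  c : Fin (3 + k) → Fin m
  c fzero    = t
  c (fsuc i) = at p i
  c-inj : Injective _≡_ _≡_ c
  c-inj {fzero}  {fzero}  _ = refl
  c-inj {fzero}  {fsuc j} e = clash (subst (_∈ Y) (≡-sym e) (at-P p j)) t∉Y
  c-inj {fsuc i} {fzero}  e = clash (subst (_∈ Y) e (at-P p i)) t∉Y
  c-inj {fsuc i} {fsuc j} e = cong fsuc (s e)
  c-adj : ∀ i → adj T (c (inject₁ i)) (c (fsuc i)) ≡ true
  c-adj fzero    = t~a
  c-adj (fsuc i) = at-adj p i

some : ∀ {m} → (Fin m → Bool) → Bool
some f = does (any? λ i → f i Bool.≟ true)

some⁺ : ∀ {m} {f : Fin m → Bool} i → f i ≡ true → some f ≡ true
some⁺ {f = f} i p with any? (λ i → f i Bool.≟ true)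
... | yes _ = refl
... | no ¬q = ⊥-elim (¬q (i , p))

some⁻ : ∀ {m} {f : Fin m → Bool} → some f ≡ true → ∃ λ i → f i ≡ true
some⁻ {f = f} p with any? (λ i → f i Bool.≟ true)
... | yes q = q

-- Among the pairs (t, Y) with Y a union of components of T − t such that few vertices of X lie
-- in bags outside Y, take Y minimal. Either Y splits into two smaller unions of components, or
-- one may move to the neighbour of t in Y, unique since T is acyclic; both contradict minimality.
linked⇒¬tw : ∀ {n} {G : Graph n} {X f} → Linked G X → 3 * suc f < size X → ¬ TwAtMost G f
linked⇒¬tw {n} {G} {X} {f} linked big τ =
  heavy-absurd (∁ (_== t₀)) t₀ (<-wellFounded _) (cong not (==-refl t₀))
    (λ s s′ _ _ → case s′ ≟ t₀ of λ { (yes e) → inj₂ e ; (no ne) → inj₁ (not⁺ (≢⇒== ne)) })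
    (≤-trans (size-mono λ v p → base v (proj₁ (∧⁻ p))) (bag-small t₀))
  where
  open TreeDecomposition τ renaming (coverV to vertexBag; coverE to edgeBag)
  q : ℕ
  q = suc f
  t₀ : Fin m
  t₀ = fromℕ< (proj₁ isTree)
  bag-small : ∀ t → size ⟦ bag t ⟧ ≤ q
  bag-small t = subst (_≤ q) (size-⟦⟧ (bag t)) (width t)

  ⋃ : VSet m → VSet n
  ⋃ Y v = some λ t → Y t ∧ ⟦ bag t ⟧ v
  ⋃⁺ : ∀ {Y : VSet m} {v} t → t ∈ Y → v ∈ ⟦ bag t ⟧ → v ∈ ⋃ Y
  ⋃⁺ {Y} {v} t p r = some⁺ {f = λ t → Y t ∧ ⟦ bag t ⟧ v} t (∧⁺ p r)
  ⋃⁻ : ∀ {Y : VSet m} {v} → v ∈ ⋃ Y → ∃ λ t → t ∈ Y × v ∈ ⟦ bag t ⟧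
  ⋃⁻ {Y} {v} p with some⁻ {f = λ t → Y t ∧ ⟦ bag t ⟧ v} p
  ... | t , r = t , proj₁ (∧⁻ r) , proj₂ (∧⁻ {Y t} r)

  base : ∀ v → v ∈ ⋃ (∁ (∁ (_== t₀))) → v ∈ ⟦ bag t₀ ⟧
  base v p with ⋃⁻ p
  ... | t , r , v∈t with ==⇒≡ {u = t} (not-false (not⁻ {not (t == t₀)} r))
  ...   | refl = v∈t

  Closed : VSet m → Fin m → Set
  Closed Y t = ∀ s s′ → s ∈ Y → adj T s s′ ≡ true → s′ ∈ Y ⊎ s′ ≡ t

  leave : ∀ {Y t} {P : Fin m → Set} → Closed Y t → ∀ {s s′} → Walk T P s s′ → s ∈ Y → s′ ∉ Y → P t
  leave cl (here _) p r = clash p r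
  leave {P = P} cl (step {w = w} _ e W) p r with cl _ w p e
  ... | inj₁ w∈Y  = leave cl W w∈Y r
  ... | inj₂ refl = walk-head W

  bags-sep : ∀ Y t → IsSep G (⋃ (Y ⊕ t)) (⋃ (∁ Y))
  bags-sep Y t .cov v p with vertexBag v
  ... | s , v∈s with split (Y s)
  ...   | inj₁ s∈Y = ⋃⁺ s (⊕-old Y s∈Y) (∈⇒⟦⟧ v∈s)
  ...   | inj₂ s∉Y = clash (⋃⁺ s (not⁺ s∉Y) (∈⇒⟦⟧ v∈s)) p
  bags-sep Y t .nox u v e p r with edgeBag u v e
  ... | s , u∈s , v∈s with split (Y s)
  ...   | inj₁ s∈Y = clash (⋃⁺ s (⊕-old Y s∈Y) (∈⇒⟦⟧ v∈s)) r
  ...   | inj₂ s∉Y = clash (⋃⁺ s (not⁺ s∉Y) (∈⇒⟦⟧ u∈s)) p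

  -- The tree nodes whose bags contain a given vertex are connected, and `t` is the only way out of
  -- `Y`; so a vertex on both sides lies in the bag of `t`.
  bags-order : ∀ Y t → Closed Y t → size (⋃ (Y ⊕ t) ∩ ⋃ (∁ Y)) ≤ q
  bags-order Y t cl = ≤-trans (size-mono λ v p → inBag v (proj₁ (∧⁻ p)) (proj₂ (∧⁻ {⋃ (Y ⊕ t) v} p))) (bag-small t)
    where
    tab : ∀ v s → v ∈ ⟦ bag s ⟧ → s Subset.∈ Vec.tabulate (λ t → Vec.lookup (bag t) v)
    tab v s p = ⟦⟧⇒∈ (trans (Vec.lookup∘tabulate _ s) p)
    inBag : ∀ v → v ∈ ⋃ (Y ⊕ t) → v ∈ ⋃ (∁ Y) → v ∈ ⟦ bag t ⟧
    inBag v p r with ⋃⁻ p | ⋃⁻ r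
    ... | s , s∈ , v∈s | s′ , s′∉ , v∈s′ with ⊕⁻ Y s∈
    ...   | inj₂ refl = v∈s
    ...   | inj₁ s∈Y  = trans (≡-sym (Vec.lookup∘tabulate _ t)) (∈⇒⟦⟧
      (leave cl (subtree v s s′ (tab v s v∈s) (tab v s′ v∈s′)) s∈Y (not⁻ s′∉)))

  dichotomy : ∀ Y t → Closed Y t → size (⋃ (Y ⊕ t) ∩ X) ≤ q ⊎ size (⋃ (∁ Y) ∩ X) ≤ q
  dichotomy Y t cl with linked _ _ (bags-sep Y t)
  ... | inj₁ p = inj₁ (≤-trans p (bags-order Y t cl))
  ... | inj₂ p = inj₂ (≤-trans p (bags-order Y t cl))

  too-small : ∀ {x} → x ≤ 3 * q → size X ≤ x → ⊥
  too-small p r = <-irrefl refl (≤-trans big (≤-trans r p))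

  heavy-absurd : ∀ Y t → Acc _<_ (size Y) → t ∉ Y → Closed Y t → size (⋃ (∁ Y) ∩ X) ≤ q → ⊥
  heavy-absurd Y t (acc rec) t∉Y cl heavy
    with any? (λ t′ → (Y t′ Bool.≟ true) ×-dec (adj T t t′ Bool.≟ true))
  ... | no none = too-small (≤-trans heavy (m≤m+n q _)) (size-mono λ v p → ∧⁺ (outside v) p)
    where
    exit : ∀ {y} → Walk T (λ _ → ⊤) y t → y ∈ Y → ⊥
    exit (here _) p = clash p t∉Y
    exit (step {u} {w} _ e W) p with cl u w p e
    ... | inj₁ w∈Y  = exit W w∈Y
    ... | inj₂ refl = none (u , p , symm T e)
    outside : ∀ v → v ∈ ⋃ (∁ Y)
    outside v with vertexBag v
    ... | s , v∈s = ⋃⁺ s (not⁺ (≢⇒false λ s∈Y → exit (proj₁ (proj₂ isTree) s t) s∈Y)) (∈⇒⟦⟧ v∈s)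
  ... | yes (t′ , t′∈Y , t~t′) with reachable T Y t′ t′∈Y
  ...   | Y₁ , t′∈Y₁ , walks , closed with any? (λ z → (Y z Bool.≟ true) ×-dec (Y₁ z Bool.≟ false))
  -- Two or more components: by induction neither `Y₁` nor `Y₂` leaves few vertices of X outside, so
  -- each has few inside. With the bags outside `Y` this makes three pieces of X, the source of 3 (f
  -- + 1).
  ...     | yes (z , z∈Y , z∉Y₁) = too-small
            (+-mono-≤ light₁ (+-mono-≤ light₂ (≤-trans heavy (m≤m+n q 0))))
            (≤-trans (size-cover {A = ⋃ (Y₁ ⊕ t) ∩ X} {(⋃ (Y₂ ⊕ t) ∩ X) ∪ (⋃ (∁ Y) ∩ X)} covers)
              (+-monoʳ-≤ _ (size-cover {A = ⋃ (Y₂ ⊕ t) ∩ X} λ v p → ∨-elim {(⋃ (Y₂ ⊕ t) ∩ X) v} p)))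
    where
    Y₂ : VSet m
    Y₂ = Y ∩ ∁ Y₁
    Y₁⊆Y : Y₁ ⊆ Y
    Y₁⊆Y v p = walk-last (walks v p)
    Y₂⊆Y : Y₂ ⊆ Y
    Y₂⊆Y v p = proj₁ (∧⁻ p)
    light : ∀ Y′ → size Y′ < size Y → t ∉ Y′ → Closed Y′ t → size (⋃ (Y′ ⊕ t) ∩ X) ≤ q
    light Y′ lt t∉Y′ cl′ = [ id , (λ h → ⊥-elim (heavy-absurd Y′ t (rec lt) t∉Y′ cl′ h)) ]′ (dichotomy Y′ t cl′)
    light₁ : size (⋃ (Y₁ ⊕ t) ∩ X) ≤ q
    light₁ = light Y₁ (size-⊂ z Y₁⊆Y z∉Y₁ z∈Y) (≢⇒false λ p → clash (Y₁⊆Y t p) t∉Y) λ s s′ p e →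
      case cl s s′ (Y₁⊆Y s p) e of λ { (inj₁ r) → inj₁ (closed s s′ p r e) ; (inj₂ r) → inj₂ r }
    light₂ : size (⋃ (Y₂ ⊕ t) ∩ X) ≤ q
    light₂ = light Y₂ (size-⊂ t′ Y₂⊆Y (∧-falseʳ {Y t′} (cong not t′∈Y₁)) t′∈Y)
      (∧-falseˡ t∉Y) λ s s′ p e → case cl s s′ (Y₂⊆Y s p) e of λ
        { (inj₂ r) → inj₂ r
        ; (inj₁ r) → inj₁ (∧⁺ r (not⁺ (≢⇒false λ s′∈Y₁ →
            clash (closed s′ s s′∈Y₁ (Y₂⊆Y s p) (symm T e)) (not⁻ (proj₂ (∧⁻ {Y s} p)))))) }
    covers : ∀ v → v ∈ X → v ∈ ⋃ (Y₁ ⊕ t) ∩ X ⊎ v ∈ (⋃ (Y₂ ⊕ t) ∩ X) ∪ (⋃ (∁ Y) ∩ X)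
    covers v p with vertexBag v
    ... | s , v∈s with split (Y s) | split (Y₁ s)
    ...   | _        | inj₁ a = inj₁ (∧⁺ (⋃⁺ s (⊕-old Y₁ a) (∈⇒⟦⟧ v∈s)) p)
    ...   | inj₁ s∈Y | inj₂ b = inj₂ (∨ˡ (∧⁺ (⋃⁺ s (⊕-old Y₂ (∧⁺ s∈Y (not⁺ b))) (∈⇒⟦⟧ v∈s)) p))
    ...   | inj₂ s∉Y | inj₂ b = inj₂ (∨ʳ {(⋃ (Y₂ ⊕ t) ∩ X) v} (∧⁺ (⋃⁺ s (not⁺ s∉Y) (∈⇒⟦⟧ v∈s)) p))
  -- One component: step to its node `t′`. Two pieces cover X.
  ...     | no none = too-small (+-mono-≤ light′ (≤-trans heavy (m≤m+n q _)))
            (size-cover {A = ⋃ (Y′ ⊕ t′) ∩ X} {⋃ (∁ Y) ∩ X} covers)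
    where
    Y′ : VSet m
    Y′ = Y ∖ t′
    cl′ : Closed Y′ t′
    cl′ s s′ p e with ∖⁻ Y p
    ... | s∈Y , s≢t′ with cl s s′ s∈Y e
    ...   | inj₁ s′∈Y = case s′ ≟ t′ of λ { (yes r) → inj₂ r ; (no r) → inj₁ (∖⁺ Y s′∈Y r) }
    ...   | inj₂ refl = ⊥-elim (proj₂ (proj₂ isTree)
              (cycle t∉Y t~t′ e (λ r → s≢t′ (≡-sym r)) (walks s (≢false⇒ λ r → none (s , s∈Y , r)))))
      where
      ≢false⇒ : ∀ {b} → ¬ (b ≡ false) → b ≡ true
      ≢false⇒ {true}  _ = refl
      ≢false⇒ {false} h = ⊥-elim (h refl)
    light′ : size (⋃ (Y′ ⊕ t′) ∩ X) ≤ q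
    light′ = [ id , (λ h → ⊥-elim (heavy-absurd Y′ t′ (rec (size-⊂ t′ (λ v p → proj₁ (∖⁻ Y p)) (∉∖ Y t′) t′∈Y))
      (∉∖ Y t′) cl′ h)) ]′ (dichotomy Y′ t′ cl′)
    covers : ∀ v → v ∈ X → v ∈ ⋃ (Y′ ⊕ t′) ∩ X ⊎ v ∈ ⋃ (∁ Y) ∩ X
    covers v p with vertexBag v
    ... | s , v∈s with split (Y s)
    ...   | inj₂ s∉Y = inj₂ (∧⁺ (⋃⁺ s (not⁺ s∉Y) (∈⇒⟦⟧ v∈s)) p)
    ...   | inj₁ s∈Y with s ≟ t′
    ...     | yes refl = inj₁ (∧⁺ (⋃⁺ t′ (⊕-new Y′ t′) (∈⇒⟦⟧ v∈s)) p)
    ...     | no  s≢t′ = inj₁ (∧⁺ (⋃⁺ s (⊕-old Y′ (∖⁺ Y s∈Y s≢t′)) (∈⇒⟦⟧ v∈s)) p)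

-- Adding an apex vertex

apex : ∀ {n} → Graph n → Graph (suc n)
apex G = record { adj = a ; sym = s ; irrefl = λ { fzero → refl ; (fsuc u) → irrefl G u } }
  where
  a : Fin _ → Fin _ → Bool
  a fzero    fzero    = false
  a fzero    (fsuc v) = true
  a (fsuc u) fzero    = true
  a (fsuc u) (fsuc v) = adj G u v
  s : ∀ u v → a u v ≡ a v u
  s fzero    fzero    = refl
  s fzero    (fsuc v) = refl
  s (fsuc u) fzero    = refl
  s (fsuc u) (fsuc v) = Graph.sym G u v

withApex : ∀ {n} → VSet n → VSet (suc n)
withApex X fzero    = true
withApex X (fsuc v) = X v

size-withApex : ∀ {n} (X : VSet n) → size (withApex X) ≡ suc (size X)
size-withApex X = size-suc (withApex X)

-- If the apex misses one side, the other side is everything, being forced to contain all its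
-- neighbours, and the order is the size of the first side. If it lies in both, the order and the
-- intersections with X all grow by one.
linked-apex : ∀ {n} {G : Graph n} {X} → Linked G X → Linked (apex G) (withApex X)
linked-apex {n} {G} {X} linked C D s with split (C fzero) | split (D fzero)
... | inj₂ p | _ = inj₁ (size-mono λ v q → ∧⁺ (proj₁ (∧⁻ {C v} q)) (all v))
  where
  all : ∀ v → v ∈ D
  all fzero    = cov′ s fzero p
  all (fsuc v) with split (D (fsuc v))
  ... | inj₁ r = r
  ... | inj₂ r = ⊥-elim (nox s (fsuc v) fzero refl r p)
... | inj₁ p | inj₂ q = inj₂ (size-mono λ v r → ∧⁺ (all v) (proj₁ (∧⁻ {D v} r)))
  where
  all : ∀ v → v ∈ C
  all fzero = p
  all (fsuc v) with split (C (fsuc v))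
  ... | inj₁ r = r
  ... | inj₂ r = ⊥-elim (nox s fzero (fsuc v) refl q r)
... | inj₁ p | inj₁ q with linked (C ∘ fsuc) (D ∘ fsuc)
      (record { cov = cov s ∘ fsuc ; nox = λ u v → nox s (fsuc u) (fsuc v) })
...   | h = [ inj₁ ∘ lift C p , inj₂ ∘ lift D q ]′ h
  where
  lift : ∀ B → fzero ∈ B → size ((B ∘ fsuc) ∩ X) ≤ size ((C ∘ fsuc) ∩ (D ∘ fsuc)) →
    size (B ∩ withApex X) ≤ size (C ∩ D)
  lift B r h = subst₂ _≤_ (≡-sym (eq B (withApex X) r refl)) (≡-sym (eq C D p q)) (s≤s h)
    where
    eq : ∀ A B → fzero ∈ A → fzero ∈ B → size (A ∩ B) ≡ suc (size ((A ∘ fsuc) ∩ (B ∘ fsuc)))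
    eq A B a b = trans (size-suc (A ∩ B)) (cong (λ x → bit x + size ((A ∩ B) ∘ fsuc)) (∧⁺ a b))

-- Grid models and their cuts

-- One partial function instead of a family of sets: branch sets are disjoint for free and
-- relabelling is composition.
Labelling : ℕ → Set
Labelling n = Fin n → Maybe (ℕ × ℕ)

-- The branch set of the cell (i , j) is the fibre of the labelling over just (i , j); labels outside
-- the a × b range carry no meaning.
record GridModel {n} (G : Graph n) (a b : ℕ) (lab : Labelling n) : Set where
  field
    cell  : ∀ {i j} → i < a → j < b → ∃ λ v → lab v ≡ just (i , j)
    conn  : ∀ {i j} → i < a → j < b → ConnectedSet G (λ v → lab v ≡ just (i , j))
    right : ∀ {i j} → i < a → suc j < b → ∃ λ u → ∃ λ v →
            lab u ≡ just (i , j) × lab v ≡ just (i , suc j) × adj G u v ≡ true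
    down  : ∀ {i j} → suc i < a → j < b → ∃ λ u → ∃ λ v →
            lab u ≡ just (i , j) × lab v ≡ just (suc i , j) × adj G u v ≡ true
open GridModel public

-- The default `d` serves unlabelled vertices; it is always chosen out of range, so that they count
-- for no row or column.
row col : ∀ {n} → ℕ → Labelling n → Fin n → ℕ
row d lab v = case lab v of λ { (just (i , j)) → i ; nothing → d }
col d lab v = case lab v of λ { (just (i , j)) → j ; nothing → d }

row-just : ∀ {n} d {lab : Labelling n} {v i j} → lab v ≡ just (i , j) → row d lab v ≡ i
row-just d {lab} {v} e with lab v
row-just d refl | just _ = refl

col-just : ∀ {n} d {lab : Labelling n} {v i j} → lab v ≡ just (i , j) → col d lab v ≡ j
col-just d {lab} {v} e with lab v
col-just d refl | just _ = refl

module _ {n : ℕ} where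

  InRow InCol : ℕ → Labelling n → ℕ → Fin n → Set
  InRow b lab i v = ∃ λ j → j < b × lab v ≡ just (i , j)
  InCol a lab j v = ∃ λ i → i < a × lab v ≡ just (i , j)

  module _ {G : Graph n} {a b : ℕ} {lab : Labelling n} (M : GridModel G a b lab) where

    row-connected : ∀ {i} → i < a → ConnectedSet G (InRow b lab i)
    row-connected {i} i<a u v (j , j<b , p) (j′ , j′<b , q) =
      walk-++ (toStart j u j<b p) (walk-rev (toStart j′ v j′<b q))
      where
      s = cell M i<a (≤-trans (s≤s z≤n) j<b)
      toStart : ∀ j u → j < b → lab u ≡ just (i , j) → Walk G (InRow b lab i) u (proj₁ s)
      toStart zero u lt p = walk-map (λ v q → 0 , lt , q) (λ _ _ _ _ → id)
        (conn M i<a lt u (proj₁ s) p (proj₂ s))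
      toStart (suc j) u lt p with right M i<a lt
      ... | x , y , x∈ , y∈ , e =
        walk-++ (walk-map (λ v q → suc j , lt , q) (λ _ _ _ _ → id) (conn M i<a lt u y p y∈))
                (step (suc j , lt , y∈) (symm G e) (toStart j x (<⇒≤ lt) x∈))

    col-connected : ∀ {j} → j < b → ConnectedSet G (InCol a lab j)
    col-connected {j} j<b u v (i , i<a , p) (i′ , i′<a , q) =
      walk-++ (toStart i u i<a p) (walk-rev (toStart i′ v i′<a q))
      where
      s = cell M (≤-trans (s≤s z≤n) i<a) j<b
      toStart : ∀ i u → i < a → lab u ≡ just (i , j) → Walk G (InCol a lab j) u (proj₁ s)
      toStart zero u lt p = walk-map (λ v q → 0 , lt , q) (λ _ _ _ _ → id)
        (conn M lt j<b u (proj₁ s) p (proj₂ s))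
      toStart (suc i) u lt p with down M lt j<b
      ... | x , y , x∈ , y∈ , e =
        walk-++ (walk-map (λ v q → suc i , lt , q) (λ _ _ _ _ → id) (conn M lt j<b u y p y∈))
                (step (suc i , lt , y∈) (symm G e) (toStart i x (<⇒≤ lt) x∈))

  RowOff : ℕ → Labelling n → ℕ → VSet n → Set
  RowOff b lab i C = ∀ v → InRow b lab i v → v ∉ C

  SomeRowOff : ℕ → ℕ → Labelling n → VSet n → Set
  SomeRowOff a b lab C = ∃ λ i → i < a × RowOff b lab i C

  free-row : ∀ a b (lab : Labelling n) Q → size Q < a → SomeRowOff a b lab Q
  free-row a b lab Q lt with avoids-value a {Q} (row a lab) lt
  ... | i , i<a , h = i , i<a , λ v (j , _ , e) → ≢⇒false λ p → h v p (row-just a {lab} e)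

  -- Two rows off the separator are linked by a column off the separator.
  rowOff-spread : ∀ {G a b lab} → GridModel G a b lab → ∀ {C D} → IsSep G C D → size (C ∩ D) < b →
    SomeRowOff a b lab C → ∀ {i} → i < a → RowOff b lab i (C ∩ D) → RowOff b lab i C
  rowOff-spread {a = a} {b} {lab} M {C} {D} s lt (i₀ , i₀<a , off) {i} i<a avoid
    with avoids-value b {C ∩ D} (col b lab) lt
  ... | j , j<b , h with cell M i₀<a j<b | cell M i<a j<b
  ...   | u , u∈ | v , v∈ = λ w w∈ →
    walk-side s avoid (row-connected M i<a v w (j , j<b , v∈) w∈)
      (walk-side s (λ z (_ , _ , e) → ≢⇒false λ p → h z p (col-just b {lab} e))
        (col-connected M j<b u v (i₀ , i₀<a , u∈) (i , i<a , v∈)) (off u (j , j<b , u∈)))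

  -- One row beyond `C` suffices to name the grid side: if the order is below the number of columns,
  -- `rowOff-spread` transfers this to every row that the separator misses.
  record Cut (G : Graph n) (a b : ℕ) (lab : Labelling n) (P C D : VSet n) : Set where
    field
      isSep : IsSep G C D
      P⊆    : P ⊆ C
      off   : SomeRowOff a b lab C
  open Cut public

  Free : Graph n → ℕ → ℕ → Labelling n → VSet n → ℕ → Set
  Free G a b lab P k = ∀ C D → Cut G a b lab P C D → k ≤ size (C ∩ D)

  sep-⊆ : ∀ {G H : Graph n} → (∀ u v → adj H u v ≡ true → adj G u v ≡ true) →
    ∀ {C D} → IsSep G C D → IsSep H C D
  sep-⊆ h s .cov = cov s
  sep-⊆ h s .nox u v e = nox s u v (h u v e)

  free-⊆ : ∀ {G H : Graph n} {a b lab P k} → (∀ u v → adj H u v ≡ true → adj G u v ≡ true) →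
    Free H a b lab P k → Free G a b lab P k
  free-⊆ h free C D c = free C D record { isSep = sep-⊆ h (isSep c) ; P⊆ = P⊆ c ; off = off c }

  gridModel-⊆ : ∀ {G H : Graph n} {a b lab} → (∀ u v → adj H u v ≡ true → adj G u v ≡ true) →
    GridModel H a b lab → GridModel G a b lab
  gridModel-⊆ h M .cell = cell M
  gridModel-⊆ h M .conn p q u v x y = walk-map (λ _ → id) (λ u v _ _ → h u v) (conn M p q u v x y)
  gridModel-⊆ h M .right p q = let (u , v , x , y , e) = right M p q in u , v , x , y , h u v e
  gridModel-⊆ h M .down  p q = let (u , v , x , y , e) = down M p q in u , v , x , y , h u v e

  Maximal : Graph n → ℕ → ℕ → Labelling n → VSet n → ℕ → VSet n → Set
  Maximal G a b lab P k C₀ = ∀ C D → Cut G a b lab P C D → size (C ∩ D) ≤ k → C₀ ⊆ C → C ⊆ C₀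

  maximal-cut : ∀ {G a b lab P k C D} → Cut G a b lab P C D → size (C ∩ D) ≤ k →
    ¬ ¬ (Σ[ C₀ ∈ VSet n ] Σ[ D₀ ∈ VSet n ]
      (Cut G a b lab P C₀ D₀ × size (C₀ ∩ D₀) ≤ k × C ⊆ C₀ × Maximal G a b lab P k C₀))
  maximal-cut {G} {a} {b} {lab} {P} {k} {C} c le = go _ _ (<-wellFounded _) c le (λ _ → id)
    where
    go : ∀ C₁ D₁ → Acc _<_ (size (∁ C₁)) → Cut G a b lab P C₁ D₁ → size (C₁ ∩ D₁) ≤ k → C ⊆ C₁ →
      ¬ ¬ (Σ[ C₀ ∈ VSet n ] Σ[ D₀ ∈ VSet n ]
        (Cut G a b lab P C₀ D₀ × size (C₀ ∩ D₀) ≤ k × C ⊆ C₀ × Maximal G a b lab P k C₀))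
    go C₁ D₁ (acc rec) c₁ le₁ C⊆ done = done (C₁ , D₁ , c₁ , le₁ , C⊆ , λ C₂ D₂ c₂ le₂ sub v v∈ →
      case split (C₁ v) of λ
        { (inj₁ p) → p
        ; (inj₂ p) → ⊥-elim (go C₂ D₂ (rec (size-∁-< v sub p v∈)) c₂ le₂ (λ w q → sub w (C⊆ w q)) done) })

  -- Deleting an edge behind a maximal cut of order k keeps P free: a smaller cut of G − xy,
  -- enlarged by an end of xy, would uncross with the maximal one to a larger cut of order k.
  free-delete : ∀ {G a b lab P k C₀ D₀ x y} → GridModel G a b lab → suc (k + k) < a → k < b →
    Free G a b lab P k → Cut G a b lab P C₀ D₀ → size (C₀ ∩ D₀) ≤ k → Maximal G a b lab P k C₀ →
    adj G x y ≡ true → x ∉ C₀ → Free (delete G x y) a b lab P k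
  free-delete {G} {a} {b} {lab} {P} {k} {C₀} {D₀} {x} {y} M 2k<a k<b free c₀ le₀ max xy x∉C₀ C D c =
    ≮⇒≥ λ lt → <-irrefl refl (≤-trans lt (free C D record
      { isSep = record { cov = cov s ; nox = nox′ lt } ; P⊆ = P⊆ c ; off = off c }))
    where
    s = isSep c
    crossing : size (C ∩ D) < k → ∀ u v → u ∉ D → v ∉ C →
      (∀ u′ v′ → adj G u′ v′ ≡ true → u′ ∉ D → v′ ∉ C → u′ ≡ u × v′ ≡ v) → x ∈ C ⊎ x ≡ v → ⊥
    crossing lt u v u∉D v∉C only x∈ = clash (max _ _ joined ∪≤k (λ w → ∨ˡ) x x∈∪) x∉C₀
      where
      -- Adding u to `D`, or v to `C`, repairs (C, D) to a separation of G of order at most k. The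
      -- first locates rows beyond `C`, the second is uncrossed with the maximal cut.
      s₁ : IsSep G C (D ⊕ u)
      s₁ .cov w p = cov s w (proj₁ (∨-false p))
      s₁ .nox u′ v′ e p q with ∨-false {D u′} p
      ... | p₁ , p₂ with only u′ v′ e p₁ q
      ...   | refl , refl = clash (==-refl u) p₂
      s₂ : IsSep G (C ⊕ v) D
      s₂ .cov w p = ∨ˡ (cov s w p)
      s₂ .nox u′ v′ e p q with ∨-false {C v′} q
      ... | q₁ , q₂ with only u′ v′ e p q₁
      ...   | refl , refl = clash (==-refl v) q₂
      o₁ : size (C ∩ (D ⊕ u)) ≤ k
      o₁ = ≤-trans (size-⊕ {S = C ∩ D} u λ w p w≢u → ∧⁺ (proj₁ (∧⁻ {C w} p))
             ([ id , (λ e → ⊥-elim (w≢u e)) ]′ (⊕⁻ D (proj₂ (∧⁻ {C w} p))))) lt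
      o₂ : size ((C ⊕ v) ∩ D) ≤ k
      o₂ = ≤-trans (size-⊕ {S = C ∩ D} v λ w p w≢v → ∧⁺ ([ id , (λ e → ⊥-elim (w≢v e)) ]′
             (⊕⁻ C (proj₁ (∧⁻ p)))) (proj₂ (∧⁻ {(C ⊕ v) w} p))) lt
      -- A row avoiding both separators and v lies beyond both sides, so that the union and the
      -- intersection are again cuts; 2k + 1 < a leaves room for it.
      Q : VSet n
      Q = ((C₀ ∩ D₀) ∪ (C ∩ (D ⊕ u))) ⊕ v
      Q<a : size Q < a
      Q<a = ≤-trans (s≤s (≤-trans (size-⊕ {S = (C₀ ∩ D₀) ∪ (C ∩ (D ⊕ u))} v λ w p w≢v →
                [ id , (λ e → ⊥-elim (w≢v e)) ]′ (⊕⁻ ((C₀ ∩ D₀) ∪ (C ∩ (D ⊕ u))) p))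
              (s≤s (≤-trans (size-cover {A = C₀ ∩ D₀} λ w → ∨-elim) (+-mono-≤ le₀ o₁))))) 2k<a
      r = free-row a b lab Q Q<a
      i = proj₁ r
      i<a = proj₁ (proj₂ r)
      Qoff : RowOff b lab i Q
      Qoff = proj₂ (proj₂ r)
      off₀ : RowOff b lab i C₀
      off₀ = rowOff-spread M (isSep c₀) (≤-trans (s≤s le₀) k<b) (off c₀) i<a
        λ w w∈ → proj₁ (∨-false (proj₁ (∨-false (Qoff w w∈))))
      offC : RowOff b lab i C
      offC = rowOff-spread M s₁ (≤-trans (s≤s o₁) k<b) (off c) i<a
        λ w w∈ → proj₂ (∨-false {(C₀ ∩ D₀) w} (proj₁ (∨-false (Qoff w w∈))))
      off₂ : RowOff b lab i (C ⊕ v)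
      off₂ w w∈ = ∨-false⁺ (offC w w∈) (proj₂ (∨-false {((C₀ ∩ D₀) ∪ (C ∩ (D ⊕ u))) w} (Qoff w w∈)))
      joined : Cut G a b lab P (C₀ ∪ (C ⊕ v)) (D₀ ∩ D)
      joined = record { isSep = sep-join (isSep c₀) s₂ ; P⊆ = λ w p → ∨ˡ (P⊆ c₀ w p)
        ; off = i , i<a , λ w w∈ → ∨-false⁺ (off₀ w w∈) (off₂ w w∈) }
      met : Cut G a b lab P (C₀ ∩ (C ⊕ v)) (D₀ ∪ D)
      met = record { isSep = sep-meet (isSep c₀) s₂ ; P⊆ = λ w p → ∧⁺ (P⊆ c₀ w p) (⊕-old C (P⊆ c w p))
        ; off = i , i<a , λ w w∈ → ∧-falseˡ (off₀ w w∈) }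
      ∪≤k : size ((C₀ ∪ (C ⊕ v)) ∩ (D₀ ∩ D)) ≤ k
      -- The intersection is a cut of `P`, hence of order at least k, and submodularity leaves at
      -- most k for the union, which contains x against the maximality of `C₀`.
      ∪≤k = +-cancelʳ-≤ k _ _ (≤-trans (+-monoʳ-≤ _ (free _ _ met))
              (≤-trans (submodular (isSep c₀) s₂) (+-mono-≤ le₀ o₂)))
      x∈∪ : x ∈ C₀ ∪ (C ⊕ v)
      x∈∪ = ∨ʳ {C₀ x} ([ ⊕-old C , (λ { refl → ⊕-new C x }) ]′ x∈)
    nox′ : size (C ∩ D) < k → ∀ u v → adj G u v ≡ true → u ∉ D → v ∉ C → ⊥
    nox′ lt u v e p q with delete-or G {x} {y} u v e
    ... | inj₁ e′ = nox s u v e′ p q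
    ... | inj₂ uv = crossing lt u v p q (λ u′ v′ e′ p′ q′ → delete-crossing-unique s e p q e′ p′ q′)
      ([ (λ { (refl , _) → inj₁ (cov s x p) }) , (λ { (_ , refl) → inj₂ refl }) ]′ uv)

-- A grid that cannot be cut off from a linked set

-- Both ends of xy lie in `A`, so xy cannot cross once `A` is added to one side.
sep-lift : ∀ {n} {G : Graph n} {x y C D W A} → IsSep G W A → x ∈ A → y ∈ A →
  IsSep (delete G x y) C D → IsSep G (C ∪ A) (D ∩ W)
sep-lift {D = D} t x∈A y∈A s .cov v p with ∧-false {D v} p
... | inj₁ q = ∨ˡ (cov s v q)
... | inj₂ q = ∨ʳ (cov′ t v q)
sep-lift {G = G} {x} {y} {D = D} t x∈A y∈A s .nox u v e p q with ∨-false q | ∧-false {D u} p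
... | _   , v∉A | inj₂ u∉W = nox t v u (symm G e) v∉A u∉W
... | v∉C , v∉A | inj₁ u∉D with delete-or G {x} {y} u v e
...   | inj₁ f                 = nox s u v f u∉D v∉C
...   | inj₂ (inj₁ (_ , refl)) = clash y∈A v∉A
...   | inj₂ (inj₂ (_ , refl)) = clash x∈A v∉A

-- (W , A) has order j and A contains a grid to which W is still j-linked in G − xy, so every
-- separation of G − xy can be pushed off A without raising its order.
linked-delete : ∀ {n} {G : Graph n} {a b lab X W A j x y} → GridModel (delete G x y) a b lab →
  j + (j + j) < a → j < b → Cut G a b lab X W A → size (W ∩ A) ≤ j →
  Free (delete G x y) a b lab W j → adj G x y ≡ true → x ∉ W → Linked G X → Linked (delete G x y) X
linked-delete {n} {G} {a} {b} {lab} {X} {W} {A} {j} {x} {y} M 3j<a j<b cut le free xy x∉W linked = result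
  where
  H = delete G x y
  t = isSep cut
  t′ : IsSep H W A
  t′ = sep-⊆ (delete-⊆ G) t
  x∈A : x ∈ A
  x∈A = cov′ t x x∉W
  y∈A : y ∈ A
  y∈A with split (A y)
  ... | inj₁ q = q
  ... | inj₂ q = ⊥-elim (nox t y x (symm G xy) q x∉W)

  -- Linkedness in G applies to the lifted separation, whose sides still contain `C ∩ X` and `D ∩ X`
  -- because X lies in `W`.
  pushed : ∀ {C D} → IsSep H C D → ∀ {r} → size ((C ∪ A) ∩ (D ∩ W)) ≤ r →
    size (C ∩ X) ≤ r ⊎ size (D ∩ X) ≤ r
  pushed {C} {D} s p with linked _ _ (sep-lift t x∈A y∈A s)
  ... | inj₁ q = inj₁ (≤-trans (size-mono λ v r → ∧⁺ (∨ˡ (proj₁ (∧⁻ {C v} r))) (proj₂ (∧⁻ {C v} r))) (≤-trans q p))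
  ... | inj₂ q = inj₂ (≤-trans (size-mono λ v r → let v∈X = proj₂ (∧⁻ {D v} r) in
                   ∧⁺ (∧⁺ (proj₁ (∧⁻ r)) (P⊆ cut v v∈X)) v∈X) (≤-trans q p))

  -- If lifting raises the order, submodularity lowers the order of the opposite corner below that
  -- of (W, A).
  inner : ∀ {C D} → IsSep H C D → size (C ∩ D) < size ((C ∪ A) ∩ (D ∩ W)) → size ((C ∩ A) ∩ (D ∪ W)) < j
  inner {C} {D} s lt = +-cancelˡ-< (size (C ∩ D)) _ _ (≤-trans (+-monoˡ-< _ lt)
    (≤-trans (submodular s (sep-swap t′)) (+-monoʳ-≤ _ (≤-trans (order-swap A W) le))))

  -- A row avoiding the corner and `W` cannot reach beyond `D ∪ W`: it would do so entirely and make
  -- the corner a cut of `W` of order below j.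
  row-inside : ∀ {C D i} → IsSep H C D → size ((C ∩ A) ∩ (D ∪ W)) < j → i < a →
    RowOff b lab i ((C ∩ A) ∩ (D ∪ W)) → RowOff b lab i W → ∀ v → InRow b lab i v → v ∈ D
  row-inside {C} {D} {i} s lt i<a avoid offW v v∈ with split (D v)
  ... | inj₁ p = p
  ... | inj₂ p = ⊥-elim (<-irrefl refl (≤-trans lt (≤-trans (free (D ∪ W) (C ∩ A) record
    { isSep = r ; P⊆ = λ w → ∨ʳ
    ; off = i , i<a , λ w w∈ → walk-side r
        (λ z z∈ → ≢⇒false λ q → clash (∧⁺ (proj₂ (∧⁻ {(D ∪ W) z} q)) (proj₁ (∧⁻ q))) (avoid z z∈))
        (row-connected M i<a v w v∈ w∈) (∨-false⁺ p (offW v v∈)) })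
    (order-swap (D ∪ W) (C ∩ A)))))
    where
    r : IsSep H (D ∪ W) (C ∩ A)
    r = sep-join (sep-swap s) t′

  result : Linked H X
  result C D s with size ((C ∪ A) ∩ (D ∩ W)) ≤? size (C ∩ D) | size ((D ∪ A) ∩ (C ∩ W)) ≤? size (C ∩ D)
  ... | yes p | _     = pushed s p
  ... | no _  | yes p = [ inj₂ , inj₁ ]′ (pushed (sep-swap s) p)
  -- A row missing both corners and `W ∩ A` lies in `C`, `D` and `A`, thus in a corner that it
  -- misses. These three sets explain the bound 3j < a.
  ... | no ¬p | no ¬q = ⊥-elim (clash (∧⁺ (∧⁺ v∈C (cov′ t v (offW v v∈))) (∨ˡ v∈D)) (off₁ v v∈))
    where
    Y₁ Y₂ Q : VSet n
    Y₁ = (C ∩ A) ∩ (D ∪ W)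
    Y₂ = (D ∩ A) ∩ (C ∪ W)
    Q = Y₁ ∪ (Y₂ ∪ (W ∩ A))
    lt₁ : size Y₁ < j
    lt₁ = inner s (≰⇒> ¬p)
    lt₂ : size Y₂ < j
    lt₂ = inner (sep-swap s) (≤-trans (s≤s (order-swap D C)) (≰⇒> ¬q))
    r = free-row a b lab Q (≤-trans (s≤s (≤-trans (size-cover {A = Y₁} {Y₂ ∪ (W ∩ A)} λ v → ∨-elim)
          (+-mono-≤ (<⇒≤ lt₁) (≤-trans (size-cover {A = Y₂} {W ∩ A} λ v → ∨-elim) (+-mono-≤ (<⇒≤ lt₂) le))))) 3j<a)
    i = proj₁ r
    i<a = proj₁ (proj₂ r)
    off₁ : RowOff b lab i Y₁
    off₁ v v∈ = proj₁ (∨-false (proj₂ (proj₂ r) v v∈))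
    off₂ : RowOff b lab i Y₂
    off₂ v v∈ = proj₁ (∨-false (proj₂ (∨-false {Y₁ v} (proj₂ (proj₂ r) v v∈))))
    offW : RowOff b lab i W
    offW = rowOff-spread M t′ (≤-trans (s≤s le) j<b) (off cut) i<a
      λ v v∈ → proj₂ (∨-false {Y₂ v} (proj₂ (∨-false {Y₁ v} (proj₂ (proj₂ r) v v∈))))
    first = cell M i<a (≤-trans (s≤s z≤n) j<b)
    v = proj₁ first
    v∈ : InRow b lab i v
    v∈ = 0 , ≤-trans (s≤s z≤n) j<b , proj₂ first
    v∈D : v ∈ D
    v∈D = row-inside s lt₁ i<a off₁ offW v v∈
    v∈C : v ∈ C
    v∈C = row-inside (sep-swap s) lt₂ i<a off₂ offW v v∈

gridModel-mono : ∀ {n} {G H : Graph n} {a b a′ b′ lab} → a′ ≤ a → b′ ≤ b →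
  (∀ u v {i j i′ j′} → lab u ≡ just (i , j) → lab v ≡ just (i′ , j′) → j < b′ → j′ < b′ →
    adj G u v ≡ true → adj H u v ≡ true) →
  GridModel G a b lab → GridModel H a′ b′ lab
gridModel-mono a≤ b≤ h M .cell p q = cell M (≤-trans p a≤) (≤-trans q b≤)
gridModel-mono a≤ b≤ h M .conn p q u v x y =
  walk-map (λ _ → id) (λ u v x y → h u v x y q q) (conn M (≤-trans p a≤) (≤-trans q b≤) u v x y)
gridModel-mono a≤ b≤ h M .right p q with right M (≤-trans p a≤) (≤-trans q b≤)
... | u , v , x , y , e = u , v , x , y , h u v x y (<⇒≤ q) q e
gridModel-mono a≤ b≤ h M .down p q with down M (≤-trans p a≤) (≤-trans q b≤)
... | u , v , x , y , e = u , v , x , y , h u v x y q q e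

-- A model whose rows are cut off from X by a small cut has an irrelevant edge: delete an edge of
-- that model into its last column and start again.
linked⇒free-grid : ∀ {n} (G : Graph n) {X a b k} → k + (k + k) < a → k < b →
  (∀ (H : Graph n) → Linked H X → ¬ ¬ (Σ[ lab ∈ Labelling n ] GridModel H a (suc b) lab)) →
  Linked G X → ¬ ¬ (Σ[ lab ∈ Labelling n ] (GridModel G a b lab × Free G a b lab X k))
linked⇒free-grid {n} G {X} {a} {suc b} {k} 3k<a k<b grids = go G (<-wellFounded _)
  where
  Goal : Graph n → Set
  Goal G = Σ[ lab ∈ Labelling n ] (GridModel G a (suc b) lab × Free G a (suc b) lab X k)
  go : ∀ G → Acc _<_ (edgeCount G) → Linked G X → ¬ ¬ Goal G
  go G (acc rec) linked done = grids G linked λ (lab , M⁺) →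
    done (lab , gridModel-mono ≤-refl (n≤1+n _) (λ _ _ _ _ _ _ → id) M⁺ , λ C D c →
      ≮⇒≥ λ lt → smallest lab M⁺ C D (<-wellFounded _) c lt)
    where
    smallest : ∀ lab → GridModel G a (2 + b) lab → ∀ W A → Acc _<_ (size (W ∩ A)) →
      Cut G a (suc b) lab X W A → size (W ∩ A) < k → ⊥
    -- Descend to a cut of least order j. Then X is j-free, and so is every set that contains X, in
    -- particular `W`.
    smallest lab M⁺ W A (acc rec′) cut lt = ¬¬-excluded-middle {A = Free G a (suc b) lab X (size (W ∩ A))} λ where
        (no ¬free) → ¬free λ C D c → ≮⇒≥ λ lt′ → smallest lab M⁺ C D (rec′ lt′) c (<-trans lt′ lt)
        (yes free) → maximal-cut {k = size (W ∩ A)} record { isSep = isSep cut ; P⊆ = λ _ → id ; off = off cut } ≤-refl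
          λ (C₀ , D₀ , c₀ , le₀ , W⊆C₀ , max) → prune free c₀ le₀ W⊆C₀ max
      where
      j = size (W ∩ A)
      j<b : j < suc b
      j<b = <-trans lt k<b
      3j<a : j + (j + j) < a
      3j<a = ≤-trans (s≤s (+-mono-≤ (<⇒≤ lt) (+-mono-≤ (<⇒≤ lt) (<⇒≤ lt)))) 3k<a
      2j<a : suc (j + j) < a
      2j<a = ≤-trans (s≤s (≤-trans (+-mono-≤ lt (<⇒≤ lt)) (+-monoʳ-≤ k (m≤m+n k k)))) 3k<a
      prune : Free G a (suc b) lab X j → ∀ {C₀ D₀} → Cut G a (suc b) lab W C₀ D₀ →
        size (C₀ ∩ D₀) ≤ j → W ⊆ C₀ → Maximal G a (suc b) lab W j C₀ → ⊥
      prune free {C₀} c₀ le₀ W⊆C₀ max with off c₀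
      -- The spare column of `M⁺` supplies an edge that `M` does not use, and row i places its end x
      -- beyond `C₀`.
      ... | i , i<a , offC₀ with right M⁺ i<a ≤-refl
      ...   | x , y , x∈ , y∈ , e = go (delete G x y) (rec (edgeCount-delete G x y e))
              (linked-delete M′ 3j<a j<b cut ≤-refl free′ e (≢⇒false λ p → clash (W⊆C₀ x p) x∉C₀) linked)
              λ (lab′ , M₁ , free₁) → done (lab′ , gridModel-⊆ (delete-⊆ G) M₁ , free-⊆ (delete-⊆ G) free₁)
        where
        x∉C₀ : x ∉ C₀
        x∉C₀ = offC₀ x (b , ≤-refl , x∈)
        M : GridModel G a (suc b) lab
        M = gridModel-mono ≤-refl (n≤1+n _) (λ _ _ _ _ _ _ → id) M⁺
        notLast : ∀ {v i j} → v ≡ y → lab v ≡ just (i , j) → j < suc b → ⊥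
        notLast refl p lt with just-injective (trans (≡-sym p) y∈)
        ... | refl = <-irrefl refl lt
        M′ : GridModel (delete G x y) a (suc b) lab
        M′ = gridModel-mono ≤-refl ≤-refl keep M
          where
          keep : ∀ u v {i j i′ j′} → lab u ≡ just (i , j) → lab v ≡ just (i′ , j′) →
            j < suc b → j′ < suc b → adj G u v ≡ true → adj (delete G x y) u v ≡ true
          keep u v p q l l′ f with delete-or G {x} {y} u v f
          ... | inj₁ g = g
          ... | inj₂ (inj₁ (_ , v≡y)) = ⊥-elim (notLast v≡y q l′)
          ... | inj₂ (inj₂ (u≡y , _)) = ⊥-elim (notLast u≡y p l)
        free′ : Free (delete G x y) a (suc b) lab W j
        free′ = free-delete M 2j<a j<b
          (λ C D c → free C D record { isSep = isSep c ; P⊆ = λ v p → P⊆ c v (P⊆ cut v p) ; off = off c })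
          c₀ le₀ max e x∉C₀

-- Coarsening grid models

_⟫_ : ∀ {n} → Labelling n → (ℕ × ℕ → Maybe (ℕ × ℕ)) → Labelling n
(lab ⟫ φ) v = lab v >>= φ

⟫⁻ : ∀ {n} (lab : Labelling n) φ {v x} → (lab ⟫ φ) v ≡ just x → ∃ λ p → lab v ≡ just p × φ p ≡ just x
⟫⁻ lab φ {v} e with lab v
... | just p = p , refl , e

⟫⁺ : ∀ {n} (lab : Labelling n) φ {v p x} → lab v ≡ just p → φ p ≡ just x → (lab ⟫ φ) v ≡ just x
⟫⁺ lab φ {v} e f rewrite e = f

InRange : ℕ → ℕ → ℕ × ℕ → Set
InRange a b (i , j) = i < a × j < b

data Step : ℕ × ℕ → ℕ × ℕ → Set where
  rightward : ∀ {i j} → Step (i , j) (i , suc j)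
  leftward  : ∀ {i j} → Step (i , suc j) (i , j)
  downward  : ∀ {i j} → Step (i , j) (suc i , j)
  upward    : ∀ {i j} → Step (suc i , j) (i , j)

step-sym : ∀ {p q} → Step p q → Step q p
step-sym rightward = leftward
step-sym leftward  = rightward
step-sym downward  = upward
step-sym upward    = downward

data GWalk (P : ℕ × ℕ → Set) : ℕ × ℕ → ℕ × ℕ → Set where
  stay : ∀ {p} → P p → GWalk P p p
  move : ∀ {p q r} → P p → Step p q → GWalk P q r → GWalk P p r

gwalk-++ : ∀ {P p q r} → GWalk P p q → GWalk P q r → GWalk P p r
gwalk-++ (stay _)     w = w
gwalk-++ (move x s v) w = move x s (gwalk-++ v w)

gwalk-head : ∀ {P p q} → GWalk P p q → P p
gwalk-head (stay x)     = x
gwalk-head (move x _ _) = x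

gwalk-rev : ∀ {P p q} → GWalk P p q → GWalk P q p
gwalk-rev (stay x)     = stay x
gwalk-rev (move x s w) = gwalk-++ (gwalk-rev w) (move (gwalk-head w) (step-sym s) (stay x))

h-segment : ∀ {P i} c d → (∀ e → c ≤ e → e ≤ c + d → P (i , e)) → GWalk P (i , c) (i , c + d)
h-segment {P} {i} c zero    h = subst (λ e → GWalk P (i , c) (i , e)) (≡-sym (+-identityʳ c))
  (stay (h c ≤-refl (m≤m+n c 0)))
h-segment {P} {i} c (suc d) h = move (h c ≤-refl (m≤m+n c _)) rightward
  (subst (λ e → GWalk P (i , suc c) (i , e)) (≡-sym (+-suc c d))
    (h-segment (suc c) d λ e p q → h e (<⇒≤ p) (≤-trans q (≤-reflexive (≡-sym (+-suc c d))))))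

v-segment : ∀ {P j} r d → (∀ e → r ≤ e → e ≤ r + d → P (e , j)) → GWalk P (r , j) (r + d , j)
v-segment {P} {j} r zero    h = subst (λ e → GWalk P (r , j) (e , j)) (≡-sym (+-identityʳ r))
  (stay (h r ≤-refl (m≤m+n r 0)))
v-segment {P} {j} r (suc d) h = move (h r ≤-refl (m≤m+n r _)) downward
  (subst (λ e → GWalk P (suc r , j) (e , j)) (≡-sym (+-suc r d))
    (v-segment (suc r) d λ e p q → h e (<⇒≤ p) (≤-trans q (≤-reflexive (≡-sym (+-suc r d))))))

h-walk : ∀ {P i c c′} → c ≤ c′ → (∀ e → c ≤ e → e ≤ c′ → P (i , e)) → GWalk P (i , c) (i , c′)
h-walk {P} {i} {c} {c′} le h = subst (λ e → GWalk P (i , c) (i , e)) (m+[n∸m]≡n le)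
  (h-segment c (c′ ∸ c) λ e p q → h e p (≤-trans q (≤-reflexive (m+[n∸m]≡n le))))

v-walk : ∀ {P j r r′} → r ≤ r′ → (∀ e → r ≤ e → e ≤ r′ → P (e , j)) → GWalk P (r , j) (r′ , j)
v-walk {P} {j} {r} {r′} le h = subst (λ e → GWalk P (r , j) (e , j)) (m+[n∸m]≡n le)
  (v-segment r (r′ ∸ r) λ e p q → h e p (≤-trans q (≤-reflexive (m+[n∸m]≡n le))))

-- These conditions concern ℕ × ℕ alone: the cells merged into one new cell are connected there and
-- neighbouring groups touch. Each relabelling is thus verified without any graph.
record Coarsening (a b a′ b′ : ℕ) (φ : ℕ × ℕ → Maybe (ℕ × ℕ)) : Set where
  field
    range  : ∀ {p x} → InRange a′ b′ x → φ p ≡ just x → InRange a b p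
    center : ∀ {x} → InRange a′ b′ x → ∃ λ p → φ p ≡ just x
    joined : ∀ {x p q} → InRange a′ b′ x → φ p ≡ just x → φ q ≡ just x → GWalk (λ r → φ r ≡ just x) p q
    across : ∀ {i j} → i < a′ → suc j < b′ → ∃ λ p → ∃ λ q → φ p ≡ just (i , j) × φ q ≡ just (i , suc j) × Step p q
    along  : ∀ {i j} → suc i < a′ → j < b′ → ∃ λ p → ∃ λ q → φ p ≡ just (i , j) × φ q ≡ just (suc i , j) × Step p q

step-edge : ∀ {n} {G : Graph n} {a b lab p q} → GridModel G a b lab → InRange a b p → InRange a b q →
  Step p q → ∃ λ u → ∃ λ v → lab u ≡ just p × lab v ≡ just q × adj G u v ≡ true
step-edge M (i< , _) (_ , j<) rightward = right M i< j<
step-edge M (_ , j<) (i< , _) downward  = down M i< j<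
step-edge {G = G} M (i< , j<) _ leftward with right M i< j<
... | u , v , x , y , e = v , u , y , x , symm G e
step-edge {G = G} M (i< , j<) _ upward with down M i< j<
... | u , v , x , y , e = v , u , y , x , symm G e

module _ {n} {G : Graph n} {a b a′ b′ lab φ} (M : GridModel G a b lab) (κ : Coarsening a b a′ b′ φ) where
  open Coarsening κ

  gwalk-lift : ∀ {x p q} → InRange a′ b′ x → GWalk (λ r → φ r ≡ just x) p q →
    ∀ u v → lab u ≡ just p → lab v ≡ just q → Walk G (λ w → (lab ⟫ φ) w ≡ just x) u v
  gwalk-lift {x} x∈ (stay e) u v p q = inCell u v p q
    where
    inCell : ∀ u v → lab u ≡ just _ → lab v ≡ just _ → Walk G (λ w → (lab ⟫ φ) w ≡ just x) u v
    inCell u v p q = let (i< , j<) = range x∈ e in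
      walk-map (λ w r → ⟫⁺ lab φ r e) (λ _ _ _ _ → id) (conn M i< j< u v p q)
  gwalk-lift {x} x∈ (move e s W) u v p q
    with step-edge M (range x∈ e) (range x∈ (gwalk-head W)) s
  ... | y , z , y∈ , z∈ , f =
    walk-++ (gwalk-lift x∈ (stay e) u y p y∈) (step (⟫⁺ lab φ y∈ e) f (gwalk-lift x∈ W z v z∈ q))

  coarsen : GridModel G a′ b′ (lab ⟫ φ)
  coarsen .cell i< j< with center (i< , j<)
  ... | p , e with range (i< , j<) e
  ...   | pi , pj = let (v , v∈) = cell M pi pj in v , ⟫⁺ lab φ v∈ e
  coarsen .conn i< j< u v x y with ⟫⁻ lab φ x | ⟫⁻ lab φ y
  ... | p , u∈ , e | q , v∈ , f = gwalk-lift (i< , j<) (joined (i< , j<) e f) u v u∈ v∈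
  coarsen .right i< j< with across i< j<
  ... | p , q , e , f , s with step-edge M (range (i< , <⇒≤ j<) e) (range (i< , j<) f) s
  ...   | u , v , u∈ , v∈ , g = u , v , ⟫⁺ lab φ u∈ e , ⟫⁺ lab φ v∈ f , g
  coarsen .down i< j< with along i< j<
  ... | p , q , e , f , s with step-edge M (range (<⇒≤ i< , j<) e) (range (i< , j<) f) s
  ...   | u , v , u∈ , v∈ , g = u , v , ⟫⁺ lab φ u∈ e , ⟫⁺ lab φ v∈ f , g

-- For relabellings that merge nothing: `ψ` names the single cell behind each new one.
reindexing : ∀ {a b a′ b′ φ} (ψ : ℕ × ℕ → ℕ × ℕ) →
  (∀ {x} → InRange a′ b′ x → InRange a b (ψ x) × φ (ψ x) ≡ just x) →
  (∀ {p x} → InRange a′ b′ x → φ p ≡ just x → p ≡ ψ x) →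
  (∀ {i j} → i < a′ → suc j < b′ → Step (ψ (i , j)) (ψ (i , suc j))) →
  (∀ {i j} → suc i < a′ → j < b′ → Step (ψ (i , j)) (ψ (suc i , j))) →
  Coarsening a b a′ b′ φ
reindexing {a} {b} {φ = φ} ψ ok inv across′ along′ = record
  { range  = λ x∈ e → subst (InRange a b) (≡-sym (inv x∈ e)) (proj₁ (ok x∈))
  ; center = λ x∈ → ψ _ , proj₂ (ok x∈)
  ; joined = λ {x} {p} x∈ e f → subst (GWalk (λ r → φ r ≡ just x) p) (trans (inv x∈ e) (≡-sym (inv x∈ f))) (stay e)
  ; across = λ i< j< → _ , _ , proj₂ (ok (i< , <⇒≤ j<)) , proj₂ (ok (i< , j<)) , across′ i< j<
  ; along  = λ i< j< → _ , _ , proj₂ (ok (<⇒≤ i< , j<)) , proj₂ (ok (i< , j<)) , along′ i< j< }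

-- Shifting, turning and folding grids

shift : ℕ → ℕ × ℕ → Maybe (ℕ × ℕ)
shift s (i , j) with s ≤? i
... | yes _ = just (i ∸ s , j)
... | no _  = nothing

shift-just : ∀ s i j → shift s (s + i , j) ≡ just (i , j)
shift-just s i j with s ≤? s + i
... | yes _ = cong (λ e → just (e , j)) (m+n∸m≡n s i)
... | no ¬p = ⊥-elim (¬p (m≤m+n s i))

shift-inv : ∀ s {p x} → shift s p ≡ just x → p ≡ (s + proj₁ x , proj₂ x)
shift-inv s {i , j} e with s ≤? i
shift-inv s {i , j} refl | yes le = cong (_, j) (≡-sym (m+[n∸m]≡n le))

shift-coarsening : ∀ s a b → Coarsening (s + a) b a b (shift s)
shift-coarsening s a b = reindexing (λ (i , j) → s + i , j)
  (λ (i< , j<) → (+-monoʳ-< s i< , j<) , shift-just s _ _) (λ _ → shift-inv s) (λ _ _ → rightward)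
  (λ {i} {j} _ _ → subst (λ e → Step (s + i , j) (e , j)) (≡-sym (+-suc s i)) downward)

-- A quarter turn: the left column becomes the top row and the bottom row the left column.
turn : ℕ → ℕ × ℕ → Maybe (ℕ × ℕ)
turn a (i , j) with i <? a
... | yes _ = just (j , a ∸ suc i)
... | no _  = nothing

reflect : ∀ {a i} → i < a → a ∸ suc (a ∸ suc i) ≡ i
reflect {suc a} (s≤s p) = m∸[m∸n]≡n p

reflect-< : ∀ {a i} → i < a → a ∸ suc i < a
reflect-< {suc a} {i} _ = s≤s (m∸n≤m a i)

turn-just : ∀ {a i} j → i < a → turn a (i , j) ≡ just (j , a ∸ suc i)
turn-just {a} {i} j lt with i <? a
... | yes _ = refl
... | no ¬p = ⊥-elim (¬p lt)

turn-coarsening : ∀ a b → Coarsening a b b a (turn a)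
turn-coarsening a b = reindexing (λ (i , j) → a ∸ suc j , i)
  (λ { {i , j} (i< , j<) → (reflect-< j< , i<) ,
         trans (turn-just i (reflect-< j<)) (cong (λ e → just (i , e)) (reflect j<)) })
  (λ _ → inv) (λ {i} {j} _ j< → subst (λ e → Step (e , i) (a ∸ suc (suc j) , i)) (suc-∸ j<) upward) (λ _ _ → rightward)
  where
  suc-∸ : ∀ {j} → suc j < a → suc (a ∸ suc (suc j)) ≡ a ∸ suc j
  suc-∸ {j} lt = ≡-sym (+-∸-assoc 1 lt)
  inv : ∀ {p x} → turn a p ≡ just x → p ≡ (a ∸ suc (proj₂ x) , proj₁ x)
  inv {i , j} e with i <? a
  inv {i , j} refl | yes lt = cong (_, j) (≡-sym (reflect lt))

-- The first h columns are distributed, in L-shaped pieces, over the cells of the next column,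
-- whose cell i then reaches the top row in the column h - 1 - i.
fold : ℕ → ℕ → ℕ → ℕ × ℕ → Maybe (ℕ × ℕ)
fold h a b (r , c) with r <? a | c <? h | c <? h + b
... | yes _ | yes _ | _     = just (r ⊔ (h ∸ suc c) , 0)
... | yes _ | no _  | yes _ = just (r , c ∸ h)
... | _     | _     | _     = nothing

module _ {h a b : ℕ} (h≤a : h ≤ a) (0<b : 0 < b) where

  fold-left : ∀ {r c} → r < a → c < h → fold h a b (r , c) ≡ just (r ⊔ (h ∸ suc c) , 0)
  fold-left {r} {c} p q with r <? a | c <? h
  ... | yes _ | yes _ = refl
  ... | yes _ | no ¬q = ⊥-elim (¬q q)
  ... | no ¬p | _     = ⊥-elim (¬p p)

  fold-right : ∀ {r j} → r < a → j < b → fold h a b (r , h + j) ≡ just (r , j)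
  fold-right {r} {j} p q with r <? a | h + j <? h | h + j <? h + b
  ... | yes _ | yes lt | _     = ⊥-elim (<-irrefl refl (≤-trans lt (m≤m+n h j)))
  ... | yes _ | no _   | yes _ = cong (λ e → just (r , e)) (m+n∸m≡n h j)
  ... | yes _ | no _   | no ¬q = ⊥-elim (¬q (+-monoʳ-< h q))
  ... | no ¬p | _      | _     = ⊥-elim (¬p p)

  data FoldView : ℕ × ℕ → ℕ × ℕ → Set where
    left-part  : ∀ {r c} → r < a → c < h → FoldView (r , c) (r ⊔ (h ∸ suc c) , 0)
    right-part : ∀ {r j} → r < a → j < b → FoldView (r , h + j) (r , j)

  fold-view : ∀ {p x} → fold h a b p ≡ just x → FoldView p x
  fold-view {r , c} e with r <? a | c <? h | c <? h + b
  fold-view {r , c} refl | yes p | yes q | _ = left-part p q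
  fold-view {r , c} refl | yes p | no ¬q | yes q =
    subst (λ d → FoldView (r , d) (r , c ∸ h)) (m+[n∸m]≡n (≮⇒≥ ¬q))
      (right-part p (+-cancelˡ-< h _ _ (subst (_< h + b) (≡-sym (m+[n∸m]≡n (≮⇒≥ ¬q))) q)))

  fold-coarsening : Coarsening a (h + b) a b (fold h a b)
  fold-coarsening = record
    { range  = λ _ e → in-range (fold-view e)
    ; center = λ { {i , j} (i< , j<) → (i , h + j) , fold-right i< j< }
    ; joined = λ x∈ e f → gwalk-++ (to-center x∈ (fold-view e)) (gwalk-rev (to-center x∈ (fold-view f)))
    ; across = λ {i} {j} i< j< → _ , _ , fold-right i< (<⇒≤ j<) , fold-right i< j< ,
        subst (λ e → Step (i , h + j) (i , e)) (≡-sym (+-suc h j)) rightward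
    ; along  = λ i< j< → _ , _ , fold-right (<⇒≤ i<) j< , fold-right i< j< , downward }
    where
    in-range : ∀ {p x} → FoldView p x → InRange a (h + b) p
    in-range (left-part p q)  = p , ≤-trans q (m≤m+n h b)
    in-range (right-part p q) = p , +-monoʳ-< h q
    horizontal : ∀ {i c} → i < a → c < h → h ∸ suc c ≤ i →
      GWalk (λ r → fold h a b r ≡ just (i , 0)) (i , c) (i , h + 0)
    horizontal {i} {c} i< c< t≤i = h-walk (≤-trans (<⇒≤ c<) (m≤m+n h 0)) on
      where
      on : ∀ e → c ≤ e → e ≤ h + 0 → fold h a b (i , e) ≡ just (i , 0)
      on e c≤e e≤h with m≤n⇒m<n∨m≡n e≤h
      ... | inj₁ lt   = trans (fold-left i< (subst (e <_) (+-identityʳ h) lt))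
        (cong (λ d → just (d , 0)) (m≥n⇒m⊔n≡m (≤-trans (∸-monoʳ-≤ h (s≤s c≤e)) t≤i)))
      ... | inj₂ refl = fold-right i< 0<b
    -- Descend to row i, where the maximum in `fold` keeps its value, then go right along row i,
    -- where the other term only decreases.
    to-center : ∀ {p i j} → InRange a b (i , j) → FoldView p (i , j) →
      GWalk (λ r → fold h a b r ≡ just (i , j)) p (i , h + j)
    to-center (i< , j<) (right-part _ _) = stay (fold-right i< j<)
    to-center (i< , j<) (left-part {r} {c} p q) = gwalk-++
      (v-walk (m≤m⊔n r _) λ e r≤e e≤ → trans (fold-left (≤-trans (s≤s e≤) i<) q)
        (cong (λ d → just (d , 0)) (≤-antisym (⊔-lub e≤ (m≤n⊔m r _)) (⊔-monoˡ-≤ _ r≤e))))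
      (horizontal i< q (m≤n⊔m r _))

-- Carrying roots around the boundary

Rooted : ∀ {n} → VSet n → Labelling n → ℕ × ℕ → Set
Rooted S lab p = ∃ λ v → v ∈ S × lab v ≡ just p

rooted-⟫ : ∀ {n} {S : VSet n} {lab p x} φ → φ p ≡ just x → Rooted S lab p → Rooted S (lab ⟫ φ) x
rooted-⟫ {lab = lab} φ e (v , v∈S , v∈p) = v , v∈S , ⟫⁺ lab φ v∈p e

Outer : ℕ → ℕ × ℕ → Set
Outer ℓ (i , j) = i ≡ 0 ⊎ i ≡ ℓ ∸ 1 ⊎ j ≡ 0 ⊎ j ≡ ℓ ∸ 1

-- Each fold carries the roots of the top row also to the left column; turning in between
-- brings the three remaining sides to the left one after the other.
frame : ∀ {n} {G : Graph n} {S lab} ℓ → 1 ≤ ℓ →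
  GridModel G ((ℓ + ℓ) + ℓ) (((ℓ + ℓ) + ℓ) + (ℓ + ℓ)) lab →
  (∀ {j} → j < ((ℓ + ℓ) + ℓ) + (ℓ + ℓ) → Rooted S lab (0 , j)) →
  Σ[ lab′ ∈ Labelling n ] (GridModel G ℓ ℓ lab′ × (∀ {p} → InRange ℓ ℓ p → Outer ℓ p → Rooted S lab′ p))
frame {n} {G} {S} {lab} ℓ 0<ℓ M root = lab₅ , M₅ , outer
  where
  ℓ₂ ℓ₃ : ℕ
  ℓ₂ = ℓ + ℓ
  ℓ₃ = ℓ₂ + ℓ
  0<ℓ₂ : 0 < ℓ₂
  0<ℓ₂ = ≤-trans 0<ℓ (m≤m+n ℓ ℓ)
  0<ℓ₃ : 0 < ℓ₃
  0<ℓ₃ = ≤-trans 0<ℓ₂ (m≤m+n ℓ₂ ℓ)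

  lab₁ lab₂ lab₃ lab₄ lab₅ : Labelling n
  -- A fold uses up as many columns as there are rows: 3ℓ × 5ℓ becomes 3ℓ × 2ℓ, turned 2ℓ × 3ℓ,
  -- folded 2ℓ × ℓ, turned ℓ × 2ℓ, folded ℓ × ℓ.
  lab₁ = lab ⟫ fold ℓ₃ ℓ₃ ℓ₂
  lab₂ = lab₁ ⟫ turn ℓ₃
  lab₃ = lab₂ ⟫ fold ℓ₂ ℓ₂ ℓ
  lab₄ = lab₃ ⟫ turn ℓ₂
  lab₅ = lab₄ ⟫ fold ℓ ℓ ℓ
  M₅ : GridModel G ℓ ℓ lab₅
  M₅ = coarsen (coarsen (coarsen (coarsen (coarsen M
    (fold-coarsening ≤-refl 0<ℓ₂)) (turn-coarsening ℓ₃ ℓ₂))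
    (fold-coarsening ≤-refl 0<ℓ)) (turn-coarsening ℓ₂ ℓ)) (fold-coarsening ≤-refl 0<ℓ)

  foldʳ : ∀ {lab h b r j} → 0 < b → r < h → j < b → Rooted S lab (r , h + j) → Rooted S (lab ⟫ fold h h b) (r , j)
  foldʳ {h = h} {b} 0<b p q = rooted-⟫ (fold h h b) (fold-right ≤-refl 0<b p q)
  foldˡ : ∀ {lab h b i} → 0 < b → i < h → Rooted S lab (0 , h ∸ suc i) → Rooted S (lab ⟫ fold h h b) (i , 0)
  foldˡ {h = h} {b} 0<b p = rooted-⟫ (fold h h b) (trans (fold-left ≤-refl 0<b (≤-trans (s≤s z≤n) p) (reflect-< p))
    (cong (λ e → just (e , 0)) (reflect p)))
  turned : ∀ {lab a i j} → i < a → Rooted S lab (i , j) → Rooted S (lab ⟫ turn a) (j , a ∸ suc i)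
  turned {a = a} {j = j} p = rooted-⟫ (turn a) (turn-just j p)
  turned-top : ∀ {lab a i} → i < a → Rooted S lab (a ∸ suc i , 0) → Rooted S (lab ⟫ turn a) (0 , i)
  turned-top {lab} {a} p r = subst (λ e → Rooted S (lab ⟫ turn a) (0 , e)) (reflect p) (turned (reflect-< p) r)

  top₁ : ∀ {j} → j < ℓ₂ → Rooted S lab₁ (0 , j)
  top₁ p = foldʳ 0<ℓ₂ 0<ℓ₃ p (root (+-monoʳ-< ℓ₃ p))
  left₁ : ∀ {i} → i < ℓ₃ → Rooted S lab₁ (i , 0)
  left₁ p = foldˡ 0<ℓ₂ p (root (≤-trans (reflect-< p) (m≤m+n ℓ₃ ℓ₂)))
  top₂ : ∀ {j} → j < ℓ₃ → Rooted S lab₂ (0 , j)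
  top₂ p = turned-top p (left₁ (reflect-< p))
  right₂ : ∀ {i} → i < ℓ₂ → Rooted S lab₂ (i , ℓ₃ ∸ 1)
  right₂ p = turned 0<ℓ₃ (top₁ p)
  last : ∀ m → m + (ℓ ∸ 1) ≡ (m + ℓ) ∸ 1
  last m = ≡-sym (+-∸-assoc m 0<ℓ)
  ℓ-1<ℓ : ℓ ∸ 1 < ℓ
  ℓ-1<ℓ = reflect-< 0<ℓ
  top₃ : ∀ {j} → j < ℓ → Rooted S lab₃ (0 , j)
  top₃ p = foldʳ 0<ℓ 0<ℓ₂ p (top₂ (+-monoʳ-< ℓ₂ p))
  left₃ : ∀ {i} → i < ℓ₂ → Rooted S lab₃ (i , 0)
  left₃ p = foldˡ 0<ℓ p (top₂ (≤-trans (reflect-< p) (m≤m+n ℓ₂ ℓ)))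
  right₃ : ∀ {i} → i < ℓ₂ → Rooted S lab₃ (i , ℓ ∸ 1)
  right₃ {i} p = foldʳ 0<ℓ p ℓ-1<ℓ (subst (λ e → Rooted S lab₂ (i , e)) (≡-sym (last ℓ₂)) (right₂ p))
  top₄ : ∀ {j} → j < ℓ₂ → Rooted S lab₄ (0 , j)
  top₄ p = turned-top p (left₃ (reflect-< p))
  right₄ : ∀ {i} → i < ℓ → Rooted S lab₄ (i , ℓ₂ ∸ 1)
  right₄ p = turned 0<ℓ₂ (top₃ p)
  bottom₄ : ∀ {j} → j < ℓ₂ → Rooted S lab₄ (ℓ ∸ 1 , j)
  bottom₄ {j} p = subst (λ e → Rooted S lab₄ (ℓ ∸ 1 , e)) (reflect p) (turned (reflect-< p) (right₃ (reflect-< p)))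

  outer : ∀ {p} → InRange ℓ ℓ p → Outer ℓ p → Rooted S lab₅ p
  outer (i< , j<) (inj₁ refl)               = foldʳ 0<ℓ 0<ℓ j< (top₄ (+-monoʳ-< ℓ j<))
  outer (i< , j<) (inj₂ (inj₁ refl))        = foldʳ 0<ℓ ℓ-1<ℓ j< (bottom₄ (+-monoʳ-< ℓ j<))
  outer (i< , j<) (inj₂ (inj₂ (inj₁ refl))) = foldˡ 0<ℓ i< (top₄ (≤-trans (reflect-< i<) (m≤m+n ℓ ℓ)))
  outer {i , _} (i< , j<) (inj₂ (inj₂ (inj₂ refl))) =
    foldʳ 0<ℓ i< ℓ-1<ℓ (subst (λ e → Rooted S lab₄ (i , e)) (≡-sym (last ℓ)) (right₄ i<))

-- Grouping columns by marks

count : (ℕ → Bool) → ℕ → ℕ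
count Q zero    = 0
count Q (suc c) = count Q c + bit (Q c)

count-mono : ∀ Q {c d} → c ≤ d → count Q c ≤ count Q d
count-mono Q {d = zero}  z≤n = z≤n
count-mono Q {d = suc d} le with m≤n⇒m<n∨m≡n le
... | inj₁ (s≤s lt) = ≤-trans (count-mono Q lt) (m≤m+n _ _)
... | inj₂ refl     = ≤-refl

count-locate : ∀ Q b {q} → q < count Q b → ∃ λ c → c < b × Q c ≡ true × count Q c ≡ q
count-locate Q (suc b) {q} lt with q <? count Q b
... | yes lt′ = let (c , c< , r) = count-locate Q b lt′ in c , m≤n⇒m≤1+n c< , r
... | no ge with Q b in eq
...   | true  = b , ≤-refl , eq , ≤-antisym (≮⇒≥ ge) (≤-pred (≤-trans lt (≤-reflexive (+-comm (count Q b) 1))))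
...   | false = ⊥-elim (ge (≤-trans lt (≤-reflexive (+-identityʳ _))))

size≡count : ∀ (Q : ℕ → Bool) b → size {b} (Q ∘ toℕ) ≡ count Q b
size≡count Q zero    = n≤0⇒n≡0 (size≤n {0} (Q ∘ toℕ))
size≡count Q (suc b) = trans (size-suc {b} (Q ∘ toℕ))
  (trans (cong (bit (Q 0) +_) (size≡count (Q ∘ suc) b)) (front Q b))
  where
  front : ∀ Q b → bit (Q 0) + count (Q ∘ suc) b ≡ count Q (suc b)
  front Q zero    = +-comm (bit (Q 0)) 0
  front Q (suc b) = trans (≡-sym (+-assoc (bit (Q 0)) _ _)) (cong (_+ bit (Q (suc b))) (front Q b))

-- Column c joins the group of the last column of Q up to c.
group : (ℕ → Bool) → ℕ → ℕ × ℕ → Maybe (ℕ × ℕ)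
group Q b (i , c) with c <? b | count Q (suc c)
... | yes _ | suc q = just (i , q)
... | _     | _     = nothing

group⁺ : ∀ Q {b i c q} → c < b → count Q (suc c) ≡ suc q → group Q b (i , c) ≡ just (i , q)
group⁺ Q {b} {i} {c} lt e with c <? b | count Q (suc c)
group⁺ Q lt refl | yes _ | suc q = refl
group⁺ Q lt e    | no ¬p | _     = ⊥-elim (¬p lt)

group⁻ : ∀ Q {b i c x} → group Q b (i , c) ≡ just x → c < b × proj₁ x ≡ i × count Q (suc c) ≡ suc (proj₂ x)
group⁻ Q {b} {i} {c} e with c <? b | count Q (suc c)
group⁻ Q refl | yes lt | suc q = lt , refl , refl

marked : ∀ Q {b q} → q < count Q b → ∃ λ c → Q c ≡ true × ∀ {i} → group Q b (i , c) ≡ just (i , q)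
marked Q {b} {q} lt with count-locate Q b lt
... | c , c<b , c∈Q , e = c , c∈Q , group⁺ Q c<b (trans (cong₂ (λ x y → x + bit y) e c∈Q) (+-comm q 1))

-- Groups are intervals because `count` is monotone. A marked column opens a new group, so it and
-- the column before it link consecutive groups.
group-coarsening : ∀ Q {a b w} → w ≤ count Q b → Coarsening a b a w (group Q b)
group-coarsening Q {a} {b} {w} w≤ = record
  { range  = λ { {i , c} (i< , _) e → let (lt , f , _) = group⁻ Q e in subst (_< a) f i< , lt }
  ; center = λ { {i , q} (_ , q<) → let (c , _ , e) = marked Q (≤-trans q< w≤) in (i , c) , e }
  ; joined = joined
  ; across = across
  ; along  = λ {i} {q} _ q< → let (c , _ , e) = marked Q (≤-trans q< w≤) in
      (i , c) , (suc i , c) , e , e , downward }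
  where
  Same : ℕ × ℕ → ℕ × ℕ → Set
  Same x r = group Q b r ≡ just x
  ordered : ∀ {i q c d} → c ≤ d → Same (i , q) (i , c) → Same (i , q) (i , d) → GWalk (Same (i , q)) (i , c) (i , d)
  ordered {i} {q} {c} {d} le e f = h-walk le λ z c≤z z≤d →
    let (_ , _ , e′) = group⁻ Q e ; (d<b , _ , f′) = group⁻ Q f in
    group⁺ Q (≤-trans (s≤s z≤d) d<b) (≤-antisym
      (≤-trans (count-mono Q (s≤s z≤d)) (≤-reflexive f′))
      (≤-trans (≤-reflexive (≡-sym e′)) (count-mono Q (s≤s c≤z))))
  joined : ∀ {x p q} → InRange a w x → Same x p → Same x q → GWalk (Same x) p q
  joined {i , x} {_ , c} {_ , d} _ e f with proj₁ (proj₂ (group⁻ Q e)) | proj₁ (proj₂ (group⁻ Q f))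
  ... | refl | refl with ≤-total c d
  ...   | inj₁ le = ordered le e f
  ...   | inj₂ le = gwalk-rev (ordered le f e)
  across : ∀ {i q} → i < a → suc q < w → ∃ λ p → ∃ λ r → Same (i , q) p × Same (i , suc q) r × Step p r
  across {i} {q} _ q< with count-locate Q b (≤-trans q< w≤)
  ... | suc c , c<b , c∈Q , e = (i , c) , (i , suc c) , group⁺ Q (<⇒≤ c<b) e
        , group⁺ Q c<b (trans (cong₂ (λ x y → x + bit y) e c∈Q) (+-comm (suc q) 1)) , rightward

-- From models of the grid to labellings and back

dist⇒step : ∀ i j i′ j′ → dist (i , j) (i′ , j′) ≡ 1 → Step (i , j) (i′ , j′)
dist⇒step zero    j zero     j′ e = horizontal j j′ e
  where
  horizontal : ∀ j j′ → ∣ j - j′ ∣ ≡ 1 → ∀ {i} → Step (i , j) (i , j′)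
  horizontal zero          (suc zero)     refl = rightward
  horizontal (suc zero)    zero           refl = leftward
  horizontal (suc (suc j)) zero           ()
  horizontal (suc j)       (suc j′)       e with horizontal j j′ e {0}
  ... | rightward = rightward
  ... | leftward  = leftward
dist⇒step zero    j (suc zero) j′ e with ∣m-n∣≡0⇒m≡n {j} {j′} (cong pred e)
... | refl = downward
dist⇒step (suc zero) j zero    j′ e with ∣m-n∣≡0⇒m≡n {j} {j′} (cong pred e)
... | refl = upward
dist⇒step (suc i) j (suc i′) j′ e with dist⇒step i j i′ j′ e
... | rightward = rightward
... | leftward  = leftward
... | downward  = downward
... | upward    = upward

step⇒dist : ∀ {p q} → Step p q → dist p q ≡ 1
step⇒dist {i , j} rightward = cong₂ _+_ (∣n-n∣≡0 i) (trans (cong (∣ j -_∣) (+-comm 1 j)) (∣m-m+n∣≡n j 1))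
step⇒dist {i , j} {_ , j′} leftward  = cong₂ _+_ (∣n-n∣≡0 i) (trans (∣-∣-comm j j′) (trans (cong (∣ j′ -_∣) (+-comm 1 j′)) (∣m-m+n∣≡n j′ 1)))
step⇒dist {i , j} downward  = cong₂ _+_ (trans (cong (∣ i -_∣) (+-comm 1 i)) (∣m-m+n∣≡n i 1)) (∣n-n∣≡0 j)
step⇒dist {i , j} {i′ , _} upward    = cong₂ _+_ (trans (∣-∣-comm i i′) (trans (cong (∣ i′ -_∣) (+-comm 1 i′)) (∣m-m+n∣≡n i′ 1))) (∣n-n∣≡0 j)

coord-range : ∀ ℓ x → InRange ℓ ℓ (coord ℓ x)
coord-range ℓ x = toℕ<n (proj₁ (remQuot {ℓ} ℓ x)) , toℕ<n (proj₂ (remQuot {ℓ} ℓ x))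

coord-inj : ∀ ℓ {x y} → coord ℓ x ≡ coord ℓ y → x ≡ y
coord-inj ℓ {x} {y} e = trans (≡-sym (combine-remQuot {ℓ} ℓ x)) (trans
  (cong₂ combine (toℕ-injective (,-injectiveˡ e)) (toℕ-injective (,-injectiveʳ e)))
  (combine-remQuot {ℓ} ℓ y))

coord-onto : ∀ ℓ {p} → InRange ℓ ℓ p → ∃ λ x → coord ℓ x ≡ p
coord-onto ℓ {i , j} (i< , j<) = combine (fromℕ< i<) (fromℕ< j<) , cong₂ _,_
  (trans (cong (toℕ ∘ proj₁) (remQuot-combine (fromℕ< i<) (fromℕ< j<))) (toℕ-fromℕ< i<))
  (trans (cong (toℕ ∘ proj₂) (remQuot-combine (fromℕ< i<) (fromℕ< j<))) (toℕ-fromℕ< j<))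

_≟ᶜ_ : (x y : Maybe (ℕ × ℕ)) → Dec (x ≡ y)
_≟ᶜ_ = Maybe.≡-dec (Product.≡-dec ℕ._≟_ ℕ._≟_)

gridModel⇒model : ∀ {n} {G : Graph n} {ℓ lab S} → GridModel G ℓ ℓ lab →
  (∀ {p} → InRange ℓ ℓ p → Outer ℓ p → Rooted ⟦ S ⟧ lab p) →
  Σ[ M ∈ Model (grid ℓ) G ] OuterRooted ℓ S M
gridModel⇒model {n} {G} {ℓ} {lab} {S} M root = record
  { B = branch
  ; nonempty = λ x → let (v , v∈) = cell M (proj₁ (coord-range ℓ x)) (proj₂ (coord-range ℓ x)) in v , in⁺ x v∈
  ; disjoint = λ x y x≢y v p q → x≢y (coord-inj ℓ (just-injective (trans (≡-sym (in⁻ x p)) (in⁻ y q))))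
  ; conn = λ x u v p q → walk-map (λ w → in⁺ x) (λ _ _ _ _ → id)
      (conn M (proj₁ (coord-range ℓ x)) (proj₂ (coord-range ℓ x)) u v (in⁻ x p) (in⁻ x q))
  ; edges = λ x y e → let (u , v , p , q , f) = step-edge M (coord-range ℓ x) (coord-range ℓ y)
                                (dist⇒step _ _ _ _ (≡ᵇ⇒≡ _ _ (subst Bool.T (≡-sym e) tt)))
                      in u , v , in⁺ x p , in⁺ y q , f }
  , λ x o → let (v , v∈S , v∈) = root (coord-range ℓ x) o in v , in⁺ x v∈ , ⟦⟧⇒∈ v∈S
  where
  branch : Fin (ℓ * ℓ) → Subset n
  branch x = Vec.tabulate λ v → does (lab v ≟ᶜ just (coord ℓ x))
  in⁺ : ∀ x {v} → lab v ≡ just (coord ℓ x) → v Subset.∈ branch x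
  in⁺ x {v} e = ⟦⟧⇒∈ (trans (Vec.lookup∘tabulate _ v) (dec-true (lab v ≟ᶜ just (coord ℓ x)) e))
  in⁻ : ∀ x {v} → v Subset.∈ branch x → lab v ≡ just (coord ℓ x)
  in⁻ x {v} p with lab v ≟ᶜ just (coord ℓ x) | trans (≡-sym (Vec.lookup∘tabulate (λ v → does (lab v ≟ᶜ just (coord ℓ x))) v)) (∈⇒⟦⟧ p)
  ... | yes e | _ = e

model⇒gridModel : ∀ {n} {G : Graph n} ℓ → Model (grid ℓ) G → Σ[ lab ∈ Labelling n ] GridModel G ℓ ℓ lab
model⇒gridModel {n} {G} ℓ M = lab , record { cell = cell′ ; conn = conn′ ; right = right′ ; down = down′ }
  where
  lab : Labelling n
  lab v with any? (λ x → ⟦ B M x ⟧ v Bool.≟ true)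
  ... | yes (x , _) = just (coord ℓ x)
  ... | no _        = nothing
  lab⁺ : ∀ x v → v Subset.∈ B M x → lab v ≡ just (coord ℓ x)
  lab⁺ x v p with any? (λ x → ⟦ B M x ⟧ v Bool.≟ true)
  ... | no ¬q = ⊥-elim (¬q (x , ∈⇒⟦⟧ p))
  ... | yes (y , q) with y ≟ x
  ...   | yes refl = refl
  ...   | no y≢x   = ⊥-elim (disjoint M y x y≢x v (⟦⟧⇒∈ q) p)
  lab⁻ : ∀ x v → lab v ≡ just (coord ℓ x) → v Subset.∈ B M x
  lab⁻ x v e with any? (λ x → ⟦ B M x ⟧ v Bool.≟ true)
  ... | yes (y , q) = subst (λ z → v Subset.∈ B M z) (coord-inj ℓ (just-injective e)) (⟦⟧⇒∈ q)
  cell′ : ∀ {i j} → i < ℓ → j < ℓ → ∃ λ v → lab v ≡ just (i , j)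
  cell′ i< j< with coord-onto ℓ (i< , j<)
  ... | x , refl = let (v , v∈) = nonempty M x in v , lab⁺ x v v∈
  conn′ : ∀ {i j} → i < ℓ → j < ℓ → ConnectedSet G (λ v → lab v ≡ just (i , j))
  conn′ i< j< u v p q with coord-onto ℓ (i< , j<)
  ... | x , refl = walk-map (lab⁺ x) (λ _ _ _ _ → id) (conn M x u v (lab⁻ x u p) (lab⁻ x v q))
  edge : ∀ {p q} → InRange ℓ ℓ p → InRange ℓ ℓ q → Step p q →
    ∃ λ u → ∃ λ v → lab u ≡ just p × lab v ≡ just q × adj G u v ≡ true
  edge p∈ q∈ s with coord-onto ℓ p∈ | coord-onto ℓ q∈
  ... | x , refl | y , refl with edges M x y (cong (_≡ᵇ 1) (step⇒dist s))
  ...   | u , v , u∈ , v∈ , e = u , v , lab⁺ x u u∈ , lab⁺ y v v∈ , e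
  right′ : ∀ {i j} → i < ℓ → suc j < ℓ → _
  right′ i< j< = edge (i< , <⇒≤ j<) (i< , j<) rightward
  down′ : ∀ {i j} → suc i < ℓ → j < ℓ → _
  down′ i< j< = edge (<⇒≤ i< , j<) (i< , j<) downward

-- Removing an apex from a grid model

walk-strip : ∀ {n} {G : Graph n} {P : Fin (suc n) → Set} → (P fzero → ⊥) →
  ∀ {u v} → Walk (apex G) P (fsuc u) (fsuc v) → Walk G (P ∘ fsuc) u v
walk-strip ¬P (here p) = here p
walk-strip ¬P (step {w = fzero}  p e w) = ⊥-elim (¬P (walk-head w))
walk-strip ¬P (step {w = fsuc _} p e w) = step p e (walk-strip ¬P w)

gridModel-strip : ∀ {n} {G : Graph n} {a b lab} → GridModel (apex G) a b lab →
  (∀ {i j} → lab fzero ≡ just (i , j) → i < a → ⊥) → GridModel G a b (lab ∘ fsuc)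
gridModel-strip M off .cell i< j< with cell M i< j<
... | fzero  , p = ⊥-elim (off p i<)
... | fsuc v , p = v , p
gridModel-strip M off .conn i< j< u v p q = walk-strip (λ r → off r i<) (conn M i< j< (fsuc u) (fsuc v) p q)
gridModel-strip M off .right i< j< with right M i< j<
... | fzero  , _      , p , _ , _ = ⊥-elim (off p i<)
... | fsuc _ , fzero  , _ , q , _ = ⊥-elim (off q i<)
... | fsuc u , fsuc v , p , q , e = u , v , p , q , e
gridModel-strip M off .down i< j< with down M i< j<
... | fzero  , _      , p , _ , _ = ⊥-elim (off p (<⇒≤ i<))
... | fsuc _ , fzero  , _ , q , _ = ⊥-elim (off q i<)
... | fsuc u , fsuc v , p , q , e = u , v , p , q , e

-- The apex meets at most one branch set, hence misses the upper or the lower half of the rows.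
remove-apex : ∀ {n} {G : Graph n} {a b} → Σ[ lab ∈ Labelling (suc n) ] GridModel (apex G) (a + a) b lab →
  Σ[ lab ∈ Labelling n ] GridModel G a b lab
remove-apex {n} {G} {a} {b} (lab , M) with row (a + a) lab fzero <? a
... | yes lt = _ , gridModel-strip (coarsen M (shift-coarsening a a b)) λ p i< →
        let (q , e , f) = ⟫⁻ lab (shift a) p in upper q e f
  where
  upper : ∀ q {x} → lab fzero ≡ just q → shift a q ≡ just x → ⊥
  upper (i , j) e f with a ≤? i
  ... | yes le = <-irrefl refl (≤-trans lt (subst (a ≤_) (≡-sym (row-just (a + a) {lab} e)) le))
... | no ge = _ , gridModel-strip (gridModel-mono (m≤m+n a a) ≤-refl (λ _ _ _ _ _ _ → id) M)
        λ e i< → ge (subst (_< a) (≡-sym (row-just (a + a) {lab} e)) i<)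

-- Linking roots to a band of rows

module _ {n} {H : Graph n} {a b lab} (M : GridModel H a b lab) where

  -- Between neighbouring cells only the one edge chosen by `M` counts; fixing it is what later
  -- bounds the entries of a column by one per border.
  data Essential : Fin n → Fin n → Set where
    inside : ∀ {x y i j} → i < a → j < b → lab x ≡ just (i , j) → lab y ≡ just (i , j) → Essential x y
    right→ : ∀ {i j} (p : i < a) (q : suc j < b) → Essential (proj₁ (right M p q)) (proj₁ (proj₂ (right M p q)))
    right← : ∀ {i j} (p : i < a) (q : suc j < b) → Essential (proj₁ (proj₂ (right M p q))) (proj₁ (right M p q))
    down→  : ∀ {i j} (p : suc i < a) (q : j < b) → Essential (proj₁ (down M p q)) (proj₁ (proj₂ (down M p q)))
    down←  : ∀ {i j} (p : suc i < a) (q : j < b) → Essential (proj₁ (proj₂ (down M p q))) (proj₁ (down M p q))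

  essential-sym : ∀ {x y} → Essential x y → Essential y x
  essential-sym (inside p q x y) = inside p q y x
  essential-sym (right→ p q)     = right← p q
  essential-sym (right← p q)     = right→ p q
  essential-sym (down→ p q)      = down← p q
  essential-sym (down← p q)      = down→ p q

  gridModel-delete : ∀ {x y} → ¬ Essential x y → GridModel (delete H x y) a b lab
  gridModel-delete {x} {y} ¬ess = record
    { cell  = cell M
    ; conn  = λ i< j< u v p q → walk-map (λ _ → id) (λ u v p q → keep (inside i< j< p q)) (conn M i< j< u v p q)
    ; right = λ i< j< → let (u , v , p , q , e) = right M i< j< in u , v , p , q , keep (right→ i< j<) e
    ; down  = λ i< j< → let (u , v , p , q , e) = down M i< j< in u , v , p , q , keep (down→ i< j<) e }
    where
    keep : ∀ {u v} → Essential u v → adj H u v ≡ true → adj (delete H x y) u v ≡ true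
    keep {u} {v} ess e with delete-or H {x} {y} u v e
    ... | inj₁ f = f
    ... | inj₂ (inj₁ (refl , refl)) = ⊥-elim (¬ess ess)
    ... | inj₂ (inj₂ (refl , refl)) = ⊥-elim (¬ess (essential-sym ess))

record Trimmed {n} (G : Graph n) (a b : ℕ) (lab : Labelling n) (P : VSet n) (k : ℕ) : Set where
  field
    H         : Graph n
    H⊆G       : ∀ u v → adj H u v ≡ true → adj G u v ≡ true
    model     : GridModel H a b lab
    free      : Free H a b lab P k
    C₀ D₀     : VSet n
    cut       : Cut H a b lab P C₀ D₀
    order≤    : size (C₀ ∩ D₀) ≤ k
    essential : ∀ x y → adj H x y ≡ true → x ∉ C₀ → ¬ ¬ Essential model x y

-- A deletion may create larger cuts of order k, so a new maximal cut is taken each time before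
-- looking for the next inessential edge beyond it.
trim : ∀ {n} (G : Graph n) {a b lab P k C D} → suc (k + k) < a → k < b → GridModel G a b lab →
  Free G a b lab P k → Cut G a b lab P C D → size (C ∩ D) ≤ k → ¬ ¬ Trimmed G a b lab P k
trim {n} G {a} {b} {lab} {P} {k} 2k<a k<b = go G (<-wellFounded _)
  where
  go : ∀ G → Acc _<_ (edgeCount G) → ∀ {C D} → GridModel G a b lab → Free G a b lab P k →
    Cut G a b lab P C D → size (C ∩ D) ≤ k → ¬ ¬ Trimmed G a b lab P k
  go G (acc rec) M free c le done = maximal-cut c le λ (C₀ , D₀ , c₀ , le₀ , _ , max) →
    ¬¬-excluded-middle {A = ∃ λ x → ∃ λ y → adj G x y ≡ true × x ∉ C₀ × ¬ Essential M x y} λ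
      { (no none) → done record
          { H = G ; H⊆G = λ _ _ → id ; model = M ; free = free ; C₀ = C₀ ; D₀ = D₀ ; cut = c₀ ; order≤ = le₀
          ; essential = λ x y e x∉ ¬ess → none (x , y , e , x∉ , ¬ess) }
      ; (yes (x , y , e , x∉ , ¬ess)) → go (delete G x y) (rec (edgeCount-delete G x y e))
          (gridModel-delete M ¬ess) (free-delete M 2k<a k<b free c₀ le₀ max e x∉)
          record { isSep = sep-⊆ (delete-⊆ G) (isSep c₀) ; P⊆ = P⊆ c₀ ; off = off c₀ } le₀
          λ τ → done record { Trimmed τ ; H⊆G = λ u v → delete-⊆ G u v ∘ Trimmed.H⊆G τ u v } }

-- A free set that is minimal has a cut of order k: removing one more vertex must create a smaller cut.
tighten : ∀ {n} {G : Graph n} {a b lab X k} → k < a → k < b → GridModel G a b lab → Free G a b lab X k →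
  ¬ ¬ (Σ[ P ∈ VSet n ] Σ[ C ∈ VSet n ] Σ[ D ∈ VSet n ]
    (P ⊆ X × Free G a b lab P k × Cut G a b lab P C D × size (C ∩ D) ≤ k))
tighten {n} {G} {a} {b} {lab} {X} {k} k<a k<b M free = go X (<-wellFounded _) (λ _ → id) free
  where
  go : ∀ P → Acc _<_ (size P) → P ⊆ X → Free G a b lab P k → ¬ ¬ (Σ[ P ∈ VSet n ] Σ[ C ∈ VSet n ] Σ[ D ∈ VSet n ]
    (P ⊆ X × Free G a b lab P k × Cut G a b lab P C D × size (C ∩ D) ≤ k))
  go P (acc rec) P⊆X free done with any? (λ v → P v Bool.≟ true)
  ... | no none = done (P , P , full , P⊆X , free , record
      { isSep = record { cov = λ v () ; nox = λ u v _ () } ; P⊆ = λ _ → id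
      ; off = 0 , ≤-trans (s≤s z≤n) k<a , λ v _ → ≢⇒false λ p → none (v , p) }
      , ≤-trans (≤-trans (size-mono {T = empty} λ v p → ⊥-elim (none (v , proj₁ (∧⁻ p)))) (≤-reflexive size-empty)) z≤n)
  ... | yes (s , s∈P) = go (P ∖ s) (rec (≤-reflexive (size-remove {S = P} s∈P))) (λ v p → P⊆X v (proj₁ (∖⁻ P p)))
      (λ C D c → ≮⇒≥ λ lt → smaller C D c lt) done
    where
    smaller : ∀ C D → Cut G a b lab (P ∖ s) C D → size (C ∩ D) < k → ⊥
    smaller C D c lt = done (P , C ⊕ s , D , P⊆X , free , record
        { isSep = record { cov = λ v p → ⊕-old C (cov (isSep c) v p)
                         ; nox = λ u v e p q → nox (isSep c) u v e p (proj₁ (∨-false q)) }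
        ; P⊆ = λ v p → case v ≟ s of λ { (yes refl) → ⊕-new C s ; (no v≢s) → ⊕-old C (P⊆ c v (∖⁺ P p v≢s)) }
        ; off = proj₁ r , proj₁ (proj₂ r) , λ v v∈ → ∨-false⁺ (offC v v∈) (proj₂ (∨-false {(C ∩ D) v} (proj₂ (proj₂ r) v v∈))) }
        , ≤-trans (size-⊕ {S = C ∩ D} s λ v p v≢s → ∧⁺ ([ id , (λ e → ⊥-elim (v≢s e)) ]′ (⊕⁻ C (proj₁ (∧⁻ p))))
            (proj₂ (∧⁻ {(C ⊕ s) v} p))) lt)
      where
      r = free-row a b lab ((C ∩ D) ⊕ s) (≤-trans (s≤s (≤-trans (size-⊕ {S = C ∩ D} s λ v p v≢s →
            [ id , (λ e → ⊥-elim (v≢s e)) ]′ (⊕⁻ (C ∩ D) p)) lt)) k<a)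
      offC : RowOff b lab (proj₁ r) C
      offC = rowOff-spread M (isSep c) (<-trans lt k<b) (off c) (proj₁ (proj₂ r))
        λ v v∈ → proj₁ (∨-false (proj₂ (proj₂ r) v v∈))

-- Among k + 1 disjoint bands of m + 1 rows the separator misses one, and all rows of that band lie
-- beyond the cut.
clean-band : ∀ {n} {H : Graph n} {a b lab P k C D} m → suc k * suc m ≤ a → k < b → GridModel H a b lab →
  Cut H a b lab P C D → size (C ∩ D) ≤ k →
  ∃ λ s → s + suc m ≤ a × (∀ {i} → s ≤ i → i < s + suc m → RowOff b lab i C)
clean-band {a = a} {b} {lab} {k = k} {C} {D} m le k<b M c order≤
  with avoids-value (suc k) {C ∩ D} (λ v → row a lab v / suc m) (s≤s order≤)
... | t , t<k , h = t * suc m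
    , ≤-trans (≤-reflexive (+-comm (t * suc m) (suc m))) (≤-trans (*-monoˡ-≤ (suc m) t<k) le)
    , λ {i} p q → rowOff-spread M (isSep c) (≤-trans (s≤s order≤) k<b) (off c)
        (≤-trans q (≤-trans (≤-reflexive (+-comm (t * suc m) (suc m))) (≤-trans (*-monoˡ-≤ (suc m) t<k) le)))
        λ v (_ , _ , e) → ≢⇒false λ v∈ → h v v∈ (trans (cong (_/ suc m) (row-just a {lab} e)) (quotient i p q))
  where
  quotient : ∀ i → t * suc m ≤ i → i < t * suc m + suc m → i / suc m ≡ t
  quotient i p q = trans (cong (_/ suc m) (≡-sym (m∸n+n≡m p)))
    (trans (+-distrib-/-∣ʳ (i ∸ t * suc m) (n∣m*n t))
      (cong₂ _+_ (m<n⇒m/n≡0 (+-cancelʳ-< (t * suc m) _ _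
         (subst₂ _<_ (≡-sym (m∸n+n≡m p)) (+-comm (t * suc m) (suc m)) q))) (m*n/n≡m t (suc m))))

¬¬-finite : ∀ k {P : Fin k → Set} → (∀ i → ¬ ¬ P i) → ¬ ¬ (∀ i → P i)
¬¬-finite zero    h done = done λ ()
¬¬-finite (suc k) h done = h fzero λ p → ¬¬-finite k (h ∘ fsuc) λ q → done λ { fzero → p ; (fsuc i) → q i }

does⁻ : ∀ {A : Set} (d : Dec A) → does d ≡ true → A
does⁻ (yes p) _ = p

record RootedBand {n} (G : Graph n) (S : VSet n) (m b w : ℕ) : Set where
  field
    labels : Labelling n
    model  : GridModel G (suc m) b labels
    side   : ℕ
    border : side ≡ 0 ⊎ side ≡ m
    column : Fin w → ℕ
    column-inj : Injective _≡_ _≡_ column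
    column-<   : ∀ t → column t < b
    roots      : ∀ t → Rooted S labels (side , column t)

-- All edges into the band are vertical edges of the model, so disjoint paths from P enter it
-- through its first or last row, in distinct columns for each of the two.
module Band {n} {G : Graph n} {a b lab P} w m (τ : Trimmed G a b lab P (w + w))
    (s : ℕ) (s+m≤a : s + suc m ≤ a)
    (clean : ∀ {i} → s ≤ i → i < s + suc m → RowOff b lab i (Trimmed.C₀ τ)) where

  open Trimmed τ

  N : VSet n
  N v with lab v
  ... | just (i , j) = does (s ≤? i) ∧ (does (i <? s + suc m) ∧ does (j <? b))
  ... | nothing      = false

  N⁺ : ∀ {v i j} → lab v ≡ just (i , j) → s ≤ i → i < s + suc m → j < b → v ∈ N
  N⁺ {v} {i} {j} e p q r rewrite e =
    ∧⁺ (dec-true (s ≤? i) p) (∧⁺ (dec-true (i <? s + suc m) q) (dec-true (j <? b) r))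

  N⁻ : ∀ {v} → v ∈ N → ∃ λ i → ∃ λ j → lab v ≡ just (i , j) × s ≤ i × i < s + suc m × j < b
  N⁻ {v} p with lab v
  ... | just (i , j) with ∧⁻ {does (s ≤? i)} p
  ...   | x , q with ∧⁻ {does (i <? s + suc m)} q
  ...     | y , z = i , j , refl , does⁻ (s ≤? i) x , does⁻ (i <? s + suc m) y , does⁻ (j <? b) z

  N-off : ∀ {v} → v ∈ N → v ∉ C₀
  N-off {v} p with N⁻ p
  ... | i , j , e , x , y , z = clean x y v (j , z , e)

  sideRow : Bool → ℕ
  sideRow true  = 0
  sideRow false = m

  -- The chosen edge across the upper (`true`) or lower (`false`) border in column c, with outer end
  -- u and inner end v. Border and column determine u.
  Entry : Bool → Fin n → Fin n → ℕ → Set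
  Entry true  u v c = ∃ λ i → Σ[ p ∈ suc i < a ] Σ[ q ∈ c < b ]
    (suc i ≡ s × u ≡ proj₁ (down model p q) × v ≡ proj₁ (proj₂ (down model p q)))
  Entry false u v c = ∃ λ i → Σ[ p ∈ suc i < a ] Σ[ q ∈ c < b ]
    (i ≡ s + m × v ≡ proj₁ (down model p q) × u ≡ proj₁ (proj₂ (down model p q)))

  entry-unique : ∀ σ {u v u′ v′ c} → Entry σ u v c → Entry σ u′ v′ c → u ≡ u′
  entry-unique true (i , p , q , refl , refl , refl) (.i , p′ , q′ , refl , refl , refl)
    rewrite ≤-irrelevant p p′ | ≤-irrelevant q q′ = refl
  entry-unique false (i , p , q , refl , refl , refl) (.i , p′ , q′ , refl , refl , refl)
    rewrite ≤-irrelevant p p′ | ≤-irrelevant q q′ = refl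

  entry-label : ∀ σ {u v c} → Entry σ u v c → lab v ≡ just (s + sideRow σ , c)
  entry-label true  {c = c} (i , p , q , refl , refl , refl) =
    trans (proj₁ (proj₂ (proj₂ (proj₂ (down model p q))))) (cong (λ e → just (e , c)) (≡-sym (+-identityʳ _)))
  entry-label false (i , p , q , refl , refl , refl) = proj₁ (proj₂ (proj₂ (down model p q)))

  entry-< : ∀ σ {u v c} → Entry σ u v c → c < b
  entry-< true  (_ , _ , q , _) = q
  entry-< false (_ , _ , q , _) = q

  -- Edges within a cell or along a row stay in the band, so only a vertical edge at the first or
  -- last row can leave it.
  classify : ∀ {x y} → Essential model x y → x ∈ N → y ∉ N → ∃ λ σ → ∃ λ c → Entry σ y x c
  classify ess x∈ y∉ with N⁻ x∈
  classify (inside _ _ e f) x∈ y∉ | _ , _ , e′ , p , q , r with just-injective (trans (≡-sym e) e′)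
  ... | refl = clash (N⁺ f p q r) y∉
  classify (right→ i< j<) x∈ y∉ | _ , _ , e′ , p , q , r with right model i< j<
  ... | _ , _ , e , f , _ with just-injective (trans (≡-sym e) e′)
  ...   | refl = clash (N⁺ f p q j<) y∉
  classify (right← i< j<) x∈ y∉ | _ , _ , e′ , p , q , r with right model i< j<
  ... | _ , _ , e , f , _ with just-injective (trans (≡-sym f) e′)
  ...   | refl = clash (N⁺ e p q (<⇒≤ r)) y∉
  classify (down→ {i} {j} i< j<) x∈ y∉ | _ , _ , e′ , p , q , r
    with just-injective (trans (≡-sym (proj₁ (proj₂ (proj₂ (down model i< j<))))) e′)
  ... | refl with suc i <? s + suc m
  ...   | yes lt = clash (N⁺ (proj₁ (proj₂ (proj₂ (proj₂ (down model i< j<))))) (m≤n⇒m≤1+n p) lt r) y∉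
  ...   | no ge = false , j , i , i< , j< , ℕ.suc-injective (≤-antisym (≤-trans q (≤-reflexive (+-suc s m)))
                    (≤-trans (≤-reflexive (≡-sym (+-suc s m))) (≮⇒≥ ge))) , refl , refl
  classify (down← {i} {j} i< j<) x∈ y∉ | _ , _ , e′ , p , q , r
    with just-injective (trans (≡-sym (proj₁ (proj₂ (proj₂ (proj₂ (down model i< j<)))))) e′)
  ... | refl with s ≤? i
  ...   | yes le = clash (N⁺ (proj₁ (proj₂ (proj₂ (down model i< j<)))) le (<⇒≤ q) r) y∉
  ...   | no gt = true , j , i , i< , j< , ≤-antisym (≰⇒> gt) p , refl , refl

  K : Graph n
  K = within H (∁ N)

  U : VSet n
  U u = not (N u) ∧ some (λ v → N v ∧ adj H u v)

  P-off : P ⊆ ∁ N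
  P-off v p = not⁺ (≢⇒false λ q → clash (P⊆ cut v p) (N-off q))

  -- Every edge from outside into the band starts in `U`, so adding the band to the side of `U`
  -- turns a separation of `K` into a cut of `H` without raising the order.
  seps : AllSeps≥ K (w + w) P U
  seps C D t P⊆C U⊆D = ≤-trans (free (C ∩ ∁ N) (D ∪ N) record
      { isSep = record { cov = cov₁ ; nox = nox₁ }
      ; P⊆ = λ v p → ∧⁺ (P⊆C v p) (P-off v p)
      ; off = s , ≤-trans (m<m+n s (s≤s z≤n)) s+m≤a , λ v (j , j< , e) →
          ∧-falseʳ {C v} (cong not (N⁺ e ≤-refl (m<m+n s (s≤s z≤n)) j<)) })
    (size-mono shrink)
    where
    cov₁ : ∀ v → v ∉ D ∪ N → v ∈ C ∩ ∁ N
    cov₁ v p with ∨-false {D v} p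
    ... | q , r = ∧⁺ (cov t v q) (not⁺ r)
    nox₁ : ∀ u v → adj H u v ≡ true → u ∉ D ∪ N → v ∉ C ∩ ∁ N → ⊥
    nox₁ u v e p q with ∨-false {D u} p | split (N v)
    ... | u∉D , u∉N | inj₁ v∈N = clash (U⊆D u (∧⁺ (not⁺ u∉N) (some⁺ {f = λ v → N v ∧ adj H u v} v (∧⁺ v∈N e)))) u∉D
    ... | u∉D , u∉N | inj₂ v∉N with ∧-false {C v} q
    ...   | inj₁ v∉C = nox t u v (∧⁺ e (∧⁺ (not⁺ u∉N) (not⁺ v∉N))) u∉D v∉C
    ...   | inj₂ v∈N = clash (not-false v∈N) v∉N
    shrink : (C ∩ ∁ N) ∩ (D ∪ N) ⊆ C ∩ D
    shrink v p with ∧⁻ {C v ∧ not (N v)} p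
    ... | q , r with ∧⁻ {C v} q | ∨-elim {D v} r
    ...   | x , y | inj₁ z = ∧⁺ x z
    ...   | x , y | inj₂ z = clash z (not⁻ y)

  -- Each chosen part joins the border cell to which its entry edge leads, which roots that cell at
  -- the source of the part.
  module Rerouted (L : Linkage K (w + w) P U) (σ : Bool) (x : Fin w → Fin (w + w)) (x-inj : Injective _≡_ _≡_ x)
      (v₀ : Fin w → Fin n) (c : Fin w → ℕ) (v₀-adj : ∀ t → adj H (Linkage.tgt L (x t)) (v₀ t) ≡ true)
      (entry : ∀ t → Entry σ (Linkage.tgt L (x t)) (v₀ t) (c t)) where

    open Linkage L

    ρ : ℕ
    ρ = sideRow σ

    part-off : ∀ {t v} → v ∈ part (x t) → v ∉ N
    part-off {t} {v} p = not⁻ (within-⊆ L P-off (x t) v p)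

    labels : Labelling n
    labels v with N v | any? (λ t → part (x t) v Bool.≟ true)
    ... | true  | _           = (lab ⟫ shift s) v
    ... | false | yes (t , _) = just (ρ , c t)
    ... | false | no _        = nothing

    new-in : ∀ {v r j} → r < suc m → j < b → lab v ≡ just (s + r , j) → labels v ≡ just (r , j)
    new-in {v} {r} {j} r< j< e with N v | N⁺ e (m≤m+n s r) (+-monoʳ-< s r<) j< | any? (λ t → part (x t) v Bool.≟ true)
    ... | true | _ | _ = ⟫⁺ lab (shift s) e (shift-just s r j)

    new-part : ∀ {v t} → v ∈ part (x t) → labels v ≡ just (ρ , c t)
    new-part {v} {t} p with N v | part-off {t} p | any? (λ t → part (x t) v Bool.≟ true)
    ... | false | _ | no ¬q = ⊥-elim (¬q (t , p))
    ... | false | _ | yes (t′ , q) = cong (λ t → just (ρ , c t)) (x-inj (separate (x t′) (x t) v q p))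

    new-inv : ∀ {v r j} → labels v ≡ just (r , j) →
      lab v ≡ just (s + r , j) ⊎ ∃ λ t → v ∈ part (x t) × r ≡ ρ × j ≡ c t
    new-inv {v} e with N v | any? (λ t → part (x t) v Bool.≟ true)
    new-inv {v} e | true | _ with ⟫⁻ lab (shift s) e
    ... | p , f , g = inj₁ (trans f (cong just (shift-inv s g)))
    new-inv {v} refl | false | yes (t , p) = inj₂ (t , p , refl , refl)

    s+<a : ∀ {r} → r < suc m → s + r < a
    s+<a r< = ≤-trans (+-monoʳ-< s r<) s+m≤a

    newModel : GridModel H (suc m) b labels
    newModel .cell r< j< = let (v , e) = cell model (s+<a r<) j< in v , new-in r< j< e
    newModel .conn {r} {j} r< j< u v p q = walk-++ (toHub u p) (walk-rev (toHub v q))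
      where
      hub = cell model (s+<a r<) j<
      direct : ∀ u → lab u ≡ just (s + r , j) → Walk H (λ v → labels v ≡ just (r , j)) u (proj₁ hub)
      direct u p = walk-map (λ v → new-in r< j<) (λ _ _ _ _ → id) (conn model (s+<a r<) j< u (proj₁ hub) p (proj₂ hub))
      toHub : ∀ u → labels u ≡ just (r , j) → Walk H (λ v → labels v ≡ just (r , j)) u (proj₁ hub)
      toHub u p with new-inv p
      ... | inj₁ e = direct u e
      ... | inj₂ (t , q , refl , refl) = walk-++
        (walk-map (λ v → new-part {v} {t}) (λ u v _ _ e → proj₁ (∧⁻ e)) (connected (x t) u (tgt (x t)) q (tgt-part (x t))))
        (step (new-part {t = t} (tgt-part (x t))) (v₀-adj t) (direct (v₀ t) (entry-label σ (entry t))))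
    newModel .right r< j< = let (u , v , p , q , e) = right model (s+<a r<) j< in
      u , v , new-in r< (<⇒≤ j<) p , new-in r< j< q , e
    newModel .down {r} {j} r< j< with down model (subst (_< a) (+-suc s r) (s+<a r<)) j<
    ... | u , v , p , q , e = u , v , new-in (<⇒≤ r<) j< p
      , new-in r< j< (trans q (cong (λ e → just (e , j)) (≡-sym (+-suc s r)))) , e

    rootedBand : ∀ {S} → P ⊆ S → RootedBand G S m b w
    rootedBand P⊆S = record
      { labels = labels ; model = gridModel-⊆ H⊆G newModel ; side = ρ ; border = border σ
      ; column = c ; column-inj = column-inj ; column-< = λ t → entry-< σ (entry t)
      ; roots = λ t → src (x t) , P⊆S _ (src-∈ (x t)) , new-part {t = t} (src-part (x t)) }
      where
      border : ∀ σ → sideRow σ ≡ 0 ⊎ sideRow σ ≡ m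
      border true  = inj₁ refl
      border false = inj₂ refl
      column-inj : Injective _≡_ _≡_ c
      -- Entries through the same border in one column share their outer end, which is the target of
      -- both parts.
      column-inj {t} {t′} e = x-inj (tgt-inj (entry-unique σ (entry t)
        (subst (Entry σ _ _) (≡-sym e) (entry t′))))

  -- The band lies beyond the cut, so each of the 2w targets enters by an essential edge, and w of
  -- them use the same border.
  band : ∀ {S} → P ⊆ S → ¬ ¬ RootedBand G S m b w
  band P⊆S done = menger K seps λ L → ¬¬-finite (w + w) (enter L) λ entries →
    let σ : Fin (w + w) → Bool
        σ t = proj₁ (proj₂ (proj₂ (entries t)))
        pick : ∀ (τ : Bool) (Q : VSet (w + w)) → (∀ t → t ∈ Q → σ t ≡ τ) → w ≤ size Q → ⊥
        pick τ Q h le = let (x , x-inj , x∈) = size-choose w Q le in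
          done (Rerouted.rootedBand L τ x x-inj (λ t → proj₁ (entries (x t)))
            (λ t → proj₁ (proj₂ (proj₂ (proj₂ (entries (x t))))))
            (λ t → proj₁ (proj₂ (entries (x t))))
            (λ t → subst (λ σ → Entry σ _ _ _) (h (x t) (x∈ t)) (proj₂ (proj₂ (proj₂ (proj₂ (entries (x t))))))) P⊆S)
    in case ≤-total w (size σ) of λ
      { (inj₁ le) → pick true σ (λ _ → id) le
      ; (inj₂ le) → pick false (∁ σ) (λ _ → not⁻) (+-cancelˡ-≤ w _ _ (≤-trans (≤-reflexive (≡-sym (size-full {w + w})))
          (≤-trans (size-cover {A = σ} {∁ σ} λ t _ → [ inj₁ , (λ p → inj₂ (not⁺ p)) ]′ (split (σ t))) (+-monoˡ-≤ _ le)))) }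
    where
    enter : ∀ (L : Linkage K (w + w) P U) t → ¬ ¬ (∃ λ v → adj H (Linkage.tgt L t) v ≡ true ×
      ∃ λ σ → ∃ λ c → Entry σ (Linkage.tgt L t) v c)
    enter L t done with ∧⁻ {not (N (Linkage.tgt L t))} (Linkage.tgt-∈ L t)
    ... | u∉N , p with some⁻ {f = λ v → N v ∧ adj H (Linkage.tgt L t) v} p
    ...   | v , q with ∧⁻ {N v} q
    ...     | v∈N , e = essential v (Linkage.tgt L t) (symm H e) (N-off v∈N) λ ess →
      done (v , e , classify ess v∈N (not⁻ u∉N))

-- Assembling the rooted grid

grouped-roots : ∀ {n} {G : Graph n} {S m b w} (R : RootedBand G S m b w) →
  Σ[ lab ∈ Labelling n ] (GridModel G (suc m) w lab × (∀ {q} → q < w → Rooted S lab (RootedBand.side R , q)))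
grouped-roots {n} {G} {S} {m} {b} {w} R = labels ⟫ group Q b , coarsen model (group-coarsening Q w≤) , roots′
  where
  open RootedBand R
  Q : ℕ → Bool
  Q c = some λ t → does (column t ℕ.≟ c)
  w≤ : w ≤ count Q b
  w≤ = subst (w ≤_) (size≡count Q b) (inj⇒≤size w (λ t → fromℕ< (column-< t))
    (λ {t} {t′} e → column-inj (trans (≡-sym (toℕ-fromℕ< (column-< t))) (trans (cong toℕ e) (toℕ-fromℕ< (column-< t′)))))
    λ t → some⁺ t (dec-true (column t ℕ.≟ _) (≡-sym (toℕ-fromℕ< (column-< t)))))
  roots′ : ∀ {q} → q < w → Rooted S (labels ⟫ group Q b) (side , q)
  roots′ q< with marked Q (≤-trans q< w≤)
  ... | c , c∈Q , e with some⁻ {f = λ t → does (column t ℕ.≟ c)} c∈Q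
  ...   | t , d with does⁻ (column t ℕ.≟ c) d
  ...     | refl = rooted-⟫ (group Q b) e (roots t)

top-rooted : ∀ {n} {G : Graph n} {S m b w} → RootedBand G S m b w →
  Σ[ lab ∈ Labelling n ] (GridModel G (suc m) w lab × (∀ {q} → q < w → Rooted S lab (0 , q)))
top-rooted {S = S} {m} {w = w} R with grouped-roots R | RootedBand.border R
... | lab , M , root | inj₁ top = lab , M , λ q< → subst (λ r → Rooted S lab (r , _)) top (root q<)
... | lab , M , root | inj₂ bottom = _ , coarsen (coarsen M (turn-coarsening (suc m) w)) (turn-coarsening w (suc m)) ,
  λ {q} q< → subst₂ (λ r c → Rooted S ((lab ⟫ turn (suc m)) ⟫ turn w) (r , c)) (n∸n≡0 m) (reflect q<)
    (rooted-⟫ (turn w) (turn-just _ (reflect-< q<)) (rooted-⟫ (turn (suc m)) (turn-just _ ≤-refl)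
      (subst (λ r → Rooted S lab (r , w ∸ suc q)) bottom (root (reflect-< q<)))))

-- Deciding whether a rooted model exists

walk? : ∀ {n} (G : Graph n) (s : Subset n) u v → u Subset.∈ s → Dec (Walk G (λ w → w Subset.∈ s) u v)
walk? G s u v u∈ with reachable G ⟦ s ⟧ u (∈⇒⟦⟧ u∈)
... | Y , u∈Y , walks , closed with split (Y v)
...   | inj₁ v∈Y = yes (walk-map (λ _ → ⟦⟧⇒∈) (λ _ _ _ _ → id) (walks v v∈Y))
...   | inj₂ v∉Y = no λ W → clash (walk-stays (λ x y p q → closed x y p (∈⇒⟦⟧ q)) W u∈Y) v∉Y

inducedConnected? : ∀ {n} (G : Graph n) (s : Subset n) → Dec (InducedConnected G s)
inducedConnected? G s = all? λ u → all? λ v → from u v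
  where
  from : ∀ u v → Dec (u Subset.∈ s → v Subset.∈ s → Walk G (λ w → w Subset.∈ s) u v)
  from u v with u Subset.∈? s
  ... | no ¬p = yes λ p → ⊥-elim (¬p p)
  ... | yes p with walk? G s u v p
  ...   | yes W = yes λ _ _ → W
  ...   | no ¬W with v Subset.∈? s
  ...     | yes q = no λ h → ¬W (h p q)
  ...     | no ¬q = yes λ _ q → ⊥-elim (¬q q)

anySubsets? : ∀ {n} h {P : Vec.Vec (Subset n) h → Set} → (∀ ss → Dec (P ss)) → Dec (∃ P)
anySubsets? zero    P? = map′ (λ p → Vec.[] , p) (λ { (Vec.[] , p) → p }) (P? Vec.[])
anySubsets? (suc h) P? = map′ (λ (s , ss , p) → s Vec.∷ ss , p) (λ { (s Vec.∷ ss , p) → s , ss , p })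
  (Subset.anySubset? λ s → anySubsets? h λ ss → P? (s Vec.∷ ss))

outerVertex? : ∀ ℓ x → Dec (OuterVertex ℓ x)
outerVertex? ℓ x = (_ ℕ.≟ _) ⊎-dec (_ ℕ.≟ _) ⊎-dec (_ ℕ.≟ _) ⊎-dec (_ ℕ.≟ _)

-- All conditions are decidable for given branch sets, and families of branch sets are searched as
-- vectors of subsets.
rootedModel? : ∀ {n} ℓ (G : Graph n) (S : Subset n) → Dec (Σ[ M ∈ Model (grid ℓ) G ] OuterRooted ℓ S M)
rootedModel? {n} ℓ G S = map′ toModel fromModel (anySubsets? (ℓ * ℓ) λ ss → branches? (Vec.lookup ss))
  where
  Single : Fin (ℓ * ℓ) → Subset n → Set
  Single x s = (∃ λ v → v Subset.∈ s) × InducedConnected G s ×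
    (OuterVertex ℓ x → ∃ λ v → v Subset.∈ s × v Subset.∈ S)
  Pair : (x y : Fin (ℓ * ℓ)) → Subset n → Subset n → Set
  Pair x y s t = (x ≢ y → ∀ v → v Subset.∈ s → v Subset.∉ t) ×
    (adj (grid ℓ) x y ≡ true → ∃ λ u → ∃ λ v → u Subset.∈ s × v Subset.∈ t × adj G u v ≡ true)
  Branches : (Fin (ℓ * ℓ) → Subset n) → Set
  Branches f = (∀ x → Single x (f x)) × (∀ x y → Pair x y (f x) (f y))
  branches? : ∀ f → Dec (Branches f)
  branches? f =
    (all? λ x → any? (λ v → v Subset.∈? f x) ×-dec inducedConnected? G (f x) ×-dec
      (outerVertex? ℓ x →-dec any? λ v → (v Subset.∈? f x) ×-dec (v Subset.∈? S)))
    ×-dec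
    (all? λ x → all? λ y →
      (¬? (x ≟ y) →-dec (all? λ v → (v Subset.∈? f x) →-dec ¬? (v Subset.∈? f y))) ×-dec
      ((adj (grid ℓ) x y Bool.≟ true) →-dec any? λ u → any? λ v →
        (u Subset.∈? f x) ×-dec (v Subset.∈? f y) ×-dec (adj G u v Bool.≟ true)))
  toModel : (∃ λ ss → Branches (Vec.lookup ss)) → Σ[ M ∈ Model (grid ℓ) G ] OuterRooted ℓ S M
  toModel (ss , single , pair) = record
    { B = Vec.lookup ss ; nonempty = proj₁ ∘ single ; conn = proj₁ ∘ proj₂ ∘ single
    ; disjoint = λ x y → proj₁ (pair x y) ; edges = λ x y → proj₂ (pair x y) }
    , λ x → proj₂ (proj₂ (single x))
  fromModel : Σ[ M ∈ Model (grid ℓ) G ] OuterRooted ℓ S M → ∃ λ ss → Branches (Vec.lookup ss)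
  fromModel (M , rooted) = Vec.tabulate (B M)
    , (λ x → subst (Single x) (look x) (nonempty M x , conn′ x , rooted x))
    , λ x y → subst₂ (Pair x y) (look x) (look y) (disjoint M x y , edges M x y)
    where
    look : ∀ x → B M x ≡ Vec.lookup (Vec.tabulate (B M)) x
    look x = ≡-sym (Vec.lookup∘tabulate (B M) x)
    conn′ : ∀ x → InducedConnected G (B M x)
    conn′ = Model.conn M

-- Removing an apex spares the columns: of an L × L grid with L = 8a all L columns remain.
linked⇒grid : ∀ {n f a L} (H : Graph n) {X} → GridBound L f → L ≡ ((a + a) + (a + a)) + ((a + a) + (a + a)) →
  3 * f + 1 ≤ size X → Linked H X → ¬ ¬ (Σ[ lab ∈ Labelling n ] GridModel H a L lab)
linked⇒grid {n} {f} {a} {L} H {X} bound L≡ large linked none =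
  linked⇒¬tw (linked-apex (linked-apex (linked-apex linked))) big (bound _ (apex (apex (apex H))) λ M →
    let (lab , N) = model⇒gridModel L M in
    none (remove-apex (remove-apex (remove-apex (lab , subst (λ r → GridModel _ r L lab) L≡ N)))))
  where
  big : 3 * suc f < size (withApex (withApex (withApex X)))
  big = subst₂ _<_ (≡-sym (*-suc 3 f)) (≡-sym (trans (size-withApex _)
          (cong suc (trans (size-withApex _) (cong suc (size-withApex X))))))
          (+-monoʳ-< 3 (≤-trans (≤-reflexive (+-comm 1 (3 * f))) large))

-- With k = 10ℓ, the bounds ask for a row missing three sets of k vertices (linkedness after a
-- deletion), a row missing two separators and one more vertex (uncrossing), a column missing a
-- separator, and k + 1 bands of 3ℓ rows.
rooted-grid : ∀ {n ℓ f a b} (G : Graph n) (S : Subset n) → 1 ≤ ℓ →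
  (let m = (ℓ + ℓ) + ℓ ; w = m + (ℓ + ℓ) ; k = w + w) →
  GridBound (suc b) f → suc b ≡ ((a + a) + (a + a)) + ((a + a) + (a + a)) →
  k + (k + k) < a → suc (k + k) < a → k < b → suc k * m ≤ a →
  Tangle G S (3 * f + 1) → ¬ ¬ (Σ[ M ∈ Model (grid ℓ) G ] OuterRooted ℓ S M)
rooted-grid {ℓ = suc ℓ} {f} {a} {b} G S 1≤ℓ bound L≡ 3k<a 2k<a k<b km≤a 𝒯 done =
  TangleLinked.linked G S (3 * f + 1) 𝒯 λ (X , X⊆S , large , linked) →
  linked⇒free-grid G 3k<a k<b (λ H → linked⇒grid H bound L≡ large) linked λ (lab , M , free) →
  tighten (≤-trans (s≤s (≤-trans (m≤m+n _ _) (n≤1+n _))) 2k<a) k<b M free λ (P , C , D , P⊆X , freeP , cut , le) →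
  trim G 2k<a k<b M freeP cut le λ τ →
  let (s , s+m≤a , clean) = clean-band _ km≤a k<b (Trimmed.model τ) (Trimmed.cut τ) (Trimmed.order≤ τ) in
  Band.band _ _ τ s s+m≤a clean (λ v p → X⊆S v (P⊆X v p)) λ R →
  let (_ , M₁ , top) = top-rooted R
      (_ , M₂ , outer) = frame (suc ℓ) 1≤ℓ M₁ top in
  done (gridModel⇒model M₂ outer)

theorem3p5 : ∀ (ℓ : ℕ) → 1 ≤ ℓ → ∀ (f : ℕ) → IsFGrid (6144 * ℓ ^ 4) f →
    ∀ (n : ℕ) (G : Graph n) (S : Subset n) → Tangle G S (3 * f + 1) →
    Σ (Model (grid ℓ) G) (λ M → OuterRooted ℓ S M)
theorem3p5 ℓ@(suc _) 1≤ℓ f (bound , _) n G S 𝒯 = decidable-stable (rootedModel? ℓ G S)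
  (rooted-grid G S 1≤ℓ (subst (λ L → GridBound L f) (trans rows (≡-sym suc-b)) bound) suc-b
    (≤-trans (s≤s (≤-reflexive (30ℓ ℓ))) (below 30 ℓ 1 ℓ≤p (m≤m+n 31 737)))
    (≤-trans (s≤s (s≤s (≤-reflexive (20ℓ ℓ)))) (below 20 ℓ 2 ℓ≤p (m≤m+n 22 746)))
    k<b
    (≤-trans (≤-reflexive (area ℓ)) (≤-trans (+-mono-≤ (*-monoʳ-≤ 30 ℓℓ≤p) (*-monoʳ-≤ 3 ℓ≤p))
      (≤-trans (≤-reflexive (≡-sym (*-distribʳ-+ p 30 3))) (*-monoˡ-≤ p (m≤m+n 33 735)))))
    𝒯)
  where
  p a k b : ℕ
  p = ℓ ^ 4
  a = 768 * p
  k = (((ℓ + ℓ) + ℓ) + (ℓ + ℓ)) + (((ℓ + ℓ) + ℓ) + (ℓ + ℓ))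
  -- One of the 8a columns is the spare one whose edges pruning deletes.
  b = pred (((a + a) + (a + a)) + ((a + a) + (a + a)))

  ℓ≤p : ℓ ≤ p
  ℓ≤p = subst (_≤ p) (^-identityʳ ℓ) (^-monoʳ-≤ ℓ {1} {4} (s≤s z≤n))
  ℓℓ≤p : ℓ * ℓ ≤ p
  ℓℓ≤p = subst (_≤ p) (cong (ℓ *_) (^-identityʳ ℓ)) (^-monoʳ-≤ ℓ {2} {4} (s≤s (s≤s z≤n)))
  1≤p : 1 ≤ p
  1≤p = ≤-trans 1≤ℓ ℓ≤p

  below : ∀ c x d → x ≤ p → c + d ≤ 768 → d + c * x ≤ a
  below c x d x≤p le = ≤-trans (+-mono-≤ (≤-trans (≤-reflexive (≡-sym (*-identityʳ d))) (*-monoʳ-≤ d 1≤p)) (*-monoʳ-≤ c x≤p))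
    (≤-trans (≤-reflexive (trans (≡-sym (*-distribʳ-+ p d c)) (cong (_* p) (+-comm d c)))) (*-monoˡ-≤ p le))

  rows : 6144 * p ≡ ((a + a) + (a + a)) + ((a + a) + (a + a))
  rows = trans (*-distribʳ-+ p 3072 3072) (cong₂ _+_ half half)
    where
    quarter : 1536 * p ≡ a + a
    quarter = *-distribʳ-+ p 768 768
    half : 3072 * p ≡ (a + a) + (a + a)
    half = trans (*-distribʳ-+ p 1536 1536) (cong₂ _+_ quarter quarter)

  1≤a : 1 ≤ a
  1≤a = ≤-trans 1≤p (m≤n*m p 768)
  a<8a : a < ((a + a) + (a + a)) + ((a + a) + (a + a))
  a<8a = ≤-trans (m<m+n a 1≤a) (≤-trans (m≤m+n (a + a) (a + a)) (m≤m+n ((a + a) + (a + a)) _))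
  suc-b : suc b ≡ ((a + a) + (a + a)) + ((a + a) + (a + a))
  suc-b = suc-pred _ {{ℕ.>-nonZero (≤-trans (s≤s z≤n) a<8a)}}

  30ℓ : ∀ x → (let w = ((x + x) + x) + (x + x)) → (w + w) + ((w + w) + (w + w)) ≡ 30 * x
  30ℓ = solve-∀
  20ℓ : ∀ x → (let w = ((x + x) + x) + (x + x)) → (w + w) + (w + w) ≡ 20 * x
  20ℓ = solve-∀
  area : ∀ x → (let w = ((x + x) + x) + (x + x)) → suc (w + w) * ((x + x) + x) ≡ 30 * (x * x) + 3 * x
  area = solve-∀

  k<b : k < b
  k<b = ≤-pred (≤-trans (s≤s (≤-trans (s≤s (≤-trans (m≤m+n k _) (≤-reflexive (30ℓ ℓ))))
    (below 30 ℓ 1 ℓ≤p (m≤m+n 31 737)))) (≤-trans a<8a (≤-reflexive (≡-sym suc-b))))
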